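{- Let $H$ be a hexagonal system that has a perfect matching. Then for every perfect matching $M$ of $H$ with $af(H,M)=Af(H)$ or $af(H,M)=Af(H)-1$, we have $af(H,M)=fr(H,M)$.
   Context: A hexagonal system is a 2-connected finite plane graph in which every interior face is bounded by a regular hexagon of side length one (equivalently, a cycle of the infinite hexagonal lattice together with its interior); its interior faces are called hexagons. For a perfect matching $M$ of a graph $G$, a cycle of $G$ is $M$-alternating if its edges alternate between $M$ and $E(G)\setminus M$. A set $S\subseteq E(G)\setminus M$ is an anti-forcing set of $M$ if $G-S$ has $M$ as its unique perfect matching; the anti-forcing number $af(G,M)$ is the minimum size of an anti-forcing set of $M$, and $Af(G)$ is the maximum of $af(G,M)$ over all perfect matchings $M$ of $G$. For a hexagonal system $H$ and perfect matching $M$, $fr(H,M)$ is the number of hexagons of $H$ that are $M$-alternating cycles. -}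

module Defs where

open import Data.Integer as ℤ using (ℤ; +_; _+_; _<_)
open import Data.Integer.Divisibility as ℤD using ()
open import Data.Nat as ℕ using (ℕ; suc; _%_; _≤_)
open import Data.Product using (Σ; Σ-syntax; _×_; _,_; proj₁; proj₂)
open import Data.Sum using (_⊎_; inj₁; inj₂)
open import Data.List using (List; []; _∷_; [_]; _++_; zip; length; filter)
open import Data.List.Membership.Propositional using (_∈_; _∉_)
open import Data.List.Relation.Unary.All using (All)
open import Data.List.Relation.Unary.Unique.Propositional using (Unique)
open import Relation.Binary.PropositionalEquality using (_≡_)
open import Relation.Nullary using (Dec; ¬_)
open import Data.Unit using (⊤)
open import Relation.Nullary.Decidable using (_×-dec_; _⊎-dec_)

-- The infinite hexagonal lattice, in "brick wall" coordinates.
-- Vertices: ℤ × ℤ.  Edges: every horizontal pair (x,y)-(x+1,y), and the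
-- vertical pair (x,y)-(x,y+1) exactly when x + y is even.  Every vertex
-- then has degree 3 and the bounded faces are the "bricks"
--   (x,y)-(x+1,y)-(x+2,y)-(x+2,y+1)-(x+1,y+1)-(x,y+1)   with x + y even,
-- which are the hexagons of the lattice.

Vtx : Set
Vtx = ℤ × ℤ

Even : ℤ → Set
Even z = (+ 2) ℤD.∣ z

data Edge : Set where
  hor : ℤ → ℤ → Edge
  ver : ℤ → ℤ → Edge

ends : Edge → Vtx × Vtx
ends (hor x y) = ((x , y) , (x + + 1 , y))
ends (ver x y) = ((x , y) , (x , y + + 1))

ValidEdge : Edge → Set
ValidEdge (hor x y) = ⊤
ValidEdge (ver x y) = Even (x + y)

Adjacent : Vtx → Vtx → Set
Adjacent u w = Σ[ e ∈ Edge ] (ValidEdge e × (ends e ≡ (u , w) ⊎ ends e ≡ (w , u)))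

Incident : Vtx → Edge → Set
Incident v e = proj₁ (ends e) ≡ v ⊎ proj₂ (ends e) ≡ v

-- A hexagon of the lattice is named by its lower-left corner (x,y), x+y even.
Hex : Set
Hex = ℤ × ℤ

ValidHex : Hex → Set
ValidHex (x , y) = Even (x + y)

e0 e1 e2 e3 e4 e5 : Hex → Edge
e0 (x , y) = hor x y
e1 (x , y) = hor (x + + 1) y
e2 (x , y) = ver (x + + 2) y
e3 (x , y) = hor (x + + 1) (y + + 1)
e4 (x , y) = hor x (y + + 1)
e5 (x , y) = ver x y

hexEdges : Hex → List Edge
hexEdges h = e0 h ∷ e1 h ∷ e2 h ∷ e3 h ∷ e4 h ∷ e5 h ∷ []

steps : List Vtx → List (Vtx × Vtx)
steps [] = []
steps (v ∷ vs) = zip (v ∷ vs) (vs ++ [ v ])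

record LatticeCycle : Set where
  field
    verts    : List Vtx
    long     : 3 ≤ length verts
    distinct : Unique verts
    adjacent : All (λ p → Adjacent (proj₁ p) (proj₂ p)) (steps verts)
open LatticeCycle public

-- The step p of the cycle crosses the horizontal ray emanating to the right
-- from the centre (x+1, y+1/2) of the hexagon (x,y): it is a vertical edge
-- spanning heights y..y+1 at abscissa > x+1.
Crosses : Hex → Vtx × Vtx → Set
Crosses (x , y) ((a , b) , (c , d)) =
  a ≡ c × (x + + 1) < a ×
  ((b ≡ y × d ≡ y + + 1) ⊎ (b ≡ y + + 1 × d ≡ y))

crosses? : (h : Hex) (p : Vtx × Vtx) → Dec (Crosses h p)
crosses? (x , y) ((a , b) , (c , d)) =
  (a ℤ.≟ c) ×-dec ((x + + 1) ℤ.<? a) ×-dec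
  (((b ℤ.≟ y) ×-dec (d ℤ.≟ y + + 1)) ⊎-dec ((b ℤ.≟ y + + 1) ×-dec (d ℤ.≟ y)))

crossings : LatticeCycle → Hex → ℕ
crossings C h = length (filter (crosses? h) (steps (verts C)))

-- A hexagon lies in the interior of C iff the ray from its centre
-- crosses C an odd number of times (Jordan crossing-number criterion).
Interior : LatticeCycle → Hex → Set
Interior C h = ValidHex h × crossings C h % 2 ≡ 1

-- The hexagonal system H(C) = C together with its interior.
-- Its hexagons are the interior hexagons; its edges/vertices are those
-- of its hexagons (which are exactly the lattice edges/vertices on or
-- inside C).

HexOf : LatticeCycle → Hex → Set
HexOf = Interior

EdgeOf : LatticeCycle → Edge → Set
EdgeOf C e = Σ[ h ∈ Hex ] (HexOf C h × e ∈ hexEdges h)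

VertexOf : LatticeCycle → Vtx → Set
VertexOf C v = Σ[ e ∈ Edge ] (EdgeOf C e × Incident v e)

PerfectMatching : LatticeCycle → List Edge → Set
PerfectMatching C M =
  (∀ e → e ∈ M → EdgeOf C e) ×
  (∀ v → VertexOf C v → Σ[ e ∈ Edge ] (e ∈ M × Incident v e)) ×
  (∀ v e e′ → e ∈ M → e′ ∈ M → Incident v e → Incident v e′ → e ≡ e′)

HasPerfectMatching : LatticeCycle → Set
HasPerfectMatching C = Σ[ M ∈ List Edge ] PerfectMatching C M

SameEdgeSet : List Edge → List Edge → Set
SameEdgeSet M M′ = ∀ e → (e ∈ M → e ∈ M′) × (e ∈ M′ → e ∈ M)

AntiForcingSet : LatticeCycle → List Edge → List Edge → Set
AntiForcingSet C M S =
  Unique S ×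
  (∀ e → e ∈ S → EdgeOf C e × e ∉ M) ×
  (∀ M′ → PerfectMatching C M′ → (∀ e → e ∈ M′ → e ∉ S) → SameEdgeSet M′ M)

AfM : LatticeCycle → List Edge → ℕ → Set
AfM C M k =
  (Σ[ S ∈ List Edge ] (AntiForcingSet C M S × length S ≡ k)) ×
  (∀ S → AntiForcingSet C M S → k ≤ length S)

AfMax : LatticeCycle → ℕ → Set
AfMax C k =
  (Σ[ M ∈ List Edge ] (PerfectMatching C M × AfM C M k)) ×
  (∀ M j → PerfectMatching C M → AfM C M j → j ≤ k)

Alternating : List Edge → Hex → Set
Alternating M h =
  (e0 h ∈ M × e1 h ∉ M × e2 h ∈ M × e3 h ∉ M × e4 h ∈ M × e5 h ∉ M) ⊎
  (e0 h ∉ M × e1 h ∈ M × e2 h ∉ M × e3 h ∈ M × e4 h ∉ M × e5 h ∈ M)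

Fr : LatticeCycle → List Edge → ℕ → Set
Fr C M k =
  Σ[ L ∈ List Hex ]
    (Unique L ×
     (∀ h → (h ∈ L → HexOf C h × Alternating M h) × (HexOf C h × Alternating M h → h ∈ L)) ×
     length L ≡ k)

{-# OPTIONS --safe #-}

-- Call the hexagons of the lattice nodes, and let a, b, c be three directions with a + b + c = 0. The arcs
-- u → u ⊕ a, u ⊕ b, u ⊕ c are dual to the edges of the lattice, and the three arcs around a vertex form
-- a directed cycle, exactly one arc of which is dual to an edge of M. Hence there is a height function on the
-- interior hexagons that rises by 1 along the arcs outside M and falls by 2 along those in M, and the
-- M-alternating hexagons are its local minima (sources) and maxima (peaks).
--
-- Each level line of the height (a contour) is a component of the symmetric difference of M with one of the
-- three periodic perfect matchings of the lattice. The closed contours are M-alternating cycles that are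
-- pairwise disjoint off M, so an anti-forcing set has an element on each of them. Conversely, flood the
-- hexagons from the exterior along the arcs outside M and, whenever stuck, backwards along a lowest arc
-- into the flooded part. The latter arcs lie on different closed contours; together with those obtained
-- after reversing all arcs they form an anti-forcing set. So af(H,M) is at most the number of these contours.
--
-- If all of them bound hexagons, then af(H,M) = fr(H,M). Otherwise some closed contour bounds a larger
-- basin. Replace M inside the basin by the periodic matching at its rim level: two out of three
-- hexagons of the basin become alternating. Counting edges of type b along the lines of direction b, there
-- are as many of these hexagons as edges of type b below the rim. Every contour destroyed contains
-- such an edge, and the contour of the basin contains three, so the new matching has at least two
-- additional disjoint contours, whence Af(H) is at least af(H,M) + 2.

module Submission where

open import Defs hiding (verts; long; distinct; adjacent)
open import Algebra.Bundles using (AbelianGroup)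
import Algebra.Properties.CommutativeSemigroup as CS
import Algebra.Properties.Group as GP
open import Data.Bool using (Bool; true; false; if_then_else_; _∨_; _∧_; not; _xor_)
import Data.Bool.Properties as BP
open import Data.Empty using (⊥; ⊥-elim)
import Data.Fin as Fin
import Data.Fin.Properties as FP
open import Data.Integer as ℤ using (ℤ; +_; -[1+_]; -1ℤ)
import Data.Integer.Divisibility.Signed as ℤSD
import Data.Integer.Properties as ℤP
open import Data.Integer.Solver using (module +-*-Solver)
open import Data.List using (List; []; _∷_; _++_; map; length; filter; lookup; deduplicate; concatMap; [_]; upTo; cartesianProduct; zip)
import Data.List.Properties as LP
open import Data.List.Membership.Propositional using (_∈_; _∉_; find)
open import Data.List.Membership.Propositional.Properties using (∈-∃++; ∈-++⁺ˡ; ∈-++⁺ʳ; ∈-++⁻; ∈-map⁺; ∈-map⁻; ∈-filter⁺; ∈-filter⁻; ∈-deduplicate⁺; ∈-concatMap⁺; ∈-upTo⁺; ∈-cartesianProduct⁺)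
open import Data.List.Relation.Unary.All as All using (All; []; _∷_)
import Data.List.Relation.Unary.All.Properties as AllP
open import Data.List.Relation.Unary.AllPairs as AllPairs using (AllPairs; []; _∷_)
import Data.List.Relation.Unary.AllPairs.Properties as AllPairsP
open import Data.List.Relation.Unary.Any as Any using (Any; here; there; index; any?)
open import Data.List.Relation.Unary.Any.Properties using (lookup-index)
open import Data.List.Relation.Unary.Unique.DecPropositional.Properties using (deduplicate-!)
open import Data.List.Relation.Unary.Unique.Propositional using (Unique)
import Data.List.Relation.Unary.Unique.Propositional.Properties as UniqueP
open import Data.Nat as ℕ using (ℕ; zero; suc; _≤_; _<_; z≤n; s≤s)
import Data.Nat.DivMod as DivMod
open import Data.Nat.Induction using (<-rec)
import Data.Nat.ListAction as LA
import Data.Nat.Properties as ℕP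
open import Data.Product using (Σ; ∃; _×_; _,_; proj₁; proj₂)
import Data.Product.Properties as ×P
open import Data.Sum using (_⊎_; inj₁; inj₂; [_,_]′)
open import Function using (_∘_; id; case_of_; mk⇔)
open import Relation.Binary.Definitions using (DecidableEquality)
open import Relation.Binary.PropositionalEquality using (_≡_; _≢_; refl; sym; trans; cong; cong₂; subst; subst₂; module ≡-Reasoning)
open import Relation.Nullary using (Dec; yes; no; ¬_; does)
open import Relation.Nullary.Decidable using (map′; dec-true; dec-false; does-⇔; _×-dec_; _⊎-dec_; ¬?)

open +-*-Solver using (solve; con; _:=_; _:+_; _:*_; _:-_; :-_)

-- The inside of a contour is never defined topologically. Two perfect matchings differ by a
-- potential, a third of the difference of their heights, normalized to vanish on the exterior. For
-- `φ` and its switch along a closed contour, this potential jumps by 1 across the contour and is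
-- constant along all other arcs outside `φ`; its sign replaces the Jordan curve theorem for
-- contours. Topology enters only through the cycle that bounds the system, in the form that the
-- exterior is connected: this makes potentials vanish outside and lets heights be single-valued
-- inside. The surplus of 2 arises as 3 - 1. A contour that encloses more than one hexagon has three
-- edges of type b on different lines, while every other destroyed contour is charged with a single
-- one; the contour itself is lost.

-- Booleans, directions, senses of rotation, hexagons and edges

absurdᵇ : ∀ {ℓ} {A : Set ℓ} {x : Bool} → x ≡ true → x ≡ false → A
absurdᵇ refl ()

split : ∀ x → x ≡ true ⊎ x ≡ false
split true = inj₁ refl
split false = inj₂ refl

does-true : ∀ {ℓ} {A : Set ℓ} (d : Dec A) → does d ≡ true → A
does-true (yes p) _ = p

does-false : ∀ {ℓ} {A : Set ℓ} (d : Dec A) → does d ≡ false → ¬ A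
does-false (no ¬p) _ = ¬p

-- The directions of the arcs of the triangular lattice of hexagons, in cyclic order.
data Dir : Set where
  a b c : Dir

-- A vertex of the hexagonal lattice is a triangle of hexagons, traversed by its three arcs in the
-- cyclic order of the directions (up) or in the reverse order (dn).
data Sense : Set where
  up dn : Sense

opp : Sense → Sense
opp up = dn
opp dn = up

rot : Sense → Dir → Dir
rot up a = b
rot up b = c
rot up c = a
rot dn a = c
rot dn b = a
rot dn c = b

opp² : ∀ s → opp (opp s) ≡ s
opp² up = refl
opp² dn = refl

rot-opp-rot : ∀ s x → rot (opp s) (rot s x) ≡ x
rot-opp-rot up a = refl
rot-opp-rot up b = refl
rot-opp-rot up c = refl
rot-opp-rot dn a = refl
rot-opp-rot dn b = refl
rot-opp-rot dn c = refl

rot-rot-opp : ∀ s x → rot s (rot (opp s) x) ≡ x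
rot-rot-opp s x = trans (cong (λ z → rot z (rot (opp s) x)) (sym (opp² s))) (rot-opp-rot (opp s) x)

rot-rot : ∀ s x → rot s (rot s x) ≡ rot (opp s) x
rot-rot up a = refl
rot-rot up b = refl
rot-rot up c = refl
rot-rot dn a = refl
rot-rot dn b = refl
rot-rot dn c = refl

iter : {A : Set} → ℕ → (A → A) → A → A
iter zero f x = x
iter (suc n) f x = f (iter n f x)

spin : ∀ s t t′ → ∃ λ n → iter n (rot s) t ≡ t′
spin up a a = 0 , refl
spin up a b = 1 , refl
spin up a c = 2 , refl
spin up b a = 2 , refl
spin up b b = 0 , refl
spin up b c = 1 , refl
spin up c a = 1 , refl
spin up c b = 2 , refl
spin up c c = 0 , refl
spin dn a a = 0 , refl
spin dn a b = 2 , refl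
spin dn a c = 1 , refl
spin dn b a = 1 , refl
spin dn b b = 0 , refl
spin dn b c = 2 , refl
spin dn c a = 2 , refl
spin dn c b = 1 , refl
spin dn c c = 0 , refl

_≟ˢ_ : DecidableEquality Sense
up ≟ˢ up = yes refl
up ≟ˢ dn = no λ ()
dn ≟ˢ up = no λ ()
dn ≟ˢ dn = yes refl

_≟ᴰ_ : DecidableEquality Dir
a ≟ᴰ a = yes refl
a ≟ᴰ b = no λ ()
a ≟ᴰ c = no λ ()
b ≟ᴰ a = no λ ()
b ≟ᴰ b = yes refl
b ≟ᴰ c = no λ ()
c ≟ᴰ a = no λ ()
c ≟ᴰ b = no λ ()
c ≟ᴰ c = yes refl

-- Hexagons in axial coordinates; they are converted to the brick coordinates of the definitions by pos.
Hx : Set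
Hx = ℤ × ℤ

-- The edge (u , x) separates the hexagons u and u ⊕ x.
Ed : Set
Ed = Hx × Dir

_≟ᴴ_ : DecidableEquality Hx
_≟ᴴ_ = ×P.≡-dec ℤ._≟_ ℤ._≟_

_≟ᴱ_ : DecidableEquality Ed
_≟ᴱ_ = ×P.≡-dec _≟ᴴ_ _≟ᴰ_

data One (p q r : Bool) : Set where
  one₁ : p ≡ true → q ≡ false → r ≡ false → One p q r
  one₂ : p ≡ false → q ≡ true → r ≡ false → One p q r
  one₃ : p ≡ false → q ≡ false → r ≡ true → One p q r

One-rot : ∀ {p q r} → One p q r → One q r p
One-rot (one₁ x y z) = one₃ y z x
One-rot (one₂ x y z) = one₁ y z x
One-rot (one₃ x y z) = one₂ y z x

One-swap : ∀ {p q r} → One p q r → One p r q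
One-swap (one₁ x y z) = one₁ x z y
One-swap (one₂ x y z) = one₃ x z y
One-swap (one₃ x y z) = one₂ x z y

val : Bool → ℤ
val true = + 1
val false = + 0

val-injective : ∀ x y → val x ≡ val y → x ≡ y
val-injective true true _ = refl
val-injective false false _ = refl

-- Iterated maps, periodic orbits and sums over lists

module _ {A : Set} where

  iter-+ : ∀ m n (f : A → A) x → iter (m ℕ.+ n) f x ≡ iter m f (iter n f x)
  iter-+ zero n f x = refl
  iter-+ (suc m) n f x = cong f (iter-+ m n f x)

  iter-comm : ∀ n (f : A → A) x → iter n f (f x) ≡ f (iter n f x)
  iter-comm zero f x = refl
  iter-comm (suc n) f x = cong f (iter-comm n f x)

  iter-invariant : (f : A → A) (P : A → Set) → (∀ x → P x → P (f x)) → ∀ n x → P x → P (iter n f x)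
  iter-invariant f P s zero x p = p
  iter-invariant f P s (suc n) x p = s _ (iter-invariant f P s n x p)

  module Period (f : A → A) (e : A) (p : ℕ) (per : iter (suc p) f e ≡ e) where
    P : ℕ
    P = suc p

    iter-multiple : ∀ k → iter (k ℕ.* P) f e ≡ e
    iter-multiple zero = refl
    iter-multiple (suc k) = trans (iter-+ P (k ℕ.* P) f e) (trans (cong (iter P f) (iter-multiple k)) per)

    -- Since `n` is at most the multiple `n * P` of the period, the missing `n * P ∸ n` steps lead
    -- home. Reachability within a periodic orbit is therefore symmetric.
    back : ∀ n → ∃ λ m → iter m f (iter n f e) ≡ e
    back n = n ℕ.* P ℕ.∸ n , trans (sym (iter-+ (n ℕ.* P ℕ.∸ n) n f e))
      (trans (cong (λ k → iter k f e) (ℕP.m∸n+n≡m (ℕP.m≤m*n n P))) (iter-multiple n))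

    reduce : ∀ n → ∃ λ m → m < P × iter n f e ≡ iter m f e
    reduce n = n ℕ.% P , DivMod.m%n<n n P , (begin
      iter n f e ≡⟨ cong (λ k → iter k f e) (DivMod.m≡m%n+[m/n]*n n P) ⟩
      iter (n ℕ.% P ℕ.+ (n ℕ./ P) ℕ.* P) f e ≡⟨ iter-+ (n ℕ.% P) _ f e ⟩
      iter (n ℕ.% P) f (iter ((n ℕ./ P) ℕ.* P) f e) ≡⟨ cong (iter (n ℕ.% P) f) (iter-multiple (n ℕ./ P)) ⟩
      iter (n ℕ.% P) f e ∎)
      where open ≡-Reasoning

    reach? : DecidableEquality A → ∀ y → Dec (∃ λ n → iter n f e ≡ y)
    reach? _≟_ y = map′ (λ { (n , _ , q) → n , q })
      (λ { (n , q) → let m , m<P , r = reduce n in m , m<P , trans (sym r) q })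
      (ℕP.anyUpTo? (λ n → iter n f e ≟ y) P)

  sequence-repeats : (s : ℕ → A) (xs : List A) → (∀ n → s n ∈ xs) → ∃ λ i → ∃ λ j → i < j × s i ≡ s j
  sequence-repeats s xs s∈ =
    let i , j , i<j , eq = FP.pigeonhole (ℕP.n<1+n (length xs)) (λ k → index (s∈ (Fin.toℕ k)))
    in Fin.toℕ i , Fin.toℕ j , i<j ,
       trans (lookup-index (s∈ (Fin.toℕ i))) (trans (cong (lookup xs) eq) (sym (lookup-index (s∈ (Fin.toℕ j)))))

  -- Each `x` with nonzero value is deleted from `ys`; uniqueness keeps the rest of `xs` inside what
  -- remains. For constant `G` this compares lengths, and for `fill` it makes the sum independent of
  -- the list that carries the support.
  sum-mono-support : (G : A → ℕ) → (∀ x → Dec (G x ≡ 0)) → ∀ xs ys → Unique xs →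
    (∀ x → x ∈ xs → G x ≢ 0 → x ∈ ys) → LA.sum (map G xs) ≤ LA.sum (map G ys)
  sum-mono-support G G? [] ys u h = z≤n
  sum-mono-support G G? (x ∷ xs) ys (x∉ ∷ u) h with G? x
  ... | yes z = subst (λ k → k ℕ.+ LA.sum (map G xs) ≤ LA.sum (map G ys)) (sym z)
                  (sum-mono-support G G? xs ys u (λ y m → h y (there m)))
  ... | no nz with ∈-∃++ (h x (here refl) nz)
  ... | ys₁ , ys₂ , refl = subst (G x ℕ.+ LA.sum (map G xs) ≤_) (sym eq) (ℕP.+-monoʳ-≤ (G x)
          (sum-mono-support G G? xs (ys₁ ++ ys₂) u rest))
    where
    eq : LA.sum (map G (ys₁ ++ x ∷ ys₂)) ≡ G x ℕ.+ LA.sum (map G (ys₁ ++ ys₂))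
    eq = begin
      LA.sum (map G (ys₁ ++ x ∷ ys₂)) ≡⟨ sumapp ys₁ (x ∷ ys₂) ⟩
      LA.sum (map G ys₁) ℕ.+ (G x ℕ.+ LA.sum (map G ys₂)) ≡⟨ sym (ℕP.+-assoc (LA.sum (map G ys₁)) _ _) ⟩
      (LA.sum (map G ys₁) ℕ.+ G x) ℕ.+ LA.sum (map G ys₂)
        ≡⟨ cong (ℕ._+ LA.sum (map G ys₂)) (ℕP.+-comm (LA.sum (map G ys₁)) _) ⟩
      (G x ℕ.+ LA.sum (map G ys₁)) ℕ.+ LA.sum (map G ys₂) ≡⟨ ℕP.+-assoc (G x) _ _ ⟩
      G x ℕ.+ (LA.sum (map G ys₁) ℕ.+ LA.sum (map G ys₂)) ≡⟨ cong (G x ℕ.+_) (sym (sumapp ys₁ ys₂)) ⟩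
      G x ℕ.+ LA.sum (map G (ys₁ ++ ys₂)) ∎
      where
      open ≡-Reasoning
      sumapp : ∀ us vs → LA.sum (map G (us ++ vs)) ≡ LA.sum (map G us) ℕ.+ LA.sum (map G vs)
      sumapp [] vs = refl
      sumapp (u ∷ us) vs = trans (cong (G u ℕ.+_) (sumapp us vs)) (sym (ℕP.+-assoc (G u) _ _))
    rest : ∀ y → y ∈ xs → G y ≢ 0 → y ∈ ys₁ ++ ys₂
    rest y m g with ∈-++⁻ ys₁ (h y (there m) g)
    ... | inj₁ q = ∈-++⁺ˡ q
    ... | inj₂ (here refl) = ⊥-elim (All.lookup x∉ m refl)
    ... | inj₂ (there q) = ∈-++⁺ʳ ys₁ q

  sum-support : (G : A → ℕ) → ∀ xs ys → Unique xs → Unique ys →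
    (∀ x → G x ≢ 0 → x ∈ xs × x ∈ ys) → LA.sum (map G xs) ≡ LA.sum (map G ys)
  sum-support G xs ys u v h = ℕP.≤-antisym
    (sum-mono-support G (λ x → G x ℕP.≟ 0) xs ys u (λ x _ g → proj₂ (h x g)))
    (sum-mono-support G (λ x → G x ℕP.≟ 0) ys xs v (λ x _ g → proj₁ (h x g)))

  Unique-⊆-length : ∀ {xs ys : List A} → Unique xs → (∀ x → x ∈ xs → x ∈ ys) → length xs ≤ length ys
  Unique-⊆-length {xs} {ys} u h = ℕP.≤-trans (ℕP.≤-reflexive (sym (sum1 xs)))
    (ℕP.≤-trans (sum-mono-support (λ _ → 1) (λ _ → no λ ()) xs ys u (λ x m _ → h x m)) (ℕP.≤-reflexive (sum1 ys)))
    where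
    sum1 : ∀ zs → LA.sum (map (λ _ → 1) zs) ≡ length zs
    sum1 [] = refl
    sum1 (z ∷ zs) = cong suc (sum1 zs)

-- Residues modulo 3, counting and choice from finite lists

-- Dir doubles as ℤ/3, with a, b, c for 0, 1, 2.
residue : ℕ → Dir
residue zero = a
residue (suc n) = rot up (residue n)

is-a is-b : Dir → Bool
is-a a = true
is-a b = false
is-a c = false
is-b a = false
is-b b = true
is-b c = false

-- The floor of `(n + 1) / 3` increases from `n` to `n + 1` exactly when `n` is 1 modulo 3, that is,
-- when `residue n` is b.
carry : Dir → ℕ
carry a = 0
carry b = 1
carry c = 0

⌊1+_/3⌋ : ℕ → ℕ
⌊1+ zero /3⌋ = 0
⌊1+ suc n /3⌋ = carry (residue n) ℕ.+ ⌊1+ n /3⌋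

count : {A : Set} → (A → Bool) → List A → ℕ
count p xs = LA.sum (map (λ x → if p x then 1 else 0) xs)

module _ {A : Set} (p : A → Bool) where

  count-filter : ∀ xs → length (filter (λ x → p x BP.≟ true) xs) ≡ count p xs
  count-filter [] = refl
  count-filter (x ∷ xs) with p x
  ... | true = cong suc (count-filter xs)
  ... | false = count-filter xs

  Unique-count : ∀ {xs ys} → Unique xs → (∀ x → x ∈ xs → x ∈ ys × p x ≡ true) → length xs ≤ count p ys
  Unique-count {ys = ys} u h = ℕP.≤-trans (Unique-⊆-length u (λ x m → let q , r = h x m in ∈-filter⁺ (λ x → p x BP.≟ true) q r))
    (ℕP.≤-reflexive (count-filter ys))

sum-map-+ : {A : Set} (f g : A → ℕ) → ∀ xs → LA.sum (map (λ x → f x ℕ.+ g x) xs)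
  ≡ LA.sum (map f xs) ℕ.+ LA.sum (map g xs)
sum-map-+ f g [] = refl
sum-map-+ f g (x ∷ xs) = begin
  f x ℕ.+ g x ℕ.+ LA.sum (map (λ x → f x ℕ.+ g x) xs) ≡⟨ cong (f x ℕ.+ g x ℕ.+_) (sum-map-+ f g xs) ⟩
  f x ℕ.+ g x ℕ.+ (LA.sum (map f xs) ℕ.+ LA.sum (map g xs))
    ≡⟨ CS.interchange ℕP.+-commutativeSemigroup (f x) (g x) _ _ ⟩
  f x ℕ.+ LA.sum (map f xs) ℕ.+ (g x ℕ.+ LA.sum (map g xs)) ∎
  where open ≡-Reasoning

sum-map-cong : {A : Set} {f g : A → ℕ} → (∀ x → f x ≡ g x) → ∀ xs → LA.sum (map f xs) ≡ LA.sum (map g xs)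
sum-map-cong h xs = cong LA.sum (LP.map-cong h xs)

anyDir? : {P : Dir → Set} → (∀ t → Dec (P t)) → Dec (∃ P)
anyDir? {P} d = map′ to from (d a ⊎-dec d b ⊎-dec d c)
  where
  to : P a ⊎ P b ⊎ P c → ∃ P
  to (inj₁ p) = a , p
  to (inj₂ (inj₁ p)) = b , p
  to (inj₂ (inj₂ p)) = c , p
  from : ∃ P → P a ⊎ P b ⊎ P c
  from (a , p) = inj₁ p
  from (b , p) = inj₂ (inj₁ p)
  from (c , p) = inj₂ (inj₂ p)

lowest : {A : Set} {P : A → Set} → (∀ x → Dec (P x)) → (h : A → ℤ) → ∀ xs → Any P xs →
  ∃ λ x → x ∈ xs × P x × (∀ y → y ∈ xs → P y → h x ℤ.≤ h y)
lowest {P = P} P? h (x ∷ xs) p∈ with any? P? xs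
lowest {P = P} P? h (x ∷ xs) (here p) | no ¬q =
  x , here refl , p , λ { _ (here refl) _ → ℤP.≤-refl ; y (there m) r → ⊥-elim (¬q (Any.map (λ { refl → r }) m)) }
lowest {P = P} P? h (x ∷ xs) (there q) | no ¬q = ⊥-elim (¬q q)
lowest {P = P} P? h (x ∷ xs) _ | yes q with lowest P? h xs q | P? x
... | y , y∈ , p , min | no ¬p = y , there y∈ , p ,
  λ { _ (here refl) r → ⊥-elim (¬p r) ; z (there m) r → min z m r }
... | y , y∈ , p , min | yes p′ with h x ℤ.≤? h y
... | yes le = x , here refl , p′ , λ { _ (here refl) _ → ℤP.≤-refl ; z (there m) r → ℤP.≤-trans le (min z m r) }
... | no gt = y , there y∈ , p , λ { _ (here refl) _ → ℤP.<⇒≤ (ℤP.≰⇒> gt) ; z (there m) r → min z m r }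

-- Integer inequalities, depths and reordering of families

i<suc[i] : ∀ i → i ℤ.< ℤ.suc i
i<suc[i] i = ℤP.≤∧≢⇒< (ℤP.i≤suc[i] i) ℤP.i≢suc[i]

val-same : ∀ x y p q → x ℤ.+ val p ≡ y ℤ.+ val q → p ≡ q → x ≡ y
val-same x y p .p eq refl = begin
  x ≡⟨ sym (ℤP.+-identityʳ x) ⟩
  x ℤ.+ + 0 ≡⟨ cong (λ k → x ℤ.+ k) (sym (ℤP.+-inverseʳ (val p))) ⟩
  x ℤ.+ (val p ℤ.- val p) ≡⟨ sym (ℤP.+-assoc x (val p) (ℤ.- val p)) ⟩
  x ℤ.+ val p ℤ.- val p ≡⟨ cong (ℤ._- val p) eq ⟩
  y ℤ.+ val p ℤ.- val p ≡⟨ ℤP.+-assoc y (val p) (ℤ.- val p) ⟩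
  y ℤ.+ (val p ℤ.- val p) ≡⟨ cong (λ k → y ℤ.+ k) (ℤP.+-inverseʳ (val p)) ⟩
  y ℤ.+ + 0 ≡⟨ ℤP.+-identityʳ y ⟩
  y ∎
  where open ≡-Reasoning

val-drop : ∀ x y p q → x ℤ.+ val p ≡ y ℤ.+ val q → p ≡ true → q ≡ false → y ≡ ℤ.suc x
val-drop x y true false eq refl refl = trans (sym (ℤP.+-identityʳ y)) (trans (sym eq) (ℤP.+-comm x (+ 1)))

val-drops : ∀ {x y} p q → x ℤ.+ val p ≡ y ℤ.+ val q → x ℤ.< y → p ≡ true × q ≡ false
val-drops true false eq lt = refl , refl
val-drops true true eq lt = ⊥-elim (ℤP.<-irrefl (val-same _ _ true true eq refl) lt)
val-drops false false eq lt = ⊥-elim (ℤP.<-irrefl (val-same _ _ false false eq refl) lt)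
val-drops {x} {y} false true eq lt =
  ⊥-elim (ℤP.<-asym lt (subst (y ℤ.<_) (sym (val-drop y x true false (sym eq) refl refl)) (i<suc[i] y)))

i<suc[j]⇒i≤j : ∀ {i j} → i ℤ.< ℤ.suc j → i ℤ.≤ j
i<suc[j]⇒i≤j {i} {j} lt = subst (i ℤ.≤_) (ℤP.pred-suc j) (ℤP.i<j⇒i≤pred[j] lt)

-- It matters only for `x` at most `k`, where the absolute value is the plain difference. A natural
-- number allows recursion modulo 3.
below : ℤ → ℤ → ℕ
below k x = ℤ.∣ k ℤ.- x ∣

below-self : ∀ k → below k k ≡ 0
below-self k = cong ℤ.∣_∣ (ℤP.+-inverseʳ k)

below-suc : ∀ k x → ℤ.suc x ℤ.≤ k → below k x ≡ suc (below k (ℤ.suc x))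
below-suc k x le = begin
  ℤ.∣ k ℤ.- x ∣ ≡⟨ cong ℤ.∣_∣ (solve 2 (λ k x → k :- x := con (+ 1) :+ (k :- (con (+ 1) :+ x))) refl k x) ⟩
  ℤ.∣ + 1 ℤ.+ (k ℤ.- ℤ.suc x) ∣ ≡⟨ cong (λ z → ℤ.∣ + 1 ℤ.+ z ∣) (sym (ℤP.0≤i⇒+∣i∣≡i (ℤP.i≤j⇒0≤j-i le))) ⟩
  suc (below k (ℤ.suc x)) ∎
  where open ≡-Reasoning

below-≤1 : ∀ k x → x ℤ.≤ k → k ℤ.< ℤ.suc (ℤ.suc x) → below k x ≤ 1
below-≤1 k x le lt with k ℤ.≤? x
... | yes q = ℕP.≤-trans (ℕP.≤-reflexive (trans (cong (λ z → below z x) (ℤP.≤-antisym q le)) (below-self x))) z≤n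
... | no q = ℕP.≤-reflexive (trans (below-suc k x (ℤP.i<j⇒suc[i]≤j (ℤP.≰⇒> q)))
      (cong suc (trans (cong (below k) (ℤP.≤-antisym (ℤP.i<j⇒suc[i]≤j (ℤP.≰⇒> q)) (i<suc[j]⇒i≤j lt)))
        (below-self k))))

-- Moving an element to the front reverses some pairs, so `R` must be symmetric. It is so only under
-- `Q`, which will be closedness: `SameContour` can be reversed once the orbit is periodic.
bring : ∀ {R : Ed → Ed → Set} {Q : Ed → Set} → (∀ {x y} → Q x → Q y → R x y → R y x) →
  ∀ {e xs} → e ∈ xs → All Q xs → AllPairs R xs →
  Σ (List Ed) λ ys → (∀ (P : Ed → Set) → All P xs → All P (e ∷ ys)) × AllPairs R (e ∷ ys) × length (e ∷ ys)
    ≡ length xs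
bring s (here refl) qs rs = _ , (λ P ps → ps) , rs , refl
bring {R} s {e} (there {x} m) (q ∷ qs) (r ∷ rs) with bring s m qs rs
... | ys , tr , d ∷ ds , len =
  x ∷ ys , (λ { P (p ∷ ps) → All.head (tr P ps) ∷ p ∷ All.tail (tr P ps) }) ,
     ((s q (All.head (tr _ qs)) (All.head (tr (R x) r)) ∷ d) ∷ All.tail (tr (R x) r) ∷ ds) , cong suc len

-- The abstract lattice and its dual

Matching : Set
Matching = Hx → Dir → Bool

-- All laws are given for both `_⊕_` and `_⊖_`, so that `dualLattice` can exchange them and each
-- result on sources yields one on peaks. The arcs whose tails have a fixed `colour` form a periodic
-- matching; `row` labels the lines in direction b.
record Lattice : Set where
  infixl 6 _⊕_ _⊖_
  field
    _⊕_ _⊖_ : Hx → Dir → Hx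
    ⊕⊖ : ∀ x t → x ⊕ t ⊖ t ≡ x
    ⊖⊕ : ∀ x t → x ⊖ t ⊕ t ≡ x
    ⊕-comm : ∀ x s t → x ⊕ s ⊕ t ≡ x ⊕ t ⊕ s
    ⊖-comm : ∀ x s t → x ⊖ s ⊖ t ≡ x ⊖ t ⊖ s
    ⊕-tri : ∀ s x t → x ⊕ t ⊕ rot s t ⊕ rot (opp s) t ≡ x
    ⊖-tri : ∀ s x t → x ⊖ t ⊖ rot s t ⊖ rot (opp s) t ≡ x
    colour : Hx → Dir
    ⊕-colour : ∀ x t → colour (x ⊕ t) ≢ colour x
    ⊖-colour : ∀ x t → colour (x ⊖ t) ≢ colour x
    ⊕-colour³ : ∀ x r s t → colour (x ⊕ r ⊕ s ⊕ t) ≡ colour x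
    ⊖-colour³ : ∀ x r s t → colour (x ⊖ r ⊖ s ⊖ t) ≡ colour x
    row : Hx → ℤ
    ⊕-row : ∀ x → row (x ⊕ b) ≡ row x
    ⊖-row : ∀ x → row (x ⊖ b) ≡ row x
    ⊕-rows : ∀ x → row x ≢ row (x ⊕ a) × row x ≢ row (x ⊕ c) × row (x ⊕ a) ≢ row (x ⊕ c)
    ⊖-rows : ∀ x → row x ≢ row (x ⊖ a) × row x ≢ row (x ⊖ c) × row (x ⊖ a) ≢ row (x ⊖ c)
    I : Hx → Bool
    cells : List Hx
    cells-complete : ∀ x → I x ≡ true → x ∈ cells
    cells-sound : ∀ x → x ∈ cells → I x ≡ true
    cells-unique : Unique cells
    ⊕-escape : ∀ x → ∃ λ n → I (iter n (_⊕ b) x) ≡ false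
    ⊖-escape : ∀ x → ∃ λ n → I (iter n (_⊖ b) x) ≡ false

dualLattice : Lattice → Lattice
dualLattice L = record
  { _⊕_ = _⊖_ ; _⊖_ = _⊕_ ; ⊕⊖ = ⊖⊕ ; ⊖⊕ = ⊕⊖ ; ⊕-comm = ⊖-comm ; ⊖-comm = ⊕-comm
  ; ⊕-tri = ⊖-tri ; ⊖-tri = ⊕-tri ; colour = colour ; ⊕-colour = ⊖-colour ; ⊖-colour = ⊕-colour
  ; ⊕-colour³ = ⊖-colour³ ; ⊖-colour³ = ⊕-colour³ ; row = row ; ⊕-row = ⊖-row ; ⊖-row = ⊕-row
  ; ⊕-rows = ⊖-rows ; ⊖-rows = ⊕-rows ; I = I ; cells = cells ; cells-complete = cells-complete
  ; cells-sound = cells-sound ; cells-unique = cells-unique ; ⊕-escape = ⊖-escape ; ⊖-escape = ⊕-escape }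
  where open Lattice L

-- Matchings and the contours of a matching

module Contours (L : Lattice) where
  open Lattice L public

  Int Ext : Hx → Set
  Int x = I x ≡ true
  Ext x = I x ≡ false

  int? : ∀ x → Int x ⊎ Ext x
  int? x with I x
  ... | true = inj₁ refl
  ... | false = inj₂ refl

  HEdge : Ed → Set
  HEdge (u , x) = Int u ⊎ Int (u ⊕ x)

  -- The three arcs around one end of the edge `(u , x)`; the sense selects the end.
  OneAt : Matching → Sense → Hx → Dir → Set
  OneAt F s u x = One (F u x) (F (u ⊕ x) (rot s x)) (F (u ⊕ x ⊕ rot s x) (rot (opp s) x))

  OneAt-rot : ∀ F s u x → OneAt F s (u ⊕ x) (rot s x) → OneAt F s u x
  OneAt-rot F s u x o = One-rot (One-rot
      (subst (λ k → One (F (u ⊕ x) (rot s x)) (F (u ⊕ x ⊕ rot s x) (rot (opp s) x)) k) eq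
        (subst (λ y → One (F (u ⊕ x) (rot s x)) (F (u ⊕ x ⊕ rot s x) y)
           (F (u ⊕ x ⊕ rot s x ⊕ y) (rot (opp s) (rot s x)))) (rot-rot s x) o)))
    where
    eq : F (u ⊕ x ⊕ rot s x ⊕ rot (opp s) x) (rot (opp s) (rot s x)) ≡ F u x
    eq = cong₂ F (⊕-tri s u x) (rot-opp-rot s x)

  -- A perfect matching of the system, viewed in the infinite lattice: `one` covers the vertices
  -- with an interior hexagon, and `inside` forbids edges between two exterior hexagons.
  record PM (φ : Matching) : Set where
    field
      inside : ∀ u x → φ u x ≡ true → HEdge (u , x)
      one : ∀ s u x → Int u → OneAt φ s u x

  at : Matching → Ed → Bool
  at φ (u , x) = φ u x

  AntiForcing : Matching → List Ed → Set
  AntiForcing φ S = All (λ e → at φ e ≡ false) S ×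
    (∀ φ′ → PM φ′ → All (λ e → at φ′ e ≡ false) S → ∀ u x → φ′ u x ≡ φ u x)

  -- The contour of M through an edge outside M is its component in the symmetric difference of M
  -- with the periodic perfect matching of the lattice that contains the edge; nxt crosses the M-edge
  -- met at one of the two ends, which is selected by the sense.
  nxt : Sense → Matching → Ed → Ed
  nxt s φ (u , x) =
    if φ (u ⊕ x) (rot s x) then (u ⊕ x ⊕ rot s x ⊕ x , rot (opp s) x) else (u , rot s x)

  nxt-true : ∀ s φ u x → φ (u ⊕ x) (rot s x) ≡ true → nxt s φ (u , x) ≡ (u ⊕ x ⊕ rot s x ⊕ x , rot (opp s) x)
  nxt-true s φ u x eq rewrite eq = refl

  nxt-false : ∀ s φ u x → φ (u ⊕ x) (rot s x) ≡ false → nxt s φ (u , x) ≡ (u , rot s x)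
  nxt-false s φ u x eq rewrite eq = refl

  third : ∀ s u x → u ⊕ x ⊕ rot s x ≡ u ⊖ rot (opp s) x
  third s u x = trans (sym (⊕⊖ _ (rot (opp s) x))) (cong (_⊖ rot (opp s) x) (⊕-tri s u x))

  SameContour : Sense → Matching → Ed → Ed → Set
  SameContour s φ e e′ = ∃ λ n → iter n (nxt s φ) e ≡ e′

  record Closed (s : Sense) (φ : Matching) (e : Ed) : Set where
    field
      p : ℕ
      period : iter (suc p) (nxt s φ) e ≡ e
      hedge : ∀ n → HEdge (iter n (nxt s φ) e)
      free : ∀ n → at φ (iter n (nxt s φ) e) ≡ false

  module Matched {φ : Matching} (pm : PM φ) where
    open PM pm public

    one′ : ∀ s u x → HEdge (u , x) → OneAt φ s u x
    one′ s u x (inj₁ i) = one s u x i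
    one′ s u x (inj₂ i) = OneAt-rot φ s u x (one s (u ⊕ x) (rot s x) i)

    -- The two cases of nxt at an edge u → v outside M; t is the third hexagon at the end of the edge.
    data Turn (s : Sense) (u : Hx) (x : Dir) : Set where
      across : (t : Hx) → t ≡ u ⊕ x ⊕ rot s x → t ⊕ rot (opp s) x ≡ u →
        φ (u ⊕ x) (rot s x) ≡ true → φ t (rot (opp s) x) ≡ false → φ t x ≡ false →
        φ (t ⊕ x) (rot (opp s) x) ≡ false → t ⊕ x ⊕ rot (opp s) x ≡ u ⊕ x →
        nxt s φ (u , x) ≡ (t ⊕ x , rot (opp s) x) → Turn s u x
      around : (t : Hx) → t ≡ u ⊕ x ⊕ rot s x → t ⊕ rot (opp s) x ≡ u →
        φ (u ⊕ x) (rot s x) ≡ false → φ t (rot (opp s) x) ≡ true → φ u (rot s x) ≡ false →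
        φ (u ⊕ rot s x) x ≡ false → nxt s φ (u , x) ≡ (u , rot s x) → Turn s u x

    turn : ∀ s u x → HEdge (u , x) → φ u x ≡ false → Turn s u x
    turn s u x h fr with one′ s u x h
    ... | one₁ p q r = absurdᵇ p fr
    ... | one₂ p q r = across (u ⊕ x ⊕ rot s x) refl (⊕-tri s u x) q r (proj₁ fs) (proj₂ fs)
            eq (nxt-true s φ u x q)
      where
      eq : u ⊕ x ⊕ rot s x ⊕ x ⊕ rot (opp s) x ≡ u ⊕ x
      eq = trans (⊕-comm (u ⊕ x ⊕ rot s x) x (rot (opp s) x)) (cong (_⊕ x) (⊕-tri s u x))
      fs : φ (u ⊕ x ⊕ rot s x) x ≡ false × φ (u ⊕ x ⊕ rot s x ⊕ x) (rot (opp s) x) ≡ false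
      fs with one′ (opp s) (u ⊕ x) (rot s x) (inside _ _ q)
      ... | one₂ o _ _ = absurdᵇ q o
      ... | one₃ o _ _ = absurdᵇ q o
      ... | one₁ _ y z = trans (cong (φ (u ⊕ x ⊕ rot s x)) (sym (rot-opp-rot s x))) y ,
             trans (cong₂ φ (cong (u ⊕ x ⊕ rot s x ⊕_) (sym (rot-opp-rot s x)))
                            (trans (sym (rot-rot s x)) (cong (λ k → rot k (rot s x)) (sym (opp² s))))) z
    ... | one₃ p q r = around (u ⊕ x ⊕ rot s x) refl (⊕-tri s u x) q r (proj₁ fs) (proj₂ fs) (nxt-false s φ u x q)
      where
      t = u ⊕ x ⊕ rot s x
      fs : φ u (rot s x) ≡ false × φ (u ⊕ rot s x) x ≡ false
      fs with one′ (opp s) t (rot (opp s) x) (inside _ _ r)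
      ... | one₂ o _ _ = absurdᵇ r o
      ... | one₃ o _ _ = absurdᵇ r o
      ... | one₁ _ y z = trans (cong₂ φ (sym (⊕-tri s u x)) (sym e₁)) y ,
             trans (cong₂ φ (cong₂ _⊕_ (sym (⊕-tri s u x)) (sym e₁)) (sym e₂)) z
        where
        e₁ : rot (opp s) (rot (opp s) x) ≡ rot s x
        e₁ = trans (rot-rot (opp s) x) (cong (λ k → rot k x) (opp² s))
        e₂ : rot (opp (opp s)) (rot (opp s) x) ≡ x
        e₂ = trans (cong (λ k → rot k (rot (opp s) x)) (opp² s)) (rot-rot-opp s x)

    -- Seen from the new edge in the opposite sense, the same M-edge is met, and it falls into the
    -- same case of `Turn`.
    nxt-inverse : ∀ s u x → HEdge (u , x) → φ u x ≡ false → nxt (opp s) φ (nxt s φ (u , x)) ≡ (u , x)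
    nxt-inverse s u x h fr with turn s u x h fr
    ... | across t t≡ tu m f₁ f₂ f₃ tv eq = trans (cong (nxt (opp s) φ) eq)
            (trans (nxt-true (opp s) φ (t ⊕ x) (rot (opp s) x) (trans (cong₂ φ tv e₁) m))
              (cong₂ _,_ (trans (cong₂ (λ p q → p ⊕ q ⊕ rot (opp s) x) tv e₁) (⊕-tri s u x)) e₂))
      where
      e₁ : rot (opp s) (rot (opp s) x) ≡ rot s x
      e₁ = trans (rot-rot (opp s) x) (cong (λ k → rot k x) (opp² s))
      e₂ : rot (opp (opp s)) (rot (opp s) x) ≡ x
      e₂ = trans (cong (λ k → rot k (rot (opp s) x)) (opp² s)) (rot-rot-opp s x)
    ... | around t t≡ tu m f₁ f₂ f₃ eq = trans (cong (nxt (opp s) φ) eq)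
            (trans (nxt-false (opp s) φ u (rot s x) (trans (cong (φ (u ⊕ rot s x)) (rot-opp-rot s x)) f₃))
              (cong (u ,_) (rot-opp-rot s x)))

    -- The tail stays fixed or moves by three arcs, and any three arcs preserve colours. So the
    -- edges of a contour outside M lie in one periodic matching.
    nxt-colour : ∀ s u x → colour (proj₁ (nxt s φ (u , x))) ≡ colour u
    nxt-colour s u x with φ (u ⊕ x) (rot s x)
    ... | true = ⊕-colour³ u x (rot s x) x
    ... | false = refl

    module Contour {s : Sense} {e : Ed} (cl : Closed s φ e) where
      open Closed cl public
      open Period (nxt s φ) e p period public using (back; reduce; reach?)

      member? : ∀ e′ → Dec (SameContour s φ e e′)
      member? = reach? _≟ᴱ_

      symmetric : ∀ {e′} → SameContour s φ e e′ → SameContour s φ e′ e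
      symmetric (n , refl) = back n

      forward : ∀ {e′} → SameContour s φ e e′ → SameContour s φ e (nxt s φ e′)
      forward (n , refl) = suc n , refl

      member-free : ∀ {e′} → SameContour s φ e e′ → at φ e′ ≡ false
      member-free (n , refl) = free n

      member-hedge : ∀ {e′} → SameContour s φ e e′ → HEdge e′
      member-hedge (n , refl) = hedge n

      member-colour : ∀ {e′} → SameContour s φ e e′ → colour (proj₁ e′) ≡ colour (proj₁ e)
      member-colour (n , refl) = go n
        where
        go : ∀ n → colour (proj₁ (iter n (nxt s φ) e)) ≡ colour (proj₁ e)
        go zero = refl
        go (suc n) = trans (nxt-colour s _ _) (go n)

      backward : ∀ {e′} → SameContour s φ e e′ → SameContour s φ e (nxt (opp s) φ e′)
      backward (suc n , refl) = n , sym (nxt-inverse s _ _ (hedge n) (free n))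
      backward (zero , refl) = p , trans (sym (nxt-inverse s _ _ (hedge p) (free p))) (cong (nxt (opp s) φ) period)

      closed-member : ∀ {e′} → SameContour s φ e e′ → Closed s φ e′
      closed-member (n , refl) = record
        { p = p
        ; period = trans (sym (iter-+ (suc p) n (nxt s φ) e))
          (trans (cong (λ k → iter k (nxt s φ) e) (ℕP.+-comm (suc p) n))
                     (trans (iter-+ n (suc p) (nxt s φ) e) (cong (iter n (nxt s φ)) period)))
        ; hedge = λ m → subst HEdge (iter-+ m n (nxt s φ) e) (hedge (m ℕ.+ n))
        ; free = λ m → trans (cong (at φ) (sym (iter-+ m n (nxt s φ) e))) (free (m ℕ.+ n)) }

    same-trans : ∀ {s e₁ e₂ e₃} → SameContour s φ e₁ e₂ → SameContour s φ e₂ e₃ → SameContour s φ e₁ e₃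
    same-trans {s} {e₁} (m , refl) (n , refl) = n ℕ.+ m , iter-+ n m (nxt s φ) e₁

    -- Switching a matching along a closed contour

    module Flip {e : Ed} (cl : Closed up φ e) where
      open Contour cl
      abstract
        X : Hx → Dir → Bool
        X u x = does (member? (u , x))

        X-true : ∀ u x → X u x ≡ true → SameContour up φ e (u , x)
        X-true u x = does-true (member? (u , x))

        true-X : ∀ u x → SameContour up φ e (u , x) → X u x ≡ true
        true-X u x = dec-true (member? (u , x))

      X-cong : ∀ u x u′ x′ → (SameContour up φ e (u , x) → SameContour up φ e (u′ , x′)) →
        (SameContour up φ e (u′ , x′) → SameContour up φ e (u , x)) → X u x ≡ X u′ x′
      X-cong u x u′ x′ f g with X u x in p | X u′ x′ in q
      ... | true | true = refl
      ... | false | false = refl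
      ... | true | false = absurdᵇ (true-X u′ x′ (f (X-true u x p))) q
      ... | false | true = absurdᵇ (true-X u x (g (X-true u′ x′ q))) p

      X-matched : ∀ u x → φ u x ≡ true → X u x ≡ false
      X-matched u x f with X u x in p
      ... | false = refl
      ... | true = absurdᵇ f (member-free (X-true u x p))

      abstract
        -- An M-edge survives unless another edge at its `up` end lies on the contour. Testing one
        -- end suffices: by `dn-across` and `dn-around`, the contour passes through both ends or
        -- through neither.
        flip : Matching
        flip u x = X u x ∨ (φ u x ∧ not (X (u ⊕ x) (rot up x) ∨ X (u ⊕ x ⊕ rot up x) (rot dn x)))

        flip-free : ∀ u x → φ u x ≡ false → flip u x ≡ X u x
        flip-free u x f rewrite f = BP.∨-identityʳ (X u x)

        flip-matched : ∀ u x → φ u x ≡ true →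
          flip u x ≡ not (X (u ⊕ x) (rot up x) ∨ X (u ⊕ x ⊕ rot up x) (rot dn x))
        flip-matched u x f rewrite X-matched u x f | f = refl

      flip-member : ∀ u x → SameContour up φ e (u , x) → flip u x ≡ true
      flip-member u x m = trans (flip-free u x (member-free m)) (true-X u x m)

      private
        dn-across : ∀ u x → φ u x ≡ true → X (u ⊕ x) (rot up x) ≡ X (u ⊕ x) (rot dn x)
        dn-across u x m = X-cong _ _ _ _ to from
          where
          v = u ⊕ x
          to : SameContour up φ e (v , rot up x) → SameContour up φ e (v , rot dn x)
          to q with turn up v (rot up x) (member-hedge q) (member-free q)
          ... | around _ _ _ _ _ _ _ eq = subst (SameContour up φ e) (trans eq (cong (v ,_) (rot-rot up x)))
            (forward q)
          ... | across t t≡ tu _ f _ _ _ _ = absurdᵇ (trans (cong₂ φ tt (rot-opp-rot up x)) m) f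
            where
            tt : t ≡ u
            tt = trans t≡ (trans (cong (v ⊕ rot up x ⊕_) (rot-rot up x)) (⊕-tri up u x))
          from : SameContour up φ e (v , rot dn x) → SameContour up φ e (v , rot up x)
          from q with turn dn v (rot dn x) (member-hedge q) (member-free q)
          ... | around _ _ _ _ _ _ _ eq = subst (SameContour up φ e) (trans eq (cong (v ,_) (rot-rot dn x)))
            (backward q)
          ... | across t t≡ tu _ f _ _ _ _ = absurdᵇ (trans (cong₂ φ tt (rot-opp-rot dn x)) m) f
            where
            tt : t ≡ u
            tt = trans t≡ (trans (cong (v ⊕ rot dn x ⊕_) (rot-rot dn x)) (⊕-tri dn u x))

        dn-around : ∀ u x → φ u x ≡ true → X (u ⊕ x ⊕ rot up x) (rot dn x) ≡ X (u ⊕ x ⊕ rot dn x) (rot up x)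
        dn-around u x m = X-cong _ _ _ _ to from
          where
          lem : ∀ s → u ⊕ x ⊕ rot s x ⊕ rot (opp s) x ⊕ x ⊕ rot (opp s) x ≡ u ⊕ x ⊕ rot (opp s) x
          lem s = cong (λ k → k ⊕ x ⊕ rot (opp s) x) (⊕-tri s u x)
          to : SameContour up φ e (u ⊕ x ⊕ rot up x , rot dn x) → SameContour up φ e (u ⊕ x ⊕ rot dn x , rot up x)
          to q with turn up _ (rot dn x) (member-hedge q) (member-free q)
          ... | across t t≡ tu _ _ _ _ _ eq =
            subst (SameContour up φ e) (trans eq (cong₂ _,_ tt (rot-rot dn x))) (forward q)
            where
            tt : t ⊕ rot dn x ≡ u ⊕ x ⊕ rot dn x
            tt = trans (cong (_⊕ rot dn x) (trans t≡
              (cong (u ⊕ x ⊕ rot up x ⊕ rot dn x ⊕_) (rot-rot-opp up x)))) (lem up)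
          ... | around t t≡ tu f _ _ _ _ = absurdᵇ (trans (cong₂ φ (⊕-tri up u x) (rot-rot-opp up x)) m) f
          from : SameContour up φ e (u ⊕ x ⊕ rot dn x , rot up x) → SameContour up φ e (u ⊕ x ⊕ rot up x , rot dn x)
          from q with turn dn _ (rot up x) (member-hedge q) (member-free q)
          ... | across t t≡ tu _ _ _ _ _ eq =
            subst (SameContour up φ e) (trans eq (cong₂ _,_ tt (rot-rot up x))) (backward q)
            where
            tt : t ⊕ rot up x ≡ u ⊕ x ⊕ rot up x
            tt = trans (cong (_⊕ rot up x) (trans t≡
              (cong (u ⊕ x ⊕ rot dn x ⊕ rot up x ⊕_) (rot-rot-opp dn x)))) (lem dn)
          ... | around t t≡ tu f _ _ _ _ = absurdᵇ (trans (cong₂ φ (⊕-tri dn u x) (rot-rot-opp dn x)) m) f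

      flip-matched′ : ∀ s u x → φ u x ≡ true →
        flip u x ≡ not (X (u ⊕ x) (rot s x) ∨ X (u ⊕ x ⊕ rot s x) (rot (opp s) x))
      flip-matched′ up u x m = flip-matched u x m
      flip-matched′ dn u x m = trans (flip-matched u x m)
        (cong₂ (λ p q → not (p ∨ q)) (dn-across u x m) (dn-around u x m))

      -- The two tails are adjacent, hence of different colours, whereas the tails of a contour have
      -- one colour.
      not-both : ∀ s u x → X (u ⊕ x) (rot s x) ≡ true → X (u ⊕ x ⊕ rot s x) (rot (opp s) x) ≡ true → ⊥
      not-both s u x p q = ⊕-colour (u ⊕ x) (rot s x)
        (trans (member-colour (X-true _ _ q)) (sym (member-colour (X-true _ _ p))))

      flip-one : ∀ s u x → φ u x ≡ true → φ (u ⊕ x) (rot s x) ≡ false → φ (u ⊕ x ⊕ rot s x) (rot (opp s) x)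
        ≡ false →
        OneAt flip s u x
      flip-one s u x m f g rewrite flip-free _ _ f | flip-free _ _ g | flip-matched′ s u x m
        with X (u ⊕ x) (rot s x) in p | X (u ⊕ x ⊕ rot s x) (rot (opp s) x) in q
      ... | true | true = ⊥-elim (not-both s u x p q)
      ... | true | false = one₂ refl refl refl
      ... | false | true = one₃ refl refl refl
      ... | false | false = one₁ refl refl refl

      flip-PM : PM flip
      flip-PM = record { inside = ins ; one = on }
        where
        ins : ∀ u x → flip u x ≡ true → HEdge (u , x)
        ins u x f with split (φ u x)
        ... | inj₁ m = inside u x m
        ... | inj₂ m = member-hedge (X-true u x (trans (sym (flip-free u x m)) f))
        on : ∀ s u x → Int u → OneAt flip s u x
        on s u x i with one s u x i
        ... | one₁ p q r = flip-one s u x p q r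
        ... | one₂ p q r = OneAt-rot flip s u x (flip-one s (u ⊕ x) (rot s x) q
                (trans (cong (φ t) (rot-rot s x)) r)
                (trans (cong₂ φ (trans (cong (t ⊕_) (rot-rot s x)) (⊕-tri s u x)) (rot-opp-rot s x)) p))
          where
          t = u ⊕ x ⊕ rot s x
        ... | one₃ p q r = OneAt-rot flip s u x (OneAt-rot flip s (u ⊕ x) (rot s x)
                (subst (OneAt flip s t) (sym (rot-rot s x)) (flip-one s t (rot (opp s) x) r
                  (trans (cong₂ φ (⊕-tri s u x) (rot-rot-opp s x)) p)
                  (trans (cong₂ φ (cong₂ _⊕_ (⊕-tri s u x) (rot-rot-opp s x))
                    (trans (rot-rot (opp s) x) (cong (λ k → rot k x) (opp² s)))) q))))
          where
          t = u ⊕ x ⊕ rot s x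

      -- Otherwise `flip` avoids `S` too, since its only edges outside `φ` are those of the contour.
      -- But it contains `e`, which `φ` does not.
      hit : ∀ {S} → AntiForcing φ S → ∃ λ s → s ∈ S × SameContour up φ e s
      hit {S} (nonM , unique) with any? member? S
      ... | yes q = let s , s∈ , r = find′ q in s , s∈ , r
        where
        find′ : ∀ {S} → Any (SameContour up φ e) S → ∃ λ s → s ∈ S × SameContour up φ e s
        find′ (here px) = _ , here refl , px
        find′ (there q) = let s , m , r = find′ q in s , there m , r
      ... | no ¬q = ⊥-elim (absurdᵇ (trans (sym (unique flip flip-PM (avoid S nonM ¬q) _ _))
        (flip-member _ _ (0 , refl))) (free 0))
        where
        avoid : ∀ S → All (λ e → at φ e ≡ false) S → ¬ Any (SameContour up φ e) S → All (λ e → at flip e ≡ false) S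
        avoid [] _ _ = []
        avoid ((u , x) ∷ S) (f ∷ fs) n = trans (flip-free u x f)
          (BP.¬-not λ q → n (here (X-true u x q))) ∷ avoid S fs (n ∘ there)

    -- Families of distinct contours bound anti-forcing sets from below

    -- One direction is enough, since reachability along closed contours is symmetric.
    Distinct : Ed → Ed → Set
    Distinct e e′ = ¬ SameContour up φ e e′

    record Family (es : List Ed) : Set where
      field
        closed : All (Closed up φ) es
        distinct : AllPairs Distinct es

    -- By `hit`, each contour carries an element of `S`. These elements differ, because two closed
    -- orbits that share an edge coincide.
    weak-duality : ∀ {es S} → Family es → AntiForcing φ S → length es ≤ length S
    weak-duality {es} {S} F af = let hs , eq , u , sub = go es (Family.closed F) (Family.distinct F) in
      subst (_≤ length S) eq (Unique-⊆-length u sub)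
      where
      Hits : List Ed → List Ed → Set
      Hits es hs = ∀ h → h ∈ hs → h ∈ S × Any (λ e → Closed up φ e × SameContour up φ e h) es
      go : ∀ es → All (Closed up φ) es → AllPairs Distinct es →
        Σ (List Ed) λ hs → length hs ≡ length es × Unique hs × (∀ h → h ∈ hs → h ∈ S)
      go′ : ∀ es → All (Closed up φ) es → AllPairs Distinct es →
        Σ (List Ed) λ hs → length hs ≡ length es × Unique hs × Hits es hs
      go es cs ds = let hs , eq , u , h = go′ es cs ds in hs , eq , u , λ x m → proj₁ (h x m)
      go′ [] _ _ = [] , refl , [] , λ _ ()
      go′ (e ∷ es) (cl ∷ cs) (d ∷ ds) =
        let hs , eq , u , h = go′ es cs ds
            s , s∈ , r = Flip.hit cl af
        in s ∷ hs , cong suc eq , All.tabulate (λ {y} m s≡y → clash d (proj₂ (h y m)) (subst (SameContour up φ e) s≡y r)) ∷ u ,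
           λ { _ (here refl) → s∈ , here (cl , r) ; y (there m) → proj₁ (h y m) , there (proj₂ (h y m)) }
        where
        clash : ∀ {es y} → All (Distinct e) es → Any (λ e → Closed up φ e × SameContour up φ e y) es →
          SameContour up φ e y → ⊥
        clash (d ∷ _) (here (cl′ , q)) r = d (same-trans r (Contour.symmetric cl′ q))
        clash (_ ∷ ds) (there q) r = clash ds q r

    family-front : ∀ {e es} → Family es → e ∈ es → Σ (List Ed) λ ys → Family (e ∷ ys) × length (e ∷ ys) ≡ length es
    family-front F m =
      let ys , tr , ds , len = bring (λ cl cl′ d s → d (Contour.symmetric cl′ s)) m (Family.closed F) (Family.distinct F)
      in ys , record { closed = tr _ (Family.closed F) ; distinct = ds } , len

    -- Alternating hexagons as contours

    data AlternatingHex (x : Hx) : Set where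
      source : (∀ t → φ (x ⊖ t) t ≡ true) → AlternatingHex x
      peak : (∀ t → φ x t ≡ true) → AlternatingHex x

    source-free : ∀ {x} → Int x → (∀ t → φ (x ⊖ t) t ≡ true) → ∀ s t → φ x t ≡ false × φ (x ⊕ t) (rot s t) ≡ false
    source-free {x} i h s t with one s x t i
    ... | one₃ p q _ = p , q
    ... | one₁ _ _ r = absurdᵇ (trans (cong (λ z → φ z (rot (opp s) t)) (third s x t)) (h (rot (opp s) t))) r
    ... | one₂ _ _ r = absurdᵇ (trans (cong (λ z → φ z (rot (opp s) t)) (third s x t)) (h (rot (opp s) t))) r

    peak-free : ∀ {x} → Int x → (∀ t → φ x t ≡ true) → ∀ t → φ (x ⊖ t) t ≡ false
    peak-free {x} i h t with one′ up (x ⊖ t) t (inj₂ (trans (cong I (⊖⊕ x t)) i))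
    ... | one₂ p _ _ = p
    ... | one₁ _ q _ = absurdᵇ (trans (cong (λ z → φ z (rot up t)) (⊖⊕ x t)) (h (rot up t))) q
    ... | one₃ _ q _ = absurdᵇ (trans (cong (λ z → φ z (rot up t)) (⊖⊕ x t)) (h (rot up t))) q

    source-not-adjacent-peak : ∀ {x t} → Int x → (∀ s → φ (x ⊖ s) s ≡ true) → (∀ s → φ (x ⊕ t) s ≡ true) → ⊥
    source-not-adjacent-peak {x} {t} i h k = absurdᵇ (k (rot up t)) (proj₂ (source-free i h up t))

    nxt-source : ∀ {x} → Int x → (∀ t → φ (x ⊖ t) t ≡ true) → ∀ t → nxt up φ (x , t) ≡ (x , rot up t)
    nxt-source {x} i h t = nxt-false up φ x t (proj₂ (source-free i h up t))

    nxt-peak : ∀ {x} → Int x → (∀ t → φ x t ≡ true) → ∀ t → nxt up φ (x ⊖ t , t) ≡ (x ⊖ rot dn t , rot dn t)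
    nxt-peak {x} i h t = trans (nxt-true up φ (x ⊖ t) t
      (trans (cong (λ z → φ z (rot up t)) (⊖⊕ x t)) (h (rot up t))))
      (cong (_, rot dn t) (trans (cong (λ z → z ⊕ rot up t ⊕ t) (⊖⊕ x t))
        (trans (⊕-comm x (rot up t) t) (third up x t))))

    iter-source : ∀ {x} → Int x → (∀ t → φ (x ⊖ t) t ≡ true) → ∀ n t → iter n (nxt up φ) (x , t)
      ≡ (x , iter n (rot up) t)
    iter-source i h zero t = refl
    iter-source i h (suc n) t = trans (cong (nxt up φ) (iter-source i h n t)) (nxt-source i h _)

    iter-peak : ∀ {x} → Int x → (∀ t → φ x t ≡ true) → ∀ n t →
      iter n (nxt up φ) (x ⊖ t , t) ≡ (x ⊖ iter n (rot dn) t , iter n (rot dn) t)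
    iter-peak i h zero t = refl
    iter-peak i h (suc n) t = trans (cong (nxt up φ) (iter-peak i h n t)) (nxt-peak i h _)

    rot³ : ∀ s t → iter 3 (rot s) t ≡ t
    rot³ s t = trans (cong (rot s) (rot-rot s t)) (rot-rot-opp s t)

    source-closed : ∀ {x} → Int x → (∀ t → φ (x ⊖ t) t ≡ true) → ∀ t → Closed up φ (x , t)
    source-closed {x} i h t = record
      { p = 2
      ; period = trans (iter-source i h 3 t) (cong (x ,_) (rot³ up t))
      ; hedge = λ n → subst HEdge (sym (iter-source i h n t)) (inj₁ i)
      ; free = λ n → trans (cong (at φ) (iter-source i h n t)) (proj₁ (source-free i h up _)) }

    peak-closed : ∀ {x} → Int x → (∀ t → φ x t ≡ true) → ∀ t → Closed up φ (x ⊖ t , t)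
    peak-closed {x} i h t = record
      { p = 2
      ; period = trans (iter-peak i h 3 t) (cong (λ t → x ⊖ t , t) (rot³ dn t))
      ; hedge = λ n → subst HEdge (sym (iter-peak i h n t)) (inj₂ (trans (cong I (⊖⊕ x _)) i))
      ; free = λ n → trans (cong (at φ) (iter-peak i h n t)) (peak-free i h _) }

    -- An edge of type b outside M on the boundary of an alternating hexagon: it leaves a source or
    -- enters a peak, and `φ x b` tells the two apart.
    rep : Hx → Ed
    rep x = if φ x b then (x ⊖ b , b) else (x , b)

    rep-source : ∀ {x} → Int x → (∀ t → φ (x ⊖ t) t ≡ true) → rep x ≡ (x , b)
    rep-source {x} i h rewrite proj₁ (source-free i h up b) = refl

    rep-peak : ∀ {x} → (∀ t → φ x t ≡ true) → rep x ≡ (x ⊖ b , b)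
    rep-peak {x} h rewrite h b = refl

    rep-closed : ∀ {x} → Int x → AlternatingHex x → Closed up φ (rep x)
    rep-closed i (source h) = subst (Closed up φ) (sym (rep-source i h)) (source-closed i h b)
    rep-closed i (peak h) = subst (Closed up φ) (sym (rep-peak h)) (peak-closed i h b)

    rep-distinct : ∀ {x y} → Int x → Int y → AlternatingHex x → AlternatingHex y → x ≢ y → Distinct (rep x) (rep y)
    rep-distinct {x} {y} i j (source h) (source k) x≢y (n , eq)
      rewrite rep-source i h | rep-source j k | iter-source i h n b = x≢y (cong proj₁ eq)
    rep-distinct {x} {y} i j (source h) (peak k) x≢y (n , eq)
      rewrite rep-source i h | rep-peak k | iter-source i h n b =
        source-not-adjacent-peak {x} {b} i h
          (λ s → trans (cong (λ z → φ z s) (trans (cong (_⊕ b) (cong proj₁ eq)) (⊖⊕ y b))) (k s))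
    rep-distinct {x} {y} i j (peak h) (source k) x≢y (n , eq)
      rewrite rep-peak h | rep-source j k | iter-peak i h n b =
        source-not-adjacent-peak {y} {iter n (rot dn) b} j k (λ s → trans (cong (λ z → φ z s)
          (trans (cong (_⊕ iter n (rot dn) b) (sym (cong proj₁ eq))) (⊖⊕ x _))) (h s))
    rep-distinct {x} {y} i j (peak h) (peak k) x≢y (n , eq)
      rewrite rep-peak h | rep-peak k | iter-peak i h n b =
        x≢y (trans (sym (⊖⊕ x _)) (trans (cong (λ e → proj₁ e ⊕ proj₂ e) eq) (⊖⊕ y b)))

    alternating-family : ∀ {xs} → Unique xs → All (λ x → Int x × AlternatingHex x) xs → Family (map rep xs)
    alternating-family u al = record { closed = cls al ; distinct = dst u al }
      where
      cls : ∀ {xs} → All (λ x → Int x × AlternatingHex x) xs → All (Closed up φ) (map rep xs)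
      cls [] = []
      cls ((i , p) ∷ al) = rep-closed i p ∷ cls al
      dst : ∀ {xs} → Unique xs → All (λ x → Int x × AlternatingHex x) xs → AllPairs Distinct (map rep xs)
      dst [] [] = []
      dst (x∉ ∷ u) ((i , p) ∷ al) = one-all x∉ al ∷ dst u al
        where
        one-all : ∀ {ys} → All (_ ≢_) ys → All (λ x → Int x × AlternatingHex x) ys →
          All (Distinct (rep _)) (map rep ys)
        one-all [] [] = []
        one-all (n ∷ ns) ((j , q) ∷ bl) = rep-distinct i j p q n ∷ one-all ns bl

    -- Basins and their flattening

    -- A basin is a set of hexagons, each at a depth below the rim, such that every edge outside M
    -- on the rim climbs out of it. Raising the height function inside to the rim produces flatten.
    record Basin : Set where
      field
        Ω : Hx → Bool
        depth : Hx → ℕ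
        Ω-int : ∀ x → Ω x ≡ true → Int x
        enter : ∀ x t → Ω x ≡ false → Ω (x ⊕ t) ≡ true → φ x t ≡ true × depth (x ⊕ t) ≤ 1
        exit : ∀ x t → Ω x ≡ true → Ω (x ⊕ t) ≡ false → φ x t ≡ false × depth x ≡ 0
        inner-free : ∀ x t → Ω x ≡ true → Ω (x ⊕ t) ≡ true → φ x t ≡ false → depth x ≡ suc (depth (x ⊕ t))
        inner-matched : ∀ x t → Ω x ≡ true → Ω (x ⊕ t) ≡ true → φ x t ≡ true → depth (x ⊕ t) ≡ suc (suc (depth x))

  module Flatten {φ : Matching} (pm : PM φ) (B : Matched.Basin pm) where
    open Matched pm
    open Basin B

    level : Hx → Dir
    level x = residue (depth x)

    -- On `Ω` the arcs with tails of level b are chosen. For an arc that enters `Ω`, the level of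
    -- the tail is read off the head: b before a. Depth 0 has level a, so no exit is chosen.
    flatten : Matching
    flatten x t = if Ω x then is-b (level x) else if Ω (x ⊕ t) then is-a (level (x ⊕ t)) else φ x t

    in-Ω : ∀ x t → Ω x ≡ true → flatten x t ≡ is-b (level x)
    in-Ω x t o rewrite o = refl

    into-Ω : ∀ x t → Ω x ≡ false → Ω (x ⊕ t) ≡ true → flatten x t ≡ is-a (level (x ⊕ t))
    into-Ω x t o p rewrite o | p = refl

    off-Ω : ∀ x t → Ω x ≡ false → Ω (x ⊕ t) ≡ false → flatten x t ≡ φ x t
    off-Ω x t o p rewrite o | p = refl

    -- Along an arc the depth decreases by 1 or increases by 2, which is the same modulo 3: levels
    -- do not see `φ`.
    level-step : ∀ x t → Ω x ≡ true → Ω (x ⊕ t) ≡ true → level x ≡ rot up (level (x ⊕ t))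
    level-step x t o p with φ x t in m
    ... | false = cong residue (inner-free x t o p m)
    ... | true = sym (trans (cong (rot up ∘ residue) (inner-matched x t o p m)) (rot³ up (level x)))

    level-exit : ∀ x t → Ω x ≡ true → Ω (x ⊕ t) ≡ false → level x ≡ a
    level-exit x t o p = cong residue (proj₂ (exit x t o p))

    one-all : ∀ {p q r} → p ≡ rot up q → q ≡ rot up r → One (is-b p) (is-b q) (is-b r)
    one-all {r = a} refl refl = one₂ refl refl refl
    one-all {r = b} refl refl = one₃ refl refl refl
    one-all {r = c} refl refl = one₁ refl refl refl

    module _ (s : Sense) (u : Hx) (x : Dir) where
      private
        v t : Hx
        v = u ⊕ x
        t = u ⊕ x ⊕ rot s x
        t→u : Ω (t ⊕ rot (opp s) x) ≡ Ω u
        t→u = cong Ω (⊕-tri s u x)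

      one-inside : Ω u ≡ true → Ω v ≡ true → Ω t ≡ true → OneAt flatten s u x
      one-inside o p q rewrite in-Ω u x o | in-Ω v (rot s x) p | in-Ω t (rot (opp s) x) q =
        one-all (level-step u x o p) (level-step v (rot s x) p q)

      -- The exit forces depth 0, so the arc entering `u` is chosen by `flatten`; by `enter` it was
      -- already the M-edge here.
      one-single : Ω u ≡ true → Ω v ≡ false → Ω t ≡ false → OneAt flatten s u x
      one-single o p q rewrite in-Ω u x o | off-Ω v (rot s x) p q | into-Ω t (rot (opp s) x) q (trans t→u o) | level-exit u x o p | ⊕-tri s u x
          | level-exit u x o p
        with one s u x (Ω-int u o)
      ... | one₁ m _ _ = absurdᵇ m (proj₁ (exit u x o p))
      ... | one₃ _ f _ = one₃ refl f refl
      ... | one₂ _ _ f = absurdᵇ (proj₁ (enter t (rot (opp s) x) q (trans t→u o))) f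

      -- The exit from `v` gives it level a, hence `u` has level b and the arc `u → v` is chosen.
      one-double : Ω u ≡ true → Ω v ≡ true → Ω t ≡ false → OneAt flatten s u x
      one-double o p q rewrite in-Ω u x o | in-Ω v (rot s x) p | into-Ω t (rot (opp s) x) q (trans t→u o) | ⊕-tri s u x
          | level-step u x o p | level-exit v (rot s x) p q
        = one₁ refl refl refl

    flatten-PM : PM flatten
    flatten-PM = record { inside = ins ; one = on }
      where
      ins : ∀ u x → flatten u x ≡ true → HEdge (u , x)
      ins u x f with Ω u in o
      ... | true = inj₁ (Ω-int u o)
      ... | false with Ω (u ⊕ x) in o′
      ... | true = inj₂ (Ω-int _ o′)
      ... | false = inside u x f
      on : ∀ s u x → Int u → OneAt flatten s u x
      on s u x i with split (Ω u) | split (Ω (u ⊕ x)) | split (Ω (u ⊕ x ⊕ rot s x))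
      ... | inj₁ ou | inj₁ ov | inj₁ ot = one-inside s u x ou ov ot
      ... | inj₁ ou | inj₁ ov | inj₂ ot = one-double s u x ou ov ot
      ... | inj₁ ou | inj₂ ov | inj₂ ot = one-single s u x ou ov ot
      ... | inj₂ ou | inj₁ ov | inj₁ ot = OneAt-rot flatten s u x (one-double s (u ⊕ x) (rot s x) ov ot
              (trans (cong Ω (trans (cong (u ⊕ x ⊕ rot s x ⊕_) (rot-rot s x)) (⊕-tri s u x))) ou))
      ... | inj₂ ou | inj₁ ov | inj₂ ot = OneAt-rot flatten s u x (one-single s (u ⊕ x) (rot s x) ov ot
              (trans (cong Ω (trans (cong (u ⊕ x ⊕ rot s x ⊕_) (rot-rot s x)) (⊕-tri s u x))) ou))
      ... | inj₁ ou | inj₂ ov | inj₁ ot = OneAt-rot flatten s u x (OneAt-rot flatten s (u ⊕ x) (rot s x)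
              (subst (OneAt flatten s (u ⊕ x ⊕ rot s x)) (sym (rot-rot s x))
                (one-double s (u ⊕ x ⊕ rot s x) (rot (opp s) x) ot
                (trans (cong Ω (⊕-tri s u x)) ou) (trans (cong Ω (cong₂ _⊕_ (⊕-tri s u x) (rot-rot-opp s x))) ov))))
      ... | inj₂ ou | inj₂ ov | inj₁ ot = OneAt-rot flatten s u x (OneAt-rot flatten s (u ⊕ x) (rot s x)
              (subst (OneAt flatten s (u ⊕ x ⊕ rot s x)) (sym (rot-rot s x))
                (one-single s (u ⊕ x ⊕ rot s x) (rot (opp s) x) ot
                (trans (cong Ω (⊕-tri s u x)) ou) (trans (cong Ω (cong₂ _⊕_ (⊕-tri s u x) (rot-rot-opp s x))) ov))))
      ... | inj₂ ou | inj₂ ov | inj₂ ot with one s u x i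
      ... | o rewrite off-Ω u x ou ov | off-Ω (u ⊕ x) (rot s x) ov ot
              | off-Ω (u ⊕ x ⊕ rot s x) (rot (opp s) x) ot (trans (cong Ω (⊕-tri s u x)) ou) = o

    open Matched flatten-PM using () renaming
      (AlternatingHex to AlternatingHex′; source to source′; peak to peak′; rep to rep′; Family to Family′)

    -- Level a makes all entering arcs matched, level b all leaving ones; hexagons of level c are
    -- the remaining third.
    extreme : Hx → Bool
    extreme x = Ω x ∧ (is-a (level x) ∨ is-b (level x))

    extreme-alternating : ∀ x → extreme x ≡ true → Int x × AlternatingHex′ x
    extreme-alternating x e with Ω x in o
    ... | true with level x in l
    ... | a = Ω-int x o , source′ λ t → src t
      where
      src : ∀ t → flatten (x ⊖ t) t ≡ true
      src t with Ω (x ⊖ t) in o′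
      ... | true = cong is-b (trans (level-step (x ⊖ t) t o′ (trans (cong Ω (⊖⊕ x t)) o))
        (cong (rot up) (trans (cong level (⊖⊕ x t)) l)))
      ... | false rewrite ⊖⊕ x t | o | l = refl
    ... | b = Ω-int x o , peak′ λ t → trans (in-Ω x t o) (cong is-b l)

    -- Crossing an M-edge leads over a hexagon `t` one deeper than `u`. It lies in `Ω`, as arcs
    -- entering `Ω` are matched, and so does its successor, as exits have depth 0.
    nxt-inside : ∀ u x → Ω u ≡ true → φ u x ≡ false → Ω (proj₁ (nxt up φ (u , x))) ≡ true
    nxt-inside u x o f with turn up u x (inj₁ (Ω-int u o)) f
    ... | around _ _ _ _ _ _ _ eq = trans (cong (Ω ∘ proj₁) eq) o
    ... | across t _ tu _ f₁ f₂ _ _ eq with Ω t in ot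
    ... | false = absurdᵇ (proj₁ (enter t (rot dn x) ot (trans (cong Ω tu) o))) f₁
    ... | true with Ω (t ⊕ x) in ou
    ... | true = trans (cong (Ω ∘ proj₁) eq) ou
    ... | false = ⊥-elim (ℕP.0≢1+n (trans (sym (proj₂ (exit t x ot ou)))
      (inner-free t (rot dn x) ot (trans (cong Ω tu) o) f₁)))

    module _ {e : Ed} (cl : Closed up φ e) where
      open Contour cl

      iter-inside : Ω (proj₁ e) ≡ true → ∀ n → Ω (proj₁ (iter n (nxt up φ) e)) ≡ true
      iter-inside o zero = o
      iter-inside o (suc n) = nxt-inside _ _ (iter-inside o n) (free n)

    iter-outside : ∀ {e} → Closed up φ e → Ω (proj₁ e) ≡ false → ∀ n → Ω (proj₁ (iter n (nxt up φ) e)) ≡ false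
    iter-outside {e} cl o n with Ω (proj₁ (iter n (nxt up φ) e)) in q
    ... | false = refl
    ... | true = let m , eq = Contour.back cl n in
      absurdᵇ (trans (cong (Ω ∘ proj₁) (sym eq)) (iter-inside (Contour.closed-member cl (n , refl)) q m)) o

    head-outside : ∀ u x → Ω u ≡ false → φ u x ≡ false → Ω (u ⊕ x) ≡ false
    head-outside u x o f with Ω (u ⊕ x) in p
    ... | false = refl
    ... | true = absurdᵇ (proj₁ (enter u x o p)) f

    -- If the third hexagon lies in `Ω`, it exits to `u` and has level a; the arc entering it is
    -- then matched in both `φ` and `flatten`.
    nxt-outside : ∀ u x → Ω u ≡ false → φ u x ≡ false → nxt up flatten (u , x) ≡ nxt up φ (u , x)
    nxt-outside u x o f = cong (λ z → if z then (u ⊕ x ⊕ rot up x ⊕ x , rot dn x) else (u , rot up x)) same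
      where
      ov = head-outside u x o f
      same : flatten (u ⊕ x) (rot up x) ≡ φ (u ⊕ x) (rot up x)
      same with split (Ω (u ⊕ x ⊕ rot up x))
      ... | inj₂ ot = off-Ω _ _ ov ot
      ... | inj₁ ot = trans (into-Ω _ _ ov ot)
        (trans (cong is-a (level-exit _ (rot dn x) ot (trans (cong Ω (⊕-tri up u x)) o)))
                    (sym (proj₁ (enter _ _ ov ot))))

    iter-flatten : ∀ {e} → Closed up φ e → Ω (proj₁ e) ≡ false → ∀ n → iter n (nxt up flatten) e
      ≡ iter n (nxt up φ) e
    iter-flatten cl o zero = refl
    iter-flatten cl o (suc n) = trans (cong (nxt up flatten) (iter-flatten cl o n))
      (nxt-outside _ _ (iter-outside cl o n) (Closed.free cl n))

    survives : ∀ {e} → Closed up φ e → Ω (proj₁ e) ≡ false → Closed up flatten e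
    survives {e} cl o = record
      { p = p
      ; period = trans (iter-flatten cl o (suc p)) period
      ; hedge = λ n → subst HEdge (sym (iter-flatten cl o n)) (hedge n)
      ; free = λ n → trans (cong (at flatten) (iter-flatten cl o n))
          (trans (off-Ω _ _ (iter-outside cl o n) (head-outside _ _ (iter-outside cl o n) (free n))) (free n)) }
      where open Closed cl

    survivor-distinct : ∀ {e e′} → Closed up φ e → Ω (proj₁ e) ≡ false → Distinct e e′ →
      Matched.Distinct flatten-PM e e′
    survivor-distinct cl o d (n , eq) = d (n , trans (sym (iter-flatten cl o n)) eq)

    survivor-not-extreme : ∀ {e y} → Closed up φ e → Ω (proj₁ e) ≡ false → extreme y ≡ true →
      Matched.Distinct flatten-PM e (rep′ y)
    survivor-not-extreme {e} {y} cl o ex (n , eq) with Ω y in oy | flatten y b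
    ... | true | false = absurdᵇ oy (trans (cong (Ω ∘ proj₁) (trans (sym eq) (iter-flatten cl o n)))
      (iter-outside cl o n))
    ... | true | true = absurdᵇ oy (trans (cong Ω (sym (⊖⊕ y b)))
      (trans (cong (λ e → Ω (proj₁ e ⊕ proj₂ e)) (trans (sym eq) (iter-flatten cl o n)))
          (head-outside _ _ (iter-outside cl o n) (Closed.free cl n))))

    -- Large enough to carry both `fill` and its translate by b, so that their sums over it agree.
    wide : List Hx
    wide = deduplicate _≟ᴴ_ (cells ++ map (_⊖ b) cells)

    wide-unique : Unique wide
    wide-unique = deduplicate-! _≟ᴴ_ (cells ++ map (_⊖ b) cells)

    Ω⊆wide : ∀ x → Ω x ≡ true → x ∈ wide
    Ω⊆wide x o = ∈-deduplicate⁺ _≟ᴴ_ (∈-++⁺ˡ (cells-complete x (Ω-int x o)))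

    Ω⊖b⊆wide : ∀ x → Ω x ≡ true → x ⊖ b ∈ wide
    Ω⊖b⊆wide x o = ∈-deduplicate⁺ _≟ᴴ_ (∈-++⁺ʳ cells (∈-map⁺ (_⊖ b) (cells-complete x (Ω-int x o))))

    climb : Hx → Bool
    climb x = Ω x ∧ not (φ x b)

    fill : Hx → ℕ
    fill x = if Ω x then ⌊1+ depth x /3⌋ else 0

    indicator : Bool → ℕ
    indicator p = if p then 1 else 0

    -- Along a line in direction b the two sides differ by the increment of fill, which vanishes at both ends.
    balance : ∀ x → indicator (climb x) ℕ.+ fill (x ⊕ b) ≡ indicator (extreme x) ℕ.+ fill x
    balance x with split (Ω x) | split (Ω (x ⊕ b))
    ... | inj₂ o | inj₂ p rewrite o | p = refl
    ... | inj₂ o | inj₁ p rewrite o | p = shallow (proj₂ (enter x b o p))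
      where
      -- Entering at depth 0 or 1 costs nothing; this is what the depth bound in `enter` is for.
      shallow : ∀ {n} → n ≤ 1 → ⌊1+ n /3⌋ ≡ 0
      shallow z≤n = refl
      shallow (s≤s z≤n) = refl
    ... | inj₁ o | inj₂ p rewrite o | p | proj₁ (exit x b o p) | proj₂ (exit x b o p) = refl
    ... | inj₁ o | inj₁ p with split (φ x b)
    ... | inj₂ f rewrite o | p | f | inner-free x b o p f = lem (residue (depth (x ⊕ b)))
      where
      lem : ∀ r → suc ⌊1+ depth (x ⊕ b) /3⌋
        ≡ indicator (is-a (rot up r) ∨ is-b (rot up r)) ℕ.+ (carry r ℕ.+ ⌊1+ depth (x ⊕ b) /3⌋)
      lem a = refl
      lem b = refl
      lem c = refl
    ... | inj₁ m rewrite o | p | m | inner-matched x b o p m = lem (residue (depth x))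
      where
      lem : ∀ r → carry (rot up r) ℕ.+ (carry r ℕ.+ ⌊1+ depth x /3⌋)
        ≡ indicator (is-a r ∨ is-b r) ℕ.+ ⌊1+ depth x /3⌋
      lem a = refl
      lem b = refl
      lem c = refl

    count-climb : count climb wide ≡ count extreme wide
    count-climb = ℕP.+-cancelʳ-≡ (LA.sum (map fill wide)) _ _ (begin
      count climb wide ℕ.+ LA.sum (map fill wide)
        ≡⟨ cong (count climb wide ℕ.+_) shifted ⟩
      count climb wide ℕ.+ LA.sum (map (λ x → fill (x ⊕ b)) wide)
        ≡⟨ sym (sum-map-+ (λ x → indicator (climb x)) (λ x → fill (x ⊕ b)) wide) ⟩
      LA.sum (map (λ x → indicator (climb x) ℕ.+ fill (x ⊕ b)) wide) ≡⟨ sum-map-cong balance wide ⟩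
      LA.sum (map (λ x → indicator (extreme x) ℕ.+ fill x) wide)
        ≡⟨ sum-map-+ (λ x → indicator (extreme x)) fill wide ⟩
      count extreme wide ℕ.+ LA.sum (map fill wide) ∎)
      where
      open ≡-Reasoning
      filled : ∀ x → fill x ≢ 0 → Ω x ≡ true
      filled x n with Ω x
      ... | true = refl
      ... | false = ⊥-elim (n refl)
      ⊕b-injective : ∀ {x y} → x ⊕ b ≡ y ⊕ b → x ≡ y
      ⊕b-injective {x} {y} eq = trans (sym (⊕⊖ x b)) (trans (cong (_⊖ b) eq) (⊕⊖ y b))
      shifted : LA.sum (map fill wide) ≡ LA.sum (map (λ x → fill (x ⊕ b)) wide)
      shifted = trans (sum-support fill wide (map (_⊕ b) wide) wide-unique (UniqueP.map⁺ ⊕b-injective wide-unique)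
          (λ x n → Ω⊆wide x (filled x n) ,
            subst (_∈ map (_⊕ b) wide) (⊖⊕ x b) (∈-map⁺ (_⊕ b) (Ω⊖b⊆wide x (filled x n)))))
        (cong LA.sum (sym (LP.map-∘ wide)))

    -- Contours lost and gained by flattening

    CrossesB : Ed → Hx → Set
    CrossesB e y = SameContour up φ e (y , b)

    crosses-climb : ∀ {e y} → Closed up φ e → Ω (proj₁ e) ≡ true → CrossesB e y → climb y ≡ true
    crosses-climb {e} {y} cl o (n , eq) = cong₂ (λ p q → p ∧ not q)
      (trans (cong (Ω ∘ proj₁) (sym eq)) (iter-inside cl o n)) (Contour.member-free cl (n , eq))

    -- A contour with tails in `Ω` is destroyed and recorded by the tail of one of its edges of type
    -- b. Distinct contours have distinct such edges, so `lost` can be counted against `climb`.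
    record Split (es : List Ed) : Set where
      field
        lost : List Hx
        kept : List Ed
        lengths : length lost ℕ.+ length kept ≡ length es
        lost-unique : Unique lost
        lost-crosses : ∀ y → y ∈ lost → climb y ≡ true × Any (λ e → Closed up φ e × CrossesB e y) es
        kept-closed : All (λ e → Closed up φ e × Ω (proj₁ e) ≡ false) kept
        kept⊆ : ∀ e → e ∈ kept → e ∈ es
        kept-distinct : AllPairs Distinct kept

    crosses-distinct : ∀ {e es y} → All (Distinct e) es → CrossesB e y →
      Any (λ e → Closed up φ e × CrossesB e y) es → ⊥
    crosses-distinct (d ∷ _) r (here (cl , q)) = d (same-trans r (Contour.symmetric cl q))
    crosses-distinct (_ ∷ ds) r (there q) = crosses-distinct ds r q

    partition : ∀ es → All (Closed up φ) es → AllPairs Distinct es → All (λ e → ∃ (CrossesB e)) es → Split es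
    partition [] _ _ _ = record
      { lost = [] ; kept = [] ; lengths = refl ; lost-unique = [] ; lost-crosses = λ _ () ; kept-closed = []
      ; kept⊆ = λ _ () ; kept-distinct = [] }
    partition (e ∷ es) (cl ∷ cls) (d ∷ ds) ((y , r) ∷ rs) with partition es cls ds rs | split (Ω (proj₁ e))
    ... | S | inj₁ o = record
      { lost = y ∷ lost ; kept = kept ; lengths = cong suc lengths
      ; lost-unique = All.tabulate (λ {z} m y≡z →
        crosses-distinct d (subst (CrossesB e) y≡z r) (proj₂ (lost-crosses z m))) ∷ lost-unique
      ; lost-crosses = λ { _ (here refl) → crosses-climb cl o r , here (cl , r)
                         ; z (there m) → proj₁ (lost-crosses z m) , there (proj₂ (lost-crosses z m)) }
      ; kept-closed = kept-closed ; kept⊆ = λ e m → there (kept⊆ e m) ; kept-distinct = kept-distinct }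
      where open Split S
    ... | S | inj₂ o = record
      { lost = lost ; kept = e ∷ kept ; lengths = trans (ℕP.+-suc (length lost) (length kept)) (cong suc lengths)
      ; lost-unique = lost-unique
      ; lost-crosses = λ z m → proj₁ (lost-crosses z m) , there (proj₂ (lost-crosses z m))
      ; kept-closed = (cl , o) ∷ kept-closed
      ; kept⊆ = λ { _ (here refl) → here refl ; e (there m) → there (kept⊆ e m) }
      ; kept-distinct = All.tabulate (λ m → All.lookup d (kept⊆ _ m)) ∷ kept-distinct }
      where open Split S

    extremes : List Hx
    extremes = filter (λ x → extreme x BP.≟ true) wide

    -- The three edges of `e₀` and one for each lost contour of `es` are different climbs, and there
    -- are as many climbs as extreme hexagons. The new family consists of the kept contours and the
    -- boundaries of the extreme hexagons.
    gain : ∀ {e₀ es y₁ y₂ y₃} → Family (e₀ ∷ es) → Ω (proj₁ e₀) ≡ true →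
      CrossesB e₀ y₁ → CrossesB e₀ y₂ → CrossesB e₀ y₃ → y₁ ≢ y₂ → y₁ ≢ y₃ → y₂ ≢ y₃ →
      All (λ e → ∃ (CrossesB e)) es → Σ (List Ed) λ es′ → Family′ es′ × 2 ℕ.+ length (e₀ ∷ es) ≤ length es′
    gain {e₀} {es} {y₁} {y₂} {y₃} F o r₁ r₂ r₃ n₁₂ n₁₃ n₂₃ rs with Family.closed F | Family.distinct F
    ... | cl ∷ cls | d ∷ ds = kept ++ map rep′ extremes , record { closed = closed′ ; distinct = distinct′ } , bound
      where
      open Split (partition es cls ds rs)
      ext-alt : All (λ x → Int x × AlternatingHex′ x) extremes
      ext-alt = All.tabulate λ {x} m → extreme-alternating x
        (proj₂ (∈-filter⁻ (λ x → extreme x BP.≟ true) {xs = wide} m))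
      famE : Family′ (map rep′ extremes)
      famE = Matched.alternating-family flatten-PM (UniqueP.filter⁺ _ wide-unique) ext-alt
      closed′ : All (Closed up flatten) (kept ++ map rep′ extremes)
      closed′ = AllP.++⁺ (All.map (λ { (cl , o) → survives cl o }) kept-closed) (Matched.Family.closed famE)
      distinct′ : AllPairs (Matched.Distinct flatten-PM) (kept ++ map rep′ extremes)
      distinct′ = AllPairsP.++⁺ (pairs kept-closed kept-distinct) (Matched.Family.distinct famE)
        (All.map (λ { (cl , o) → AllP.map⁺ (All.tabulate λ {y} m → survivor-not-extreme cl o
            (proj₂ (∈-filter⁻ (λ x → extreme x BP.≟ true) {xs = wide} m))) }) kept-closed)
        where
        pairs : ∀ {ks} → All (λ e → Closed up φ e × Ω (proj₁ e) ≡ false) ks → AllPairs Distinct ks →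
          AllPairs (Matched.Distinct flatten-PM) ks
        pairs [] [] = []
        pairs ((cl , o) ∷ ks) (d ∷ ds) = All.map (survivor-distinct cl o) d ∷ pairs ks ds
      fresh : ∀ {y} → CrossesB e₀ y → All (y ≢_) lost
      fresh r = All.tabulate λ {z} m y≡z → crosses-distinct d (subst (CrossesB e₀) y≡z r) (proj₂ (lost-crosses z m))
      big : 3 ℕ.+ length lost ≤ count climb wide
      big = Unique-count climb {xs = y₁ ∷ y₂ ∷ y₃ ∷ lost}
        ((n₁₂ ∷ n₁₃ ∷ fresh r₁) ∷ (n₂₃ ∷ fresh r₂) ∷ fresh r₃ ∷ lost-unique)
        λ { _ (here refl) → member r₁ ; _ (there (here refl)) → member r₂ ; _ (there (there (here refl))) →
          member r₃
          ; y (there (there (there m))) → climb-wide (proj₁ (lost-crosses y m)) }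
        where
        climb-wide : ∀ {y} → climb y ≡ true → y ∈ wide × climb y ≡ true
        climb-wide {y} h with split (Ω y)
        ... | inj₁ o = Ω⊆wide y o , h
        ... | inj₂ o = absurdᵇ h (cong (_∧ not (φ y b)) o)
        member : ∀ {y} → CrossesB e₀ y → y ∈ wide × climb y ≡ true
        member r = climb-wide (crosses-climb cl o r)
      bound : 2 ℕ.+ length (e₀ ∷ es) ≤ length (kept ++ map rep′ extremes)
      bound = begin
        3 ℕ.+ length es ≡⟨ cong (3 ℕ.+_) (sym lengths) ⟩
        3 ℕ.+ length lost ℕ.+ length kept ≤⟨ ℕP.+-monoˡ-≤ (length kept) big ⟩
        count climb wide ℕ.+ length kept ≡⟨ cong (ℕ._+ length kept)
          (trans count-climb (sym (count-filter extreme wide))) ⟩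
        length extremes ℕ.+ length kept ≡⟨ ℕP.+-comm (length extremes) (length kept) ⟩
        length kept ℕ.+ length extremes ≡⟨ cong (length kept ℕ.+_) (sym (LP.length-map rep′ extremes)) ⟩
        length kept ℕ.+ length (map rep′ extremes) ≡⟨ sym (LP.length-++ kept) ⟩
        length (kept ++ map rep′ extremes) ∎
        where open ℕP.≤-Reasoning

-- Regions with potentials and heights

-- `potential` is a third of the height of `φ₂` minus that of `φ₁`. It has to be known across the
-- boundary, where it vanishes, whereas `height` is needed only between interior hexagons.
record Region : Set₁ where
  field
    lattice : Lattice
  open Contours lattice
  field
    potential : ∀ φ₁ φ₂ → PM φ₁ → PM φ₂ → ∃ λ (f : Hx → ℤ) →
      (∀ x → Ext x → f x ≡ + 0) × (∀ x t → f (x ⊕ t) ℤ.+ val (φ₂ x t) ≡ f x ℤ.+ val (φ₁ x t))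
    height : ∀ φ → PM φ → ∃ λ (h : Hx → ℤ) → ∀ x t → Int x → Int (x ⊕ t) →
      (φ x t ≡ false → h (x ⊕ t) ≡ ℤ.suc (h x)) × (φ x t ≡ true → h x ≡ ℤ.suc (ℤ.suc (h (x ⊕ t))))

-- Flooding from the exterior

module Growth (R : Region) where
  open Region R public
  open Contours lattice public

  VanishesOutside : (Hx → ℤ) → Set
  VanishesOutside f = ∀ x → Ext x → f x ≡ + 0

  nonzero-int : ∀ {f} → VanishesOutside f → ∀ x → f x ≢ + 0 → Int x
  nonzero-int z x n with int? x
  ... | inj₁ i = i
  ... | inj₂ o = ⊥-elim (n (z x o))

  pos-int : ∀ {f} → VanishesOutside f → ∀ x → + 0 ℤ.< f x → Int x
  pos-int z x p = nonzero-int z x λ eq → ℤP.<-irrefl (sym eq) p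

  module Matching-Growth {φ : Matching} (pm : PM φ) where
    open Matched pm public

    h : Hx → ℤ
    h = proj₁ (height φ pm)

    h-free : ∀ {x t} → Int x → Int (x ⊕ t) → φ x t ≡ false → h (x ⊕ t) ≡ ℤ.suc (h x)
    h-free i j = proj₁ (proj₂ (height φ pm) _ _ i j)

    h-matched : ∀ {x t} → Int x → Int (x ⊕ t) → φ x t ≡ true → h x ≡ ℤ.suc (ℤ.suc (h (x ⊕ t)))
    h-matched i j = proj₂ (proj₂ (height φ pm) _ _ i j)

    -- The contour of e encloses the tail of e rather than its head, expressed by test functions that
    -- jump only across this contour.
    Outer : Ed → Set
    Outer e = ∀ f → VanishesOutside f →
      (∀ y t → φ y t ≡ false → ¬ SameContour up φ e (y , t) → f (y ⊕ t) ≡ f y) → f (proj₁ e ⊕ proj₂ e) ≡ + 0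

    Climb : List Hx → Hx → Set
    Climb U y = ∃ λ t → y ⊕ t ∉ U × φ y t ≡ false

    Fall : List Hx → Hx → Set
    Fall U y = ∃ λ t → y ⊖ t ∉ U × φ (y ⊖ t) t ≡ false

    open import Data.List.Membership.DecPropositional _≟ᴴ_ using (_∈?_)

    climb? : ∀ U y → Dec (Climb U y)
    climb? U y = anyDir? λ t → ¬? (y ⊕ t ∈? U) ×-dec (φ y t BP.≟ false)

    fall? : ∀ U y → Dec (Fall U y)
    fall? U y = anyDir? λ t → ¬? (y ⊖ t ∈? U) ×-dec (φ (y ⊖ t) t BP.≟ false)

    -- Every hexagon off U is joined to the exterior by arcs outside M that start off U.
    Connected : List Hx → Set
    Connected U = ∀ f → VanishesOutside f → (∀ y t → φ y t ≡ false → y ∉ U → f (y ⊕ t) ≡ f y) → ∀ y → y ∉ U →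
      f y ≡ + 0

    -- `tails` keeps the contours in the part not yet flooded, which separates them from earlier
    -- ones. `bound` is one half of the anti-forcing property: the potential from `φ` to a matching
    -- that avoids `es` is nowhere positive.
    record Grown (U : List Hx) : Set where
      field
        es : List Ed
        closed : All (Closed up φ) es
        outer : All Outer es
        tails : All (λ e → ∀ n → proj₁ (iter n (nxt up φ) e) ∈ U) es
        distinct : AllPairs (λ e e′ → Distinct e′ e) es
        bound : ∀ f → VanishesOutside f → (∀ x t → φ x t ≡ false → f (x ⊕ t) ℤ.≤ f x) →
          All (λ e → f (proj₁ e) ≡ f (proj₁ e ⊕ proj₂ e)) es → (∀ y → y ∉ U → f y ℤ.≤ + 0) → ∀ y → f y ℤ.≤ + 0

    -- When no edge outside M enters U, the lowest edge leaving U has its whole contour in U.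
    module Stuck (U : List Hx) (U-int : ∀ y → y ∈ U → Int y) (stuck : ¬ Any (Fall U) U) where
      closed-down : ∀ y t → y ∈ U → φ (y ⊖ t) t ≡ false → y ⊖ t ∈ U
      closed-down y t m f with y ⊖ t ∈? U
      ... | yes p = p
      ... | no n = ⊥-elim (stuck (Any.map (λ { refl → t , n , f }) m))

      closed-down′ : ∀ y t → y ⊕ t ∈ U → φ y t ≡ false → y ∈ U
      closed-down′ y t m f = subst (_∈ U) (⊕⊖ y t) (closed-down (y ⊕ t) t m (trans (cong (λ z → φ z t) (⊕⊖ y t)) f))

      -- A line in direction b leaves `U`. If its exit `y → y ⊕ b` is matched, then the arcs
      -- `y ⊕ b → y ⊕ b ⊕ c → y` are not, and closure under predecessors puts `y ⊕ b` into `U` after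
      -- all.
      leaves : ∀ y → y ∈ U → Any (Climb U) U
      leaves y m = let n , e = ⊕-escape y in go n y m e
        where
        go : ∀ n y → y ∈ U → I (iter n (_⊕ b) y) ≡ false → Any (Climb U) U
        go zero y m e = absurdᵇ (U-int y m) e
        go (suc n) y m e with y ⊕ b ∈? U
        ... | yes p = go n (y ⊕ b) p (trans (cong I (iter-comm n (_⊕ b) y)) e)
        ... | no ¬p with split (φ y b)
        ... | inj₂ f = Any.map (λ { refl → b , ¬p , f }) m
        ... | inj₁ t with one up y b (U-int y m)
        ... | one₂ o _ _ = absurdᵇ t o
        ... | one₃ o _ _ = absurdᵇ t o
        ... | one₁ _ f g = ⊥-elim (¬p (closed-down′ (y ⊕ b) c
              (closed-down′ (y ⊕ b ⊕ c) a (subst (_∈ U) (sym (⊕-tri up y b)) m) g) f))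

      module Lowest (u : Hx) (x : Dir) (u∈ : u ∈ U) (out : u ⊕ x ∉ U) (f₀ : φ u x ≡ false)
                    (low : ∀ y → y ∈ U → Climb U y → h u ℤ.≤ h y) where
        Inv : Ed → Set
        Inv e = proj₁ e ∈ U × h (proj₁ e) ≡ h u × at φ e ≡ false

        -- When an M-edge is crossed, the hexagon `t` between the two tails is one lower than they
        -- are. If `t ⊕ y` were outside `U`, then `t` would be an exit below the lowest one.
        step : ∀ e → Inv e → Inv (nxt up φ e)
        step (v , y) (m , eq , f) with turn up v y (inj₁ (U-int v m)) f
        ... | around _ _ _ _ _ f₁ _ q rewrite q = m , eq , f₁
        ... | across t _ tv _ f₁ f₂ f₃ _ q rewrite q = u′∈ ,
          trans (h-free t-int (U-int _ u′∈) f₂) (trans (sym hv) eq) , f₃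
          where
          t∈ : t ∈ U
          t∈ = closed-down′ t (rot dn y) (subst (_∈ U) (sym tv) m) f₁
          t-int = U-int t t∈
          hv : h v ≡ ℤ.suc (h t)
          hv = trans (cong h (sym tv)) (h-free t-int (trans (cong I tv) (U-int v m)) f₁)
          u′∈ : t ⊕ y ∈ U
          u′∈ with t ⊕ y ∈? U
          ... | yes p = p
          ... | no n = ⊥-elim (ℤP.<⇒≱ (subst (h t ℤ.<_) (trans (sym hv) eq) (i<suc[i] (h t)))
            (low t t∈ (y , n , f₂)))

        inv : ∀ n → Inv (iter n (nxt up φ) (u , x))
        inv n = iter-invariant (nxt up φ) Inv step n (u , x) (u∈ , refl , f₀)

        edges : List Ed
        edges = map (_, a) U ++ map (_, b) U ++ map (_, c) U

        in-edges : ∀ y t → y ∈ U → (y , t) ∈ edges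
        in-edges y a m = ∈-++⁺ˡ (∈-map⁺ (_, a) m)
        in-edges y b m = ∈-++⁺ʳ (map (_, a) U) (∈-++⁺ˡ (∈-map⁺ (_, b) m))
        in-edges y c m = ∈-++⁺ʳ (map (_, a) U) (∈-++⁺ʳ (map (_, b) U) (∈-map⁺ (_, c) m))

        -- The tails lie in the finite `U`, so some edge repeats; since `nxt` can be undone, the
        -- starting edge repeats as well.
        contour : Closed up φ (u , x)
        contour with sequence-repeats (λ n → iter n (nxt up φ) (u , x)) edges (λ n → in-edges _ _ (proj₁ (inv n)))
        ... | i , j , i<j , eq = record
          { p = j ℕ.∸ suc i
          ; period = trans (cong (λ k → iter k (nxt up φ) (u , x)) (sym (ℕP.+-∸-assoc 1 i<j)))
            (sym (cancel i (j ℕ.∸ i)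
              (trans eq (cong (λ k → iter k (nxt up φ) (u , x)) (sym (ℕP.m+[n∸m]≡n (ℕP.<⇒≤ i<j)))))))
          ; hedge = λ n → inj₁ (U-int _ (proj₁ (inv n)))
          ; free = λ n → proj₂ (proj₂ (inv n)) }
          where
          cancel : ∀ i k → iter i (nxt up φ) (u , x) ≡ iter (i ℕ.+ k) (nxt up φ) (u , x) → (u , x)
            ≡ iter k (nxt up φ) (u , x)
          cancel zero k q = q
          cancel (suc i) k q = cancel i k (trans (sym (back i)) (trans (cong (nxt dn φ) q) (back (i ℕ.+ k))))
            where
            back : ∀ n → nxt dn φ (iter (suc n) (nxt up φ) (u , x)) ≡ iter n (nxt up φ) (u , x)
            back n = nxt-inverse up _ _ (inj₁ (U-int _ (proj₁ (inv n)))) (proj₂ (proj₂ (inv n)))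

    _∖_ : List Hx → Hx → List Hx
    U ∖ y = filter (λ z → ¬? (z ≟ᴴ y)) U

    ∖-shrinks : ∀ {U y} → y ∈ U → length (U ∖ y) < length U
    ∖-shrinks {U} {y} m = LP.filter-notAll (λ z → ¬? (z ≟ᴴ y)) U (Any.map (λ { refl n → n refl }) m)

    ∖⊆ : ∀ {U y z} → z ∈ U ∖ y → z ∈ U
    ∖⊆ {U} {y} m = proj₁ (∈-filter⁻ (λ z → ¬? (z ≟ᴴ y)) {xs = U} m)

    ∉∖ : ∀ {U y} → y ∉ U ∖ y
    ∉∖ {U} {y} m = proj₂ (∈-filter⁻ (λ z → ¬? (z ≟ᴴ y)) {xs = U} m) refl

    ∖-cases : ∀ {U y z} → z ∉ U ∖ y → z ∉ U ⊎ z ≡ y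
    ∖-cases {U} {y} {z} n with z ≟ᴴ y
    ... | yes p = inj₂ p
    ... | no ne = inj₁ λ m → n (∈-filter⁺ (λ z → ¬? (z ≟ᴴ y)) m ne)

    -- The complement of U is flooded from the exterior: along arcs outside M for free, and otherwise
    -- backwards along the lowest rim edge, which is then recorded in es.
    grow : ∀ n U → length U ≤ n → (∀ y → y ∈ U → Int y) → Connected U → Grown U
    grow n U le U-int conn with any? (fall? U) U
    grow zero [] le U-int conn | yes ()
    grow (suc n) U le U-int conn | yes q = extend (proj₂ (proj₂ fallen)) (proj₁ (proj₂ fallen))
      where
      fallen : ∃ λ y → y ∈ U × Fall U y
      fallen = let y , m , f = find q in y , m , f
      extend : ∀ {y} → Fall U y → y ∈ U → Grown U
      extend {y} (t , n∉ , f) m = record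
        { es = es ; closed = closed ; outer = outer ; tails = All.map (λ k n → ∖⊆ {U} (k n)) tails ; distinct =
          distinct
        ; bound = λ g z fr eqs base → bound g z fr eqs λ w w∉ → low g fr base w (∖-cases {U} w∉) }
        where
        x = y ⊖ t
        x⊕t : x ⊕ t ≡ y
        x⊕t = ⊖⊕ y t
        conn′ : Connected (U ∖ y)
        conn′ g z fr w w∉ with ∖-cases {U} w∉
        ... | inj₁ o = conn g z (λ v s e v∉ → fr v s e (v∉ ∘ ∖⊆ {U})) w o
        ... | inj₂ refl = trans (cong g (sym x⊕t)) (trans (fr x t f (n∉ ∘ ∖⊆ {U}))
                (conn g z (λ v s e v∉ → fr v s e (v∉ ∘ ∖⊆ {U})) x n∉))
        open Grown (grow n (U ∖ y) (ℕP.≤-pred (ℕP.≤-trans (∖-shrinks m) le)) (λ w k → U-int w (∖⊆ {U} k)) conn′)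
        low : ∀ g → (∀ x t → φ x t ≡ false → g (x ⊕ t) ℤ.≤ g x) → (∀ y → y ∉ U → g y ℤ.≤ + 0) →
          ∀ w → w ∉ U ⊎ w ≡ y → g w ℤ.≤ + 0
        low g fr base w (inj₁ o) = base w o
        low g fr base w (inj₂ refl) = ℤP.≤-trans (subst (λ k → g k ℤ.≤ g x) x⊕t (fr x t f)) (base x n∉)
    grow n [] le U-int conn | no stuck = record
      { es = [] ; closed = [] ; outer = [] ; tails = [] ; distinct = []
      ; bound = λ f z fr eqs base y → base y λ () }
    grow (suc n) U@(y₀ ∷ _) le U-int conn | no stuck = extend (lowest (climb? U) h U (leaves y₀ (here refl)))
      where
      open Stuck U U-int stuck
      extend : (∃ λ u → u ∈ U × Climb U u × (∀ y → y ∈ U → Climb U y → h u ℤ.≤ h y)) → Grown U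
      extend (u , u∈ , (x , out , f₀) , low) = record
        { es = (u , x) ∷ es
        ; closed = contour ∷ closed
        -- The contour has all its tails in `U`, so no arc that starts in the flooded part belongs
        -- to it, and `conn` applies to the head.
        ; outer = (λ g z fr → conn g z (λ v s e v∉ →
          fr v s e λ { (k , eq) → v∉ (subst (_∈ U) (cong proj₁ eq) (proj₁ (inv k))) }) (u ⊕ x) out) ∷ outer
        ; tails = (λ n → proj₁ (inv n)) ∷ All.map (λ k n → ∖⊆ {U} (k n)) tails
        -- Later contours have their tails in `U ∖ u` and cannot reach an edge with tail `u`.
        ; distinct = All.map (λ k → λ { (n , eq) →
          ∉∖ {U} (subst (_∈ U ∖ u) (cong proj₁ eq) (k n)) }) tails ∷ distinct
        ; bound = λ { g z fr (eq ∷ eqs) base → bound g z fr eqs λ w w∉ → low′ g eq base w (∖-cases {U} w∉) } }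
        where
        open Lowest u x u∈ out f₀ low
        conn′ : Connected (U ∖ u)
        conn′ g z fr w w∉ with ∖-cases {U} w∉
        ... | inj₁ o = conn g z (λ v s e v∉ → fr v s e (v∉ ∘ ∖⊆ {U})) w o
        ... | inj₂ refl = trans (sym (fr u x f₀ (∉∖ {U})))
          (conn g z (λ v s e v∉ → fr v s e (v∉ ∘ ∖⊆ {U})) (u ⊕ x) out)
        open Grown (grow n (U ∖ u) (ℕP.≤-pred (ℕP.≤-trans (∖-shrinks u∈) le)) (λ w k → U-int w (∖⊆ {U} k)) conn′)
        low′ : ∀ g → g u ≡ g (u ⊕ x) → (∀ y → y ∉ U → g y ℤ.≤ + 0) → ∀ w → w ∉ U ⊎ w ≡ u → g w ℤ.≤ + 0
        low′ g eq base w (inj₁ o) = base w o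
        low′ g eq base w (inj₂ refl) = subst (ℤ._≤ + 0) (sym eq) (base (u ⊕ x) out)

    ext∉cells : ∀ y → y ∉ cells → Ext y
    ext∉cells y n with int? y
    ... | inj₁ i = ⊥-elim (n (cells-complete y i))
    ... | inj₂ o = o

    abstract
      grown : Grown cells
      grown = grow (length cells) cells ℕP.≤-refl cells-sound λ f z _ y n → z y (ext∉cells y n)

    open Grown grown public using () renaming (es to sources)

    sources-closed : All (Closed up φ) sources
    sources-closed = Grown.closed grown

    sources-outer : All Outer sources
    sources-outer = Grown.outer grown

    sources-bound : ∀ f → VanishesOutside f → (∀ x t → φ x t ≡ false → f (x ⊕ t) ℤ.≤ f x) →
      All (λ e → f (proj₁ e) ≡ f (proj₁ e ⊕ proj₂ e)) sources → ∀ y → f y ℤ.≤ + 0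
    sources-bound f z fr eqs = Grown.bound grown f z fr eqs λ y n → ℤP.≤-reflexive (z y (ext∉cells y n))

    reverse-pairs : ∀ {es} → All (Closed up φ) es → AllPairs (λ e e′ → Distinct e′ e) es → AllPairs Distinct es
    reverse-pairs [] [] = []
    reverse-pairs (cl ∷ cls) (d ∷ ds) = All.map (λ n s → n (Contour.symmetric cl s)) d ∷ reverse-pairs cls ds

    sources-family : Family sources
    sources-family = record { closed = sources-closed ; distinct =
      reverse-pairs sources-closed (Grown.distinct grown) }

    -- The potential of a closed contour

    module ContourPotential {e : Ed} (cl : Closed up φ e) where
      open Contour cl
      open Flip cl using (flip; flip-PM; X; flip-free; flip-member; X-true; flip-matched)
      f : Hx → ℤ
      f = proj₁ (potential φ flip pm flip-PM)

      f-outside : VanishesOutside f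
      f-outside = proj₁ (proj₂ (potential φ flip pm flip-PM))

      f-step : ∀ x t → f (x ⊕ t) ℤ.+ val (flip x t) ≡ f x ℤ.+ val (φ x t)
      f-step = proj₂ (proj₂ (potential φ flip pm flip-PM))

      f-member : ∀ {x t} → SameContour up φ e (x , t) → f x ≡ ℤ.suc (f (x ⊕ t))
      f-member {x} {t} m = val-drop (f (x ⊕ t)) (f x) (flip x t) (φ x t) (f-step x t) (flip-member x t m)
        (member-free m)

      f-other : ∀ {x t} → φ x t ≡ false → ¬ SameContour up φ e (x , t) → f (x ⊕ t) ≡ f x
      f-other {x} {t} fr n = val-same (f (x ⊕ t)) (f x) (flip x t) (φ x t) (f-step x t)
        (trans (flip-free x t fr) (trans (BP.¬-not (λ q → n (X-true x t q))) (sym fr)))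

      f-drop : ∀ x t → f (x ⊕ t) ℤ.< f x → SameContour up φ e (x , t)
      f-drop x t lt = let p , q = val-drops (flip x t) (φ x t) (f-step x t) lt in
        X-true x t (trans (sym (flip-free x t q)) p)

      -- A rise needs an edge of `φ` that `flip` has dropped, and by construction of `flip` one of
      -- the other edges at its `up` end is then on the contour.
      f-rise : ∀ x t → f x ℤ.< f (x ⊕ t) → φ x t ≡ true ×
        (SameContour up φ e (x ⊕ t , rot up t) ⊎ SameContour up φ e (x ⊕ t ⊕ rot up t , rot dn t))
      f-rise x t lt with val-drops (φ x t) (flip x t) (sym (f-step x t)) lt
      ... | m , q with split (X (x ⊕ t) (rot up t)) | split (X (x ⊕ t ⊕ rot up t) (rot dn t))
      ... | inj₁ p | _ = m , inj₁ (X-true _ _ p)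
      ... | inj₂ _ | inj₁ p = m , inj₂ (X-true _ _ p)
      ... | inj₂ p | inj₂ r = absurdᵇ (trans (flip-matched x t m) (cong₂ (λ y z → not (y ∨ z)) p r)) q

      -- Along a line in direction b, a positive value must drop to 0 and a negative value must have dropped from 0.
      drop-forward : ∀ n y → + 0 ℤ.< f y → I (iter n (_⊕ b) y) ≡ false → ∃ λ z → row z ≡ row y ×
        SameContour up φ e (z , b)
      drop-forward zero y p e = ⊥-elim (ℤP.<-irrefl (sym (f-outside y e)) p)
      drop-forward (suc n) y p e with + 0 ℤ.<? f (y ⊕ b)
      ... | yes q = let z , r , m = drop-forward n (y ⊕ b) q (trans (cong I (iter-comm n (_⊕ b) y)) e) in z , trans r (⊕-row y) , m
      ... | no q = y , refl , f-drop y b (ℤP.≤-<-trans (ℤP.≮⇒≥ q) p)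

      drop-backward : ∀ n y → f y ℤ.< + 0 → I (iter n (_⊖ b) y) ≡ false → ∃ λ z → SameContour up φ e (z , b)
      drop-backward zero y p e = ⊥-elim (ℤP.<-irrefl (f-outside y e) p)
      drop-backward (suc n) y p e with f (y ⊖ b) ℤ.<? + 0
      ... | yes q = drop-backward n (y ⊖ b) q (trans (cong I (iter-comm n (_⊖ b) y)) e)
      ... | no q = y ⊖ b , f-drop (y ⊖ b) b (ℤP.<-≤-trans (subst (λ k → f k ℤ.< + 0) (sym (⊖⊕ y b)) p) (ℤP.≮⇒≥ q))

      -- The drop by 1 across `e` makes the potential positive at the tail or negative at the head.
      -- The line in direction b through that hexagon has value 0 at both ends, so it contains a
      -- drop.
      crossesB : ∃ λ z → SameContour up φ e (z , b)
      crossesB with + 0 ℤ.<? f (proj₁ e)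
      ... | yes p = let n , o = ⊕-escape (proj₁ e) ; z , _ , m = drop-forward n _ p o in z , m
      ... | no p = let n , o = ⊖-escape (proj₁ e ⊕ proj₂ e) in drop-backward n _
              (ℤP.<-≤-trans (subst (f (proj₁ e ⊕ proj₂ e) ℤ.<_) (sym (f-member (0 , refl))) (i<suc[i] _))
                (ℤP.≮⇒≥ p)) o

-- The basin of an outer contour

module OuterContour (R : Region) {φ : Matching} (pm : Contours.PM (Region.lattice R) φ) where
  open Growth R
  open Matching-Growth pm

  module Below {e : Ed} (cl : Closed up φ e) (outer : Outer e) where
    open Contour cl
    open ContourPotential cl

    u₀ : Hx
    u₀ = proj₁ e

    k : ℤ
    k = h u₀

    f-head : f (u₀ ⊕ proj₂ e) ≡ + 0
    f-head = outer f f-outside λ y t → f-other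

    f-tail : + 0 ℤ.< f u₀
    f-tail = subst (+ 0 ℤ.<_) (sym (trans (f-member (0 , refl)) (cong ℤ.suc f-head))) (ℤ.+<+ (s≤s z≤n))

    f-int : ∀ {x} → + 0 ℤ.< f x → Int x
    f-int {x} = pos-int f-outside x

    u₀-int : Int u₀
    u₀-int = f-int f-tail

    -- The hexagon `t` passed when crossing an M-edge differs in colour from the tails, so its two
    -- arcs used here are off the contour: the potential is unchanged, and the height goes down and
    -- up by 1.
    tails-level : ∀ n → + 0 ℤ.< f (proj₁ (iter n (nxt up φ) e)) × h (proj₁ (iter n (nxt up φ) e)) ≡ k
    tails-level zero = f-tail , refl
    tails-level (suc n) with iter n (nxt up φ) e in it | tails-level n
    ... | v , y | pos , lev with turn up v y (inj₁ (f-int pos)) (member-free (n , it))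
    ... | around _ _ _ _ _ _ _ q rewrite q = pos , lev
    ... | across t _ tv _ f₁ f₂ _ _ q rewrite q = pos′ , trans (h-free (f-int post) (f-int pos′) f₂)
            (trans (sym (h-free (f-int post) (subst Int (sym tv) (f-int pos)) f₁)) (trans (cong h tv) lev))
      where
      other : ∀ s → ¬ SameContour up φ e (t , s)
      other s m = ⊕-colour t (rot dn y) (trans (cong colour tv)
        (trans (member-colour {v , y} (n , it)) (sym (member-colour m))))
      post : + 0 ℤ.< f t
      post = subst (+ 0 ℤ.<_) (trans (cong f (sym tv)) (f-other f₁ (other (rot dn y)))) pos
      pos′ : + 0 ℤ.< f (t ⊕ y)
      pos′ = subst (+ 0 ℤ.<_) (sym (f-other f₂ (other y))) post

    member-level : ∀ {x t} → SameContour up φ e (x , t) → + 0 ℤ.< f x × h x ≡ k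
    member-level (n , eq) = subst (λ e → + 0 ℤ.< f (proj₁ e) × h (proj₁ e) ≡ k) eq (tails-level n)

    -- Positive potential means enclosed by the contour. Enclosed hexagons above its level are cut
    -- out, since a basin has only depths below the rim.
    Ω? : ∀ x → Dec (+ 0 ℤ.< f x × h x ℤ.≤ k)
    Ω? x = (+ 0 ℤ.<? f x) ×-dec (h x ℤ.≤? k)

    Ω : Hx → Bool
    Ω x = does (Ω? x)

    Ω-true : ∀ x → Ω x ≡ true → + 0 ℤ.< f x × h x ℤ.≤ k
    Ω-true x = does-true (Ω? x)

    off : ∀ x → Ω x ≡ false → f x ℤ.≤ + 0 ⊎ (+ 0 ℤ.< f x × k ℤ.< h x)
    off x o = go (+ 0 ℤ.<? f x)
      where
      go : Dec (+ 0 ℤ.< f x) → f x ℤ.≤ + 0 ⊎ (+ 0 ℤ.< f x × k ℤ.< h x)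
      go (no n) = inj₁ (ℤP.≮⇒≥ n)
      go (yes p) = inj₂ (p , ℤP.≰⇒> λ q → does-false (Ω? x) o (p , q))

    depth : Hx → ℕ
    depth x = below k (h x)

    depth-level : ∀ {x} → h x ≡ k → depth x ≡ 0
    depth-level {x} eq = trans (cong (below k) eq) (below-self k)

    basin : Basin
    basin = record
      { Ω = Ω ; depth = depth ; Ω-int = λ x o → f-int (proj₁ (Ω-true x o))
      ; enter = enter ; exit = exit ; inner-free = inner-free ; inner-matched = inner-matched }
      where
      -- If `x` is enclosed but too high, only a fall by 2 can lead to `Ω`. If the potential rises
      -- instead, an edge of the contour meets the arc; its tail, at level `k`, is `x ⊕ t` itself or
      -- one step above it.
      enter : ∀ x t → Ω x ≡ false → Ω (x ⊕ t) ≡ true → φ x t ≡ true × depth (x ⊕ t) ≤ 1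
      enter x t o p with Ω-true (x ⊕ t) p | off x o
      ... | pos , le | inj₂ (pos′ , gt) with split (φ x t)
      ... | inj₁ m = m , below-≤1 k (h (x ⊕ t)) le (subst (k ℤ.<_) (h-matched (f-int pos′) (f-int pos) m) gt)
      ... | inj₂ fr = ⊥-elim (ℤP.<⇒≱ (ℤP.<-trans gt
        (subst (h x ℤ.<_) (sym (h-free (f-int pos′) (f-int pos) fr)) (i<suc[i] (h x)))) le)
      enter x t o p | pos , le | inj₁ neg with f-rise x t (ℤP.≤-<-trans neg pos)
      ... | m , inj₁ q = m , ℕP.≤-trans (ℕP.≤-reflexive (depth-level (proj₂ (member-level q)))) z≤n
      ... | m , inj₂ q with one′ up x t (inj₂ (f-int pos))
      ... | one₂ r _ _ = absurdᵇ m r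
      ... | one₃ r _ _ = absurdᵇ m r
      ... | one₁ _ fr _ = m , ℕP.≤-reflexive
        (trans (below-suc k (h (x ⊕ t)) (ℤP.≤-reflexive lev))
        (cong suc (trans (cong (below k) lev) (below-self k))))
        where
        lev : ℤ.suc (h (x ⊕ t)) ≡ k
        lev = trans (sym (h-free (f-int pos) (f-int (proj₁ (member-level q))) fr)) (proj₂ (member-level q))
      -- Where the potential drops, the arc itself is on the contour. Otherwise the height passes
      -- level `k` upwards, which takes an arc outside M from level `k` exactly.
      exit : ∀ x t → Ω x ≡ true → Ω (x ⊕ t) ≡ false → φ x t ≡ false × depth x ≡ 0
      exit x t o p with Ω-true x o | off (x ⊕ t) p
      ... | pos , le | inj₁ neg = let m = f-drop x t (ℤP.≤-<-trans neg pos) in member-free m , depth-level (proj₂ (member-level m))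
      ... | pos , le | inj₂ (pos′ , gt) with split (φ x t)
      ... | inj₂ fr = fr , depth-level (ℤP.≤-antisym le
        (i<suc[j]⇒i≤j (subst (k ℤ.<_) (h-free (f-int pos) (f-int pos′) fr) gt)))
      ... | inj₁ m = ⊥-elim (ℤP.<⇒≱ gt (ℤP.≤-trans (ℤP.≤-trans (ℤP.i≤suc[i] _) (ℤP.i≤suc[i] _))
              (subst (ℤ._≤ k) (h-matched (f-int pos) (f-int pos′) m) le)))
      inner-free : ∀ x t → Ω x ≡ true → Ω (x ⊕ t) ≡ true → φ x t ≡ false → depth x ≡ suc (depth (x ⊕ t))
      inner-free x t o p fr with Ω-true x o | Ω-true (x ⊕ t) p
      ... | pos , le | pos′ , le′ with h-free (f-int pos) (f-int pos′) fr
      ... | eq = trans (below-suc k (h x) (subst (ℤ._≤ k) eq le′)) (cong (suc ∘ below k) (sym eq))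
      inner-matched : ∀ x t → Ω x ≡ true → Ω (x ⊕ t) ≡ true → φ x t ≡ true → depth (x ⊕ t) ≡ suc (suc (depth x))
      inner-matched x t o p m with Ω-true x o | Ω-true (x ⊕ t) p
      ... | pos , le | pos′ , le′ with h-matched (f-int pos) (f-int pos′) m
      ... | eq = trans (below-suc k (h (x ⊕ t)) (ℤP.≤-trans (ℤP.i≤suc[i] _) (subst (ℤ._≤ k) eq le)))
            (cong suc (trans (below-suc k (ℤ.suc (h (x ⊕ t))) (subst (ℤ._≤ k) eq le))
              (cong (suc ∘ below k) (sym eq))))

    open Basin basin using (enter; exit; inner-free)
    open Flatten pm basin using (gain; flatten; flatten-PM; CrossesB)

    u₀∈Ω : Ω u₀ ≡ true
    u₀∈Ω = dec-true (Ω? u₀) (f-tail , ℤP.≤-refl)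

    -- The hexagon w lies at depth 1, so it and its three successors lie in Ω, on three different lines in direction b.
    improve : ∀ {es} → Family (e ∷ es) → (∃ λ t → φ (u₀ ⊖ t) t ≡ false) →
      ∃ λ φ′ → Σ (PM φ′) λ pm′ → Σ (List Ed) λ es′ → Matched.Family pm′ es′ × 2 ℕ.+ length (e ∷ es) ≤ length es′
    improve {es} F (t , fr) = flatten , flatten-PM ,
      gain F u₀∈Ω (proj₂ (proj₂ (line w o))) (proj₂ (proj₂ (line (w ⊕ a) (succ a))))
        (proj₂ (proj₂ (line (w ⊕ c) (succ c))))
        (differ w (w ⊕ a) o (succ a) (proj₁ (⊕-rows w))) (differ w (w ⊕ c) o (succ c) (proj₁ (proj₂ (⊕-rows w))))
        (differ (w ⊕ a) (w ⊕ c) (succ a) (succ c) (proj₂ (proj₂ (⊕-rows w))))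
        (All.map (λ cl′ → ContourPotential.crossesB cl′) (All.tail (Family.closed F)))
      where
      w : Hx
      w = u₀ ⊖ t
      wu : Ω (w ⊕ t) ≡ true
      wu = trans (cong Ω (⊖⊕ u₀ t)) u₀∈Ω
      o : Ω w ≡ true
      o with split (Ω w)
      ... | inj₁ p = p
      ... | inj₂ p = absurdᵇ (proj₁ (enter w t p wu)) fr
      succ : ∀ s → Ω (w ⊕ s) ≡ true
      succ s with split (Ω (w ⊕ s))
      ... | inj₁ p = p
      ... | inj₂ p = ⊥-elim (ℕP.0≢1+n (trans (sym (proj₂ (exit w s o p))) (inner-free w t o wu fr)))
      line : ∀ z → Ω z ≡ true → ∃ λ y → row y ≡ row z × CrossesB e y
      line z p = let n , q = ⊕-escape z in drop-forward n z (proj₁ (Ω-true z p)) q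
      differ : ∀ z z′ (p : Ω z ≡ true) (p′ : Ω z′ ≡ true) → row z ≢ row z′ → proj₁ (line z p) ≢ proj₁ (line z′ p′)
      differ z z′ p p′ n eq = n (trans (sym (proj₁ (proj₂ (line z p))))
        (trans (cong row eq) (proj₁ (proj₂ (line z′ p′)))))

    source-or-improve : (∀ t → φ (u₀ ⊖ t) t ≡ true) ⊎ (∃ λ t → φ (u₀ ⊖ t) t ≡ false)
    source-or-improve with anyDir? (λ t → φ (u₀ ⊖ t) t BP.≟ false)
    ... | yes p = inj₂ p
    ... | no n = inj₁ λ t → BP.¬-not λ q → n (t , q)

-- Duality: reversing all arcs

-- Reversing all arcs exchanges sources with peaks; the edge u → u ⊕ x is then named by its head.
module Dual (L : Lattice) where
  open Contours L
  module D = Contours (dualLattice L)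

  Mirror : Matching → Matching → Set
  Mirror φ ψ = ∀ u x → ψ (u ⊕ x) x ≡ φ u x

  mirror′ : ∀ {φ ψ} → Mirror φ ψ → ∀ u x → φ (u ⊖ x) x ≡ ψ u x
  mirror′ {φ} {ψ} m u x = trans (sym (m (u ⊖ x) x)) (cong (λ z → ψ z x) (⊖⊕ u x))

  ρ : Ed → Ed
  ρ (u , x) = u ⊕ x , x

  ρ-injective : ∀ {e e′} → ρ e ≡ ρ e′ → e ≡ e′
  ρ-injective {u , x} {v , y} eq with cong proj₂ eq
  ... | refl = cong (_, x) (trans (sym (⊕⊖ u x)) (trans (cong (_⊖ x) (cong proj₁ eq)) (⊕⊖ v x)))

  ⊖⊖ : ∀ s u x → u ⊖ x ⊖ rot s x ≡ u ⊕ rot (opp s) x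
  ⊖⊖ s u x = trans (sym (⊖⊕ _ (rot (opp s) x))) (cong (_⊕ rot (opp s) x) (⊖-tri s u x))

  -- The arcs around a vertex are met in the opposite cyclic order after reversal; hence the sense
  -- `opp s` and the swap.
  mirror-PM : ∀ {φ ψ} → Mirror φ ψ → PM φ → D.PM ψ
  mirror-PM {φ} {ψ} m pm = record { inside = ins ; one = on }
    where
    open PM pm
    ins : ∀ u x → ψ u x ≡ true → D.HEdge (u , x)
    ins u x q with inside (u ⊖ x) x (trans (mirror′ {φ} {ψ} m u x) q)
    ... | inj₁ i = inj₂ i
    ... | inj₂ i = inj₁ (trans (cong I (sym (⊖⊕ u x))) i)
    on : ∀ s u x → Int u → D.OneAt ψ s u x
    on s u x i = One-rot (One-swap (subst₃ One (trans e₁ (mirror′ {φ} {ψ} m _ _))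
      (trans e₂ (mirror′ {φ} {ψ} m _ _)) (trans e₃ (mirror′ {φ} {ψ} m _ _)) (one (opp s) u (rot (opp s) x) i)))
      where
      subst₃ : ∀ (P : Bool → Bool → Bool → Set) {p p′ q q′ r r′} → p ≡ p′ → q ≡ q′ → r ≡ r′ → P p q r → P p′ q′ r′
      subst₃ P refl refl refl x = x
      t₂ : rot (opp s) (rot (opp s) x) ≡ rot s x
      t₂ = trans (rot-rot (opp s) x) (cong (λ k → rot k x) (opp² s))
      t₃ : rot (opp (opp s)) (rot (opp s) x) ≡ x
      t₃ = trans (cong (λ k → rot k (rot (opp s) x)) (opp² s)) (rot-rot-opp s x)
      e₁ : φ u (rot (opp s) x) ≡ φ (u ⊖ x ⊖ rot s x ⊖ rot (opp s) x) (rot (opp s) x)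
      e₁ = cong (λ z → φ z (rot (opp s) x)) (sym (⊖-tri s u x))
      e₂ : φ (u ⊕ rot (opp s) x) (rot (opp s) (rot (opp s) x)) ≡ φ (u ⊖ x ⊖ rot s x) (rot s x)
      e₂ = cong₂ φ (sym (⊖⊖ s u x)) t₂
      e₃ : φ (u ⊕ rot (opp s) x ⊕ rot (opp s) (rot (opp s) x)) (rot (opp (opp s)) (rot (opp s) x)) ≡ φ (u ⊖ x) x
      e₃ = cong₂ φ (trans (cong₂ _⊕_ (sym (⊖⊖ s u x)) t₂) (⊖⊕ (u ⊖ x) (rot s x))) t₃

  antiforcing-mirror : ∀ {φ ψ S} → Mirror φ ψ → (∀ {χ} → D.PM χ → PM (λ u x → χ (u ⊕ x) x)) →
    AntiForcing φ S → D.AntiForcing ψ (map ρ S)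
  antiforcing-mirror {φ} {ψ} {S} m un (fr , uq) =
    AllP.map⁺ (All.map (λ {e} q → trans (m (proj₁ e) (proj₂ e)) q) fr) ,
    λ χ pm avoid v x → trans (cong (λ z → χ z x) (sym (⊖⊕ v x)))
      (trans (uq (λ u x → χ (u ⊕ x) x) (un pm) (AllP.map⁻ avoid) (v ⊖ x) x) (mirror′ {φ} {ψ} m v x))

  module Transfer {φ ψ : Matching} (m : Mirror φ ψ) (pm : PM φ) where
    open Matched pm
    module DM = D.Matched (mirror-PM {φ} {ψ} m pm)

    -- The cases of `Turn` are exchanged: two successive edges have a common tail in one case and a
    -- common head in the other. The contour remains the same, run through backwards.
    nxt-mirror : ∀ s u x → HEdge (u , x) → φ u x ≡ false → D.nxt s ψ (ρ (u , x)) ≡ ρ (nxt (opp s) φ (u , x))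
    nxt-mirror s u x h fr with turn (opp s) u x h fr
    ... | across t _ tu _ f₁ _ _ tv q rewrite opp² s =
      trans (D.nxt-false s ψ (u ⊕ x) x (trans (sym (mirror′ {φ} {ψ} m (u ⊕ x ⊖ x) (rot s x)))
              (trans (cong (λ z → φ z (rot s x)) (trans (cong (_⊖ rot s x) (⊕⊖ u x))
                (trans (cong (_⊖ rot s x) (sym tu)) (⊕⊖ t (rot s x))))) f₁)))
        (trans (cong (_, rot s x) (sym tv)) (cong ρ (sym q)))
    ... | around t t≡ tu _ m₁ _ _ q rewrite opp² s =
      trans (D.nxt-true s ψ (u ⊕ x) x (trans (sym (mirror′ {φ} {ψ} m (u ⊕ x ⊖ x) (rot s x)))
        (trans (cong (λ z → φ z (rot s x)) tt) m₁)))
        (trans (cong (_, rot (opp s) x) (trans (cong (_⊖ x) (trans tt t≡))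
          (trans (cong (_⊖ x) (⊕-comm u x (rot (opp s) x))) (⊕⊖ _ x))))
          (cong ρ (sym q)))
      where
      tt : u ⊕ x ⊖ x ⊖ rot s x ≡ t
      tt = trans (cong (_⊖ rot s x) (trans (⊕⊖ u x) (sym tu))) (⊕⊖ t (rot s x))

    module _ {e : Ed} (cl : Closed up φ e) where
      open Contour cl

      backwards : ∀ n → SameContour up φ e (iter n (nxt dn φ) e)
      backwards zero = 0 , refl
      backwards (suc n) = backward (backwards n)

      unwind : ∀ n → iter n (nxt dn φ) (iter n (nxt up φ) e) ≡ e
      unwind zero = refl
      unwind (suc n) = trans (sym (iter-comm n (nxt dn φ) _))
        (trans (cong (iter n (nxt dn φ)) (nxt-inverse up _ _ (hedge n) (free n))) (unwind n))

      iter-mirror : ∀ n → iter n (D.nxt up ψ) (ρ e) ≡ ρ (iter n (nxt dn φ) e)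
      iter-mirror zero = refl
      iter-mirror (suc n) = trans (cong (D.nxt up ψ) (iter-mirror n))
        (nxt-mirror up _ _ (member-hedge (backwards n)) (member-free (backwards n)))

      mirror-closed : D.Closed up ψ (ρ e)
      mirror-closed = record
        { p = p
        ; period = trans (iter-mirror (suc p))
          (cong ρ (trans (cong (iter (suc p) (nxt dn φ)) (sym period)) (unwind (suc p))))
        ; hedge = λ n → subst D.HEdge (sym (iter-mirror n)) (sw (iter n (nxt dn φ) e) (member-hedge (backwards n)))
        ; free = λ n → trans (cong (D.at ψ) (iter-mirror n)) (trans (m _ _) (member-free (backwards n))) }
        where
        sw : ∀ e → HEdge e → D.HEdge (ρ e)
        sw (u , x) (inj₁ i) = inj₂ (trans (cong I (⊕⊖ u x)) i)
        sw (u , x) (inj₂ i) = inj₁ i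

      mirror-same : ∀ {e′} → D.SameContour up ψ (ρ e) (ρ e′) → SameContour up φ e e′
      mirror-same (n , eq) = subst (SameContour up φ e) (ρ-injective (trans (sym (iter-mirror n)) eq)) (backwards n)

    same-mirror : ∀ {e e′} → Closed up φ e → SameContour up φ e e′ → D.SameContour up ψ (ρ e) (ρ e′)
    same-mirror {e} {e′} cl s =
      let n , eq = Contour.symmetric cl s
      in n , trans (iter-mirror cl n) (cong ρ (trans (cong (iter n (nxt dn φ)) (sym eq)) (unwind (Contour.closed-member cl s) n)))

    mirror-family : ∀ {es} → Family es → DM.Family (map ρ es)
    mirror-family F = record { closed = AllP.map⁺ (All.map mirror-closed closed) ; distinct =
      pairs closed distinct }
      where
      open Family F
      pairs : ∀ {es} → All (Closed up φ) es → AllPairs Distinct es → AllPairs DM.Distinct (map ρ es)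
      pairs [] [] = []
      pairs (cl ∷ cls) (d ∷ ds) = AllP.map⁺ (All.map (λ n s → n (mirror-same cl s)) d) ∷ pairs cls ds

mirror-refl : ∀ (L : Lattice) → let open Lattice L in (φ : Matching) → Dual.Mirror L φ (λ u x → φ (u ⊖ x) x)
mirror-refl L φ u x = cong (λ z → φ z x) (Lattice.⊕⊖ L u x)

unmirror-PM : ∀ (L : Lattice) → let open Lattice L in ∀ {χ} → Contours.PM (dualLattice L) χ → Contours.PM L (λ u x → χ (u ⊕ x) x)
unmirror-PM L {χ} pm = Dual.mirror-PM (dualLattice L) {χ} (mirror-refl (dualLattice L) χ) pm

dualRegion : Region → Region
dualRegion R = record { lattice = dualLattice lattice ; potential = pot ; height = hei }
  where
  open Region R
  open Lattice lattice
  module D = Contours (dualLattice lattice)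
  pot : ∀ φ₁ φ₂ → D.PM φ₁ → D.PM φ₂ → ∃ λ (f : Hx → ℤ) →
    (∀ x → D.Ext x → f x ≡ + 0) × (∀ x t → f (x ⊖ t) ℤ.+ val (φ₂ x t) ≡ f x ℤ.+ val (φ₁ x t))
  pot φ₁ φ₂ p₁ p₂ with potential _ _ (unmirror-PM lattice p₁) (unmirror-PM lattice p₂)
  ... | f , z , st = (λ x → ℤ.- f x) , (λ x o → cong ℤ.-_ (z x o)) , λ x t →
        lem (f x) (f (x ⊖ t)) _ _ (subst (λ y → f y ℤ.+ val (φ₂ y t) ≡ f (x ⊖ t) ℤ.+ val (φ₁ y t)) (⊖⊕ x t)
          (st (x ⊖ t) t))
    where
    lem : ∀ p q r s → p ℤ.+ r ≡ q ℤ.+ s → ℤ.- q ℤ.+ r ≡ ℤ.- p ℤ.+ s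
    lem p q r s eq = begin
      ℤ.- q ℤ.+ r ≡⟨ solve 3 (λ p q r → :- q :+ r := :- p :+ (:- q :+ (p :+ r))) refl p q r ⟩
      ℤ.- p ℤ.+ (ℤ.- q ℤ.+ (p ℤ.+ r)) ≡⟨ cong (λ z → ℤ.- p ℤ.+ (ℤ.- q ℤ.+ z)) eq ⟩
      ℤ.- p ℤ.+ (ℤ.- q ℤ.+ (q ℤ.+ s)) ≡⟨ solve 3 (λ p q s → :- p :+ (:- q :+ (q :+ s)) := :- p :+ s) refl p q s ⟩
      ℤ.- p ℤ.+ s ∎
      where open ≡-Reasoning
  hei : ∀ φ → D.PM φ → ∃ λ (h : Hx → ℤ) → ∀ x t → D.Int x → D.Int (x ⊖ t) →
      (φ x t ≡ false → h (x ⊖ t) ≡ ℤ.suc (h x)) × (φ x t ≡ true → h x ≡ ℤ.suc (ℤ.suc (h (x ⊖ t))))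
  hei φ p with height _ (unmirror-PM lattice p)
  ... | h , st = (λ x → ℤ.- h x) , λ x t i j →
        let s₁ , s₂ = st (x ⊖ t) t j (trans (cong I (⊖⊕ x t)) i)
            e : φ (x ⊖ t ⊕ t) t ≡ φ x t
            e = cong (λ y → φ y t) (⊖⊕ x t)
        in (λ fr → lem₁ _ _ (trans (cong h (sym (⊖⊕ x t))) (s₁ (trans e fr)))) ,
           (λ m → lem₂ _ _ (trans (s₂ (trans e m)) (cong (ℤ.suc ∘ ℤ.suc ∘ h) (⊖⊕ x t))))
    where
    lem₁ : ∀ p q → p ≡ ℤ.suc q → ℤ.- q ≡ ℤ.suc (ℤ.- p)
    lem₁ p q refl = solve 1 (λ q → :- q := con (+ 1) :+ (:- (con (+ 1) :+ q))) refl q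
    lem₂ : ∀ p q → q ≡ ℤ.suc (ℤ.suc p) → ℤ.- p ≡ ℤ.suc (ℤ.suc (ℤ.- q))
    lem₂ p q refl = solve 1 (λ p → :- p := con (+ 1) :+ (con (+ 1) :+ (:- (con (+ 1) :+ (con (+ 1) :+ p))))) refl p

-- Either all contours bound hexagons, or the matching can be improved

module Dichotomy (R : Region) {φ : Matching} (pm : Contours.PM (Region.lattice R) φ) where
  open Growth R
  open Matching-Growth pm
  open Dual lattice

  ψ : Matching
  ψ u x = φ (u ⊖ x) x

  mir : Mirror φ ψ
  mir = mirror-refl lattice φ

  pm~ : D.PM ψ
  pm~ = mirror-PM {φ} {ψ} mir pm

  module G~ = Growth (dualRegion R)
  module M~ = G~.Matching-Growth pm~
  module Back = Dual (dualLattice lattice)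

  mir~ : Back.Mirror ψ φ
  mir~ u x = refl

  module To = Transfer {φ} {ψ} mir pm
  module From = Back.Transfer {ψ} {φ} mir~ pm~

  ρ-inverse : ∀ e → ρ (Back.ρ e) ≡ e
  ρ-inverse (u , x) = cong (_, x) (⊖⊕ u x)

  family⁻ : Matched.Family pm (map Back.ρ M~.sources)
  family⁻ = record
    { closed = AllP.map⁺ (All.map From.mirror-closed M~.sources-closed)
    ; distinct = Matched.Family.distinct (subst-pm (From.mirror-family M~.sources-family)) }
    where
    subst-pm : From.DM.Family (map Back.ρ M~.sources) → Matched.Family pm (map Back.ρ M~.sources)
    subst-pm F = record { closed = From.DM.Family.closed F ; distinct = From.DM.Family.distinct F }

  -- On a contour found by both floodings, the potential would be positive at the tails by
  -- `member-level` and 0 at a tail by `out~`, for which tails are heads.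
  opposite-distinct : ∀ {e e′} → Closed up φ e → Outer e → D.Closed up ψ e′ → M~.Outer e′ → Distinct e (Back.ρ e′)
  opposite-distinct {e} {v , t} cl out cl~ out~ s =
    ℤP.<-irrefl (sym zero-tail) (proj₁ (Below.member-level cl out s))
    where
    open OuterContour R pm
    open ContourPotential cl
    zero-tail : f (v ⊖ t) ≡ + 0
    zero-tail = out~ f f-outside λ y x fr n → sym (trans (cong f (sym (⊖⊕ y x))) (f-other fr λ s′ →
      n (subst₂ (D.SameContour up ψ) (ρ-inverse (v , t)) (cong (_, x) (⊖⊕ y x))
        (To.same-mirror (Contour.closed-member cl s) (same-trans (Contour.symmetric cl s) s′)))))

  contours : List Ed
  contours = sources ++ map Back.ρ M~.sources

  contours-family : Family contours
  contours-family = record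
    { closed = AllP.++⁺ sources-closed (Family.closed family⁻)
    ; distinct = AllPairsP.++⁺ (Family.distinct sources-family) (Family.distinct family⁻)
        (pairs sources-closed sources-outer) }
    where
    inner : ∀ {e es} → Closed up φ e → Outer e → All (D.Closed up ψ) es → All M~.Outer es →
      All (Distinct e) (map Back.ρ es)
    inner cl o [] [] = []
    inner cl o (cl~ ∷ cls) (o~ ∷ os) = opposite-distinct cl o cl~ o~ ∷ inner cl o cls os
    pairs : ∀ {es} → All (Closed up φ) es → All Outer es → All (λ e → All (Distinct e) (map Back.ρ M~.sources)) es
    pairs [] [] = []
    pairs (cl ∷ cls) (o ∷ os) = inner cl o M~.sources-closed M~.sources-outer ∷ pairs cls os

  contours-unique : Unique contours
  contours-unique = AllPairs.map (λ d eq → d (0 , eq)) (Family.distinct contours-family)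

  -- The potential `f` from `φ` to a matching `χ` that avoids the contours never rises along arcs
  -- outside `φ` and is constant across the listed ones. The flooding gives `f ≤ 0`, the reversed
  -- flooding `- f ≤ 0`, and `f = 0` means that the matchings agree.
  contours-antiforcing : AntiForcing φ contours
  contours-antiforcing = All.map (λ cl → Closed.free cl 0) (Family.closed contours-family) , uq
    where
    uq : ∀ χ → PM χ → All (λ e → at χ e ≡ false) contours → ∀ u x → χ u x ≡ φ u x
    uq χ pmχ avoid with potential φ χ pm pmχ
    ... | f , z , step = λ u x → sym (val-injective _ _
      (GP.∙-cancelˡ (AbelianGroup.group ℤP.+-0-abelianGroup) (f u) _ _
            (trans (sym (step u x)) (cong (ℤ._+ val (χ u x)) (trans (zero-f (u ⊕ x)) (sym (zero-f u)))))))
      where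
      avoid⁺ : All (λ e → at χ e ≡ false) sources
      avoid⁺ = AllP.++⁻ˡ sources avoid
      avoid⁻ : All (λ e → at χ (Back.ρ e) ≡ false) M~.sources
      avoid⁻ = AllP.map⁻ (AllP.++⁻ʳ sources avoid)
      free-step : ∀ x t → φ x t ≡ false → f (x ⊕ t) ℤ.+ val (χ x t) ≡ f x
      free-step x t fr = trans (step x t) (trans (cong (λ p → f x ℤ.+ val p) fr) (ℤP.+-identityʳ (f x)))
      nonneg : ∀ p → + 0 ℤ.≤ val p
      nonneg true = ℤ.+≤+ z≤n
      nonneg false = ℤ.+≤+ z≤n
      descend : ∀ x t → φ x t ≡ false → f (x ⊕ t) ℤ.≤ f x
      descend x t fr = ℤP.≤-trans (ℤP.≤-trans (ℤP.≤-reflexive (sym (ℤP.+-identityʳ _)))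
        (ℤP.+-monoʳ-≤ (f (x ⊕ t)) (nonneg (χ x t)))) (ℤP.≤-reflexive (free-step x t fr))
      equal : ∀ x t → φ x t ≡ false → χ x t ≡ false → f x ≡ f (x ⊕ t)
      equal x t fr q = trans (sym (free-step x t fr))
        (trans (cong (λ p → f (x ⊕ t) ℤ.+ val p) q) (ℤP.+-identityʳ _))
      upper : ∀ y → f y ℤ.≤ + 0
      upper = sources-bound f z descend (zipped sources-closed avoid⁺)
        where
        zipped : ∀ {es} → All (Closed up φ) es → All (λ e → at χ e ≡ false) es →
          All (λ e → f (proj₁ e) ≡ f (proj₁ e ⊕ proj₂ e)) es
        zipped [] [] = []
        zipped (cl ∷ cls) (q ∷ qs) = equal _ _ (Closed.free cl 0) q ∷ zipped cls qs
      lower : ∀ y → ℤ.- f y ℤ.≤ + 0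
      lower = M~.sources-bound (λ x → ℤ.- f x) (λ x o → cong ℤ.-_ (z x o))
        (λ x t fr → ℤP.neg-mono-≤ (subst (λ k → f k ℤ.≤ f (x ⊖ t)) (⊖⊕ x t) (descend (x ⊖ t) t fr)))
        (zipped M~.sources-closed avoid⁻)
        where
        zipped : ∀ {es} → All (D.Closed up ψ) es → All (λ e → at χ (Back.ρ e) ≡ false) es →
          All (λ e → ℤ.- f (proj₁ e) ≡ ℤ.- f (proj₁ e ⊖ proj₂ e)) es
        zipped [] [] = []
        zipped {(v , t) ∷ es} (cl ∷ cls) (q ∷ qs) = cong ℤ.-_ (trans (cong f (sym (⊖⊕ v t)))
          (sym (equal (v ⊖ t) t (D.Closed.free cl 0) q))) ∷ zipped cls qs
      zero-f : ∀ y → f y ≡ + 0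
      zero-f y = ℤP.≤-antisym (upper y) (ℤP.neg-cancel-≤ (lower y))

  -- A bound on all anti-forcing sets of `φ′`, so that no set of minimum size has to be produced.
  Improvement : Set
  Improvement = ∃ λ φ′ → PM φ′ × (∀ S → AntiForcing φ′ S → 2 ℕ.+ length contours ≤ length S)

  improve⁺ : ∀ {e} → e ∈ sources → (∃ λ t → φ (proj₁ e ⊖ t) t ≡ false) → Improvement
  improve⁺ {e} m dip = front (family-front contours-family (∈-++⁺ˡ m))
    where
    conclude : ∀ {n} → n ≡ length contours →
      (∃ λ φ′ → Σ (PM φ′) λ pm′ → Σ (List Ed) λ es′ → Matched.Family pm′ es′ × 2 ℕ.+ n ≤ length es′) → Improvement
    conclude len (φ′ , pm′ , es′ , F , le) = φ′ , pm′ , λ S af →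
      ℕP.≤-trans (subst (λ n → 2 ℕ.+ n ≤ length es′) len le) (Matched.weak-duality pm′ F af)
    front : (Σ (List Ed) λ ys → Family (e ∷ ys) × length (e ∷ ys) ≡ length contours) → Improvement
    front (ys , F , len) = conclude len
      (OuterContour.Below.improve R pm (All.lookup sources-closed m) (All.lookup sources-outer m) F dip)

  contours~ : D.Matched.Family pm~ (map ρ contours)
  contours~ = To.mirror-family contours-family

  -- The dual region improves the reversed matching; reversing once more carries the new matching
  -- and its bound back.
  improve⁻ : ∀ {e} → e ∈ M~.sources → (∃ λ t → ψ (proj₁ e ⊕ t) t ≡ false) → Improvement
  improve⁻ {e} m dip = front (D.Matched.family-front pm~ contours~
      (subst (_∈ map ρ contours) (ρ-inverse e) (∈-map⁺ ρ (∈-++⁺ʳ sources (∈-map⁺ Back.ρ m)))))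
    where
    conclude : ∀ {n} → n ≡ length contours →
      (∃ λ φ′ → Σ (D.PM φ′) λ pm′ → Σ (List Ed) λ es′ → D.Matched.Family pm′ es′ × 2 ℕ.+ n ≤ length es′) →
        Improvement
    conclude len (φ′ , pm′ , es′ , F , le) = (λ u x → φ′ (u ⊕ x) x) , unmirror-PM lattice pm′ , λ S af →
      ℕP.≤-trans (subst (λ n → 2 ℕ.+ n ≤ length es′) len le)
        (ℕP.≤-trans (D.Matched.weak-duality pm′ F
          (antiforcing-mirror {ψ = φ′} (λ u x → refl) (unmirror-PM lattice) af))
          (ℕP.≤-reflexive (LP.length-map ρ S)))
    front : (Σ (List Ed) λ ys → D.Matched.Family pm~ (e ∷ ys) × length (e ∷ ys) ≡ length (map ρ contours)) →
      Improvement
    front (ys , F , len) = conclude (trans len (LP.length-map ρ contours))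
      (OuterContour.Below.improve (dualRegion R) pm~ (All.lookup M~.sources-closed m)
        (All.lookup M~.sources-outer m) F dip)

  Tight : Set
  Tight = Σ (List Hx) λ xs → Unique xs × All (λ x → Int x × AlternatingHex x) xs × length contours ≡ length xs

  scan : ∀ {A : Set} {P : Ed → Set} es → (∀ e → e ∈ es → P e ⊎ A) → All P es ⊎ A
  scan [] g = inj₁ []
  scan (e ∷ es) g with g e (here refl) | scan es (λ e m → g e (there m))
  ... | inj₂ x | _ = inj₂ x
  ... | inj₁ p | inj₂ x = inj₂ x
  ... | inj₁ p | inj₁ ps = inj₁ (p ∷ ps)

  IsSource IsPeak : Hx → Set
  IsSource x = ∀ t → φ (x ⊖ t) t ≡ true
  IsPeak x = ∀ t → φ x t ≡ true

  check⁺ : ∀ e → e ∈ sources → (Int (proj₁ e) × IsSource (proj₁ e)) ⊎ Improvement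
  check⁺ e m = go (OuterContour.Below.source-or-improve R pm cl o)
    where
    cl = All.lookup sources-closed m
    o = All.lookup sources-outer m
    go : IsSource (proj₁ e) ⊎ (∃ λ t → φ (proj₁ e ⊖ t) t ≡ false) → (Int (proj₁ e) × IsSource (proj₁ e)) ⊎
      Improvement
    go (inj₁ s) = inj₁ (OuterContour.Below.u₀-int R pm cl o , s)
    go (inj₂ q) = inj₂ (improve⁺ m q)

  check⁻ : ∀ e → e ∈ M~.sources → (Int (proj₁ e) × IsPeak (proj₁ e)) ⊎ Improvement
  check⁻ e m = go (OuterContour.Below.source-or-improve (dualRegion R) pm~ cl o)
    where
    cl = All.lookup M~.sources-closed m
    o = All.lookup M~.sources-outer m
    go : (∀ t → ψ (proj₁ e ⊕ t) t ≡ true) ⊎ (∃ λ t → ψ (proj₁ e ⊕ t) t ≡ false) →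
      (Int (proj₁ e) × IsPeak (proj₁ e)) ⊎ Improvement
    go (inj₁ s) = inj₁ (OuterContour.Below.u₀-int (dualRegion R) pm~ cl o ,
      λ t → trans (cong (λ z → φ z t) (sym (⊕⊖ (proj₁ e) t))) (s t))
    go (inj₂ q) = inj₂ (improve⁻ m q)

  -- Without an improvement each recorded edge leaves a source or enters a peak. These hexagons are
  -- distinct since, by `spin`, the contour of a source contains all its leaving arcs, and that of a
  -- peak all its entering ones.
  dichotomy : Tight ⊎ Improvement
  dichotomy = assemble (scan sources check⁺) (scan M~.sources check⁻)
    where
    tails⁺ : ∀ {es} → All (λ e → Int (proj₁ e) × IsSource (proj₁ e)) es → AllPairs Distinct es →
      Unique (map proj₁ es)
    tails⁺ [] [] = []
    tails⁺ {(u , x) ∷ _} ((i , s) ∷ ss) (d ∷ ds) = AllP.map⁺ (All.map (λ { {v , y} n refl →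
      n (proj₁ (spin up x y) , trans (iter-source i s (proj₁ (spin up x y)) x)
        (cong (u ,_) (proj₂ (spin up x y)))) }) d) ∷ tails⁺ ss ds
    tails⁻ : ∀ {es} → All (λ e → Int (proj₁ e) × IsPeak (proj₁ e)) es → AllPairs Distinct (map Back.ρ es) →
      Unique (map proj₁ es)
    tails⁻ [] [] = []
    tails⁻ {(u , x) ∷ _} ((i , s) ∷ ss) (d ∷ ds) = AllP.map⁺ (All.map (λ { {v , y} n refl →
      n (proj₁ (spin dn x y) , trans (iter-peak i s (proj₁ (spin dn x y)) x)
        (cong (λ t → u ⊖ t , t) (proj₂ (spin dn x y)))) }) (AllP.map⁻ d)) ∷ tails⁻ ss ds
    mixed : All (λ e → Int (proj₁ e) × IsSource (proj₁ e)) sources →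
      All (λ e → Int (proj₁ e) × IsPeak (proj₁ e)) M~.sources →
      All (λ x → All (x ≢_) (map proj₁ M~.sources)) (map proj₁ sources)
    mixed ss ps = AllP.map⁺ (All.map (λ { (i , s) → AllP.map⁺ (All.map (λ { {v , y} (j , p) refl →
      absurdᵇ (s a) (peak-free j p a) }) ps) }) ss)
    lens : length contours ≡ length (map proj₁ sources ++ map proj₁ M~.sources)
    lens = trans (LP.length-++ sources) (trans (cong₂ ℕ._+_ (sym (LP.length-map proj₁ sources))
      (trans (LP.length-map Back.ρ M~.sources) (sym (LP.length-map proj₁ M~.sources))))
        (sym (LP.length-++ (map proj₁ sources))))
    assemble : All (λ e → Int (proj₁ e) × IsSource (proj₁ e)) sources ⊎ Improvement →
      All (λ e → Int (proj₁ e) × IsPeak (proj₁ e)) M~.sources ⊎ Improvement → Tight ⊎ Improvement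
    assemble (inj₂ i) _ = inj₂ i
    assemble (inj₁ _) (inj₂ i) = inj₂ i
    assemble (inj₁ ss) (inj₁ ps) = inj₁ (map proj₁ sources ++ map proj₁ M~.sources ,
      AllPairsP.++⁺ (tails⁺ ss (Family.distinct sources-family)) (tails⁻ ps (Family.distinct family⁻))
        (mixed ss ps) ,
      AllP.++⁺ (AllP.map⁺ (All.map (λ { (i , s) → i , source s }) ss))
        (AllP.map⁺ (All.map (λ { (i , s) → i , peak s }) ps)) , lens)

-- The triangular lattice of hexagons in axial coordinates

infixl 6 _⊞_ _⊟_

_⊞_ _⊟_ : Hx → Dir → Hx
(i , j) ⊞ a = ℤ.pred i , ℤ.pred j
(i , j) ⊞ b = ℤ.suc i , j
(i , j) ⊞ c = i , ℤ.suc j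
(i , j) ⊟ a = ℤ.suc i , ℤ.suc j
(i , j) ⊟ b = ℤ.pred i , j
(i , j) ⊟ c = i , ℤ.pred j

⊞⊟ : ∀ x t → x ⊞ t ⊟ t ≡ x
⊞⊟ (i , j) a = cong₂ _,_ (ℤP.suc-pred i) (ℤP.suc-pred j)
⊞⊟ (i , j) b = cong (_, j) (ℤP.pred-suc i)
⊞⊟ (i , j) c = cong (i ,_) (ℤP.pred-suc j)

⊟⊞ : ∀ x t → x ⊟ t ⊞ t ≡ x
⊟⊞ (i , j) a = cong₂ _,_ (ℤP.pred-suc i) (ℤP.pred-suc j)
⊟⊞ (i , j) b = cong (_, j) (ℤP.suc-pred i)
⊟⊞ (i , j) c = cong (i ,_) (ℤP.suc-pred j)

pred-suc≡suc-pred : ∀ i → ℤ.pred (ℤ.suc i) ≡ ℤ.suc (ℤ.pred i)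
pred-suc≡suc-pred i = trans (ℤP.pred-suc i) (sym (ℤP.suc-pred i))

⊞-comm : ∀ x s t → x ⊞ s ⊞ t ≡ x ⊞ t ⊞ s
⊞-comm x a a = refl
⊞-comm (i , j) a b = cong (_, ℤ.pred j) (sym (pred-suc≡suc-pred i))
⊞-comm (i , j) a c = cong (ℤ.pred i ,_) (sym (pred-suc≡suc-pred j))
⊞-comm (i , j) b a = cong (_, ℤ.pred j) (pred-suc≡suc-pred i)
⊞-comm x b b = refl
⊞-comm x b c = refl
⊞-comm (i , j) c a = cong (ℤ.pred i ,_) (pred-suc≡suc-pred j)
⊞-comm x c b = refl
⊞-comm x c c = refl

⊞bca : ∀ x → x ⊞ b ⊞ c ⊞ a ≡ x
⊞bca (i , j) = cong₂ _,_ (ℤP.pred-suc i) (ℤP.pred-suc j)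

⊞abc : ∀ x → x ⊞ a ⊞ b ⊞ c ≡ x
⊞abc (i , j) = cong₂ _,_ (ℤP.suc-pred i) (ℤP.suc-pred j)

⊞-tri : ∀ s x t → x ⊞ t ⊞ rot s t ⊞ rot (opp s) t ≡ x
⊞-tri up x a = ⊞abc x
⊞-tri up x b = ⊞bca x
⊞-tri up x c = trans (cong (_⊞ b) (⊞-comm x c a)) (trans (⊞-comm (x ⊞ a) c b) (⊞abc x))
⊞-tri dn x a = trans (⊞-comm (x ⊞ a) c b) (⊞abc x)
⊞-tri dn x b = trans (cong (_⊞ c) (⊞-comm x b a)) (⊞abc x)
⊞-tri dn x c = ⊞bca x

⊟-comm : ∀ x s t → x ⊟ s ⊟ t ≡ x ⊟ t ⊟ s
⊟-comm x s t = trans (sym (⊞⊟ (x ⊟ s ⊟ t) s)) (cong (_⊟ s) (trans (sym (⊞⊟ (x ⊟ s ⊟ t ⊞ s) t)) (cong (_⊟ t)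
  (trans (⊞-comm (x ⊟ s ⊟ t) s t) (trans (cong (_⊞ s) (⊟⊞ (x ⊟ s) t)) (⊟⊞ x s))))))

⊟-tri : ∀ s x t → x ⊟ t ⊟ rot s t ⊟ rot (opp s) t ≡ x
⊟-tri s x t = trans (sym (⊞-tri (opp s) y t)) (trans (cong (λ k → y ⊞ t ⊞ rot (opp s) t ⊞ rot k t) (opp² s)) step)
  where
  y = x ⊟ t ⊟ rot s t ⊟ rot (opp s) t
  step : y ⊞ t ⊞ rot (opp s) t ⊞ rot s t ≡ x
  step = trans (cong (_⊞ rot s t) (⊞-comm y t (rot (opp s) t)))
    (trans (cong (λ z → z ⊞ t ⊞ rot s t) (⊟⊞ (x ⊟ t ⊟ rot s t) (rot (opp s) t)))
      (trans (⊞-comm (x ⊟ t ⊟ rot s t) t (rot s t)) (trans (cong (_⊞ t) (⊟⊞ (x ⊟ t) (rot s t))) (⊟⊞ x t))))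

residueℤ : ℤ → Dir
residueℤ (+ n) = residue n
residueℤ -[1+ n ] = iter (suc n) (rot dn) a

residueℤ-suc : ∀ i → residueℤ (ℤ.suc i) ≡ rot up (residueℤ i)
residueℤ-suc (+ n) = refl
residueℤ-suc -[1+ zero ] = refl
residueℤ-suc -[1+ suc n ] = sym (rot-rot-opp up (iter (suc n) (rot dn) a))

residueℤ-pred : ∀ i → residueℤ (ℤ.pred i) ≡ rot dn (residueℤ i)
residueℤ-pred i = trans (sym (rot-opp-rot up _))
  (cong (rot dn) (trans (sym (residueℤ-suc (ℤ.pred i))) (cong residueℤ (ℤP.suc-pred i))))

-- Directions b and c change `i + j` by 1, and a changes it by -2, the same modulo 3.
hue : Hx → Dir
hue (i , j) = residueℤ (i ℤ.+ j)

hue-⊞ : ∀ x t → hue (x ⊞ t) ≡ rot up (hue x)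
hue-⊞ (i , j) b = trans (cong residueℤ (ℤP.+-assoc (+ 1) i j)) (residueℤ-suc (i ℤ.+ j))
hue-⊞ (i , j) c = trans (cong residueℤ
  (solve 2 (λ i j → i :+ (con (+ 1) :+ j) := con (+ 1) :+ (i :+ j)) refl i j)) (residueℤ-suc (i ℤ.+ j))
hue-⊞ (i , j) a = trans (cong residueℤ (solve 2 (λ i j → (con -1ℤ :+ i) :+ (con -1ℤ :+ j)
    := con -1ℤ :+ (con -1ℤ :+ (i :+ j))) refl i j))
  (trans (residueℤ-pred (ℤ.pred (i ℤ.+ j)))
    (trans (cong (rot dn) (residueℤ-pred (i ℤ.+ j))) (rot-rot dn (residueℤ (i ℤ.+ j)))))

hue-⊟ : ∀ x t → hue (x ⊟ t) ≡ rot dn (hue x)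
hue-⊟ x t = trans (sym (rot-opp-rot up _)) (cong (rot dn) (trans (sym (hue-⊞ (x ⊟ t) t)) (cong hue (⊟⊞ x t))))

rot-moves : ∀ s t → rot s t ≢ t
rot-moves up a ()
rot-moves up b ()
rot-moves up c ()
rot-moves dn a ()
rot-moves dn b ()
rot-moves dn c ()

suc≢ : ∀ i → ℤ.suc i ≢ i
suc≢ i eq = ℤP.i≢suc[i] (sym eq)

pred≢ : ∀ i → ℤ.pred i ≢ i
pred≢ i eq = suc≢ (ℤ.pred i) (trans (ℤP.suc-pred i) (sym eq))

pred≢suc : ∀ i → ℤ.pred i ≢ ℤ.suc i
pred≢suc i eq = ℤP.<-irrefl eq (ℤP.<-trans (subst (ℤ.pred i ℤ.<_) (ℤP.suc-pred i) (i<suc[i] (ℤ.pred i)))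
  (i<suc[i] i))

-- Discrete forms and their integration

-- The antidifference of `F` on the whole of ℤ that vanishes at 0.
∑ : (ℤ → ℤ) → ℤ → ℤ
∑ F (+ zero) = + 0
∑ F (+ suc n) = ∑ F (+ n) ℤ.+ F (+ n)
∑ F -[1+ zero ] = ℤ.- F -[1+ 0 ]
∑ F -[1+ suc n ] = ∑ F -[1+ n ] ℤ.- F -[1+ suc n ]

∑-suc : ∀ F i → ∑ F (ℤ.suc i) ≡ ∑ F i ℤ.+ F i
∑-suc F (+ n) = refl
∑-suc F -[1+ zero ] = sym (ℤP.+-inverseˡ (F -[1+ 0 ]))
∑-suc F -[1+ suc n ] = solve 2 (λ p f → p := p :- f :+ f) refl (∑ F -[1+ n ]) (F -[1+ suc n ])

constant : (D : ℤ → ℤ) → (∀ i → D (ℤ.suc i) ≡ D i) → ∀ i → D i ≡ D (+ 0)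
constant D s (+ zero) = refl
constant D s (+ suc n) = trans (s (+ n)) (constant D s (+ n))
constant D s -[1+ zero ] = sym (s -[1+ 0 ])
constant D s -[1+ suc n ] = trans (sym (s -[1+ suc n ])) (constant D s -[1+ n ])

Form : Set
Form = Hx → Dir → ℤ

-- The triangles `x`, `x ⊞ b`, `x ⊞ b ⊞ c` (up) and `x`, `x ⊞ c`, `x ⊞ c ⊞ b` (dn) are both named by
-- the hexagon `x`.
Vertex : Set
Vertex = Hx × Sense

edgeAt : Vertex → Dir → Ed
edgeAt (x , up) b = x , b
edgeAt (x , up) c = x ⊞ b , c
edgeAt (x , up) a = x ⊞ b ⊞ c , a
edgeAt (x , dn) c = x , c
edgeAt (x , dn) b = x ⊞ c , b
edgeAt (x , dn) a = x ⊞ c ⊞ b , a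

endAt : Ed → Sense → Vertex
endAt (x , a) s = x ⊞ a , s
endAt (x , b) up = x , up
endAt (x , b) dn = x ⊟ c , dn
endAt (x , c) up = x ⊟ b , up
endAt (x , c) dn = x , dn

tail-at : Vertex → Dir → Hx
tail-at v t = proj₁ (edgeAt v t)

edgeAt-type : ∀ v t → edgeAt v t ≡ (tail-at v t , t)
edgeAt-type (x , up) a = refl
edgeAt-type (x , up) b = refl
edgeAt-type (x , up) c = refl
edgeAt-type (x , dn) a = refl
edgeAt-type (x , dn) b = refl
edgeAt-type (x , dn) c = refl

endAt-edgeAt : ∀ v t → endAt (edgeAt v t) (proj₂ v) ≡ v
endAt-edgeAt (x , up) a = cong (_, up) (⊞bca x)
endAt-edgeAt (x , up) b = refl
endAt-edgeAt (x , up) c = cong (_, up) (⊞⊟ x b)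
endAt-edgeAt (x , dn) a = cong (_, dn) (⊞bca x)
endAt-edgeAt (x , dn) b = cong (_, dn) (⊞⊟ x c)
endAt-edgeAt (x , dn) c = refl

edgeAt-endAt : ∀ x t s → edgeAt (endAt (x , t) s) t ≡ (x , t)
edgeAt-endAt x a up = cong (_, a) (⊞abc x)
edgeAt-endAt x a dn = cong (_, a) (⊞abc x)
edgeAt-endAt x b up = refl
edgeAt-endAt x b dn = cong (_, b) (⊟⊞ x c)
edgeAt-endAt x c up = cong (_, c) (⊟⊞ x b)
edgeAt-endAt x c dn = refl

endAt-sense : ∀ e s → proj₂ (endAt e s) ≡ s
endAt-sense (x , a) s = refl
endAt-sense (x , b) up = refl
endAt-sense (x , b) dn = refl
endAt-sense (x , c) up = refl
endAt-sense (x , c) dn = refl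

endAt-head : ∀ x t s → endAt (x , t) s ≡ endAt (x ⊞ t , rot s t) s
endAt-head x a up = refl
endAt-head x a dn = refl
endAt-head x b up = cong (_, up) (sym (⊞⊟ x b))
endAt-head (i , j) b dn = cong (λ k → (k , ℤ.pred j) , dn) (sym (ℤP.pred-suc i))
endAt-head (i , j) c up = cong (λ k → (ℤ.pred i , k) , up) (sym (ℤP.pred-suc j))
endAt-head x c dn = cong (_, dn) (sym (⊞⊟ x c))

triangle-heads : (P : Hx → Set) → ∀ v → (∀ t → P (tail-at v t)) → ∀ t → P (tail-at v t ⊞ t)
triangle-heads P (x , up) o a = subst P (sym (⊞bca x)) (o b)
triangle-heads P (x , up) o b = o c
triangle-heads P (x , up) o c = o a
triangle-heads P (x , dn) o a = subst P (sym (⊞bca x)) (o c)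
triangle-heads P (x , dn) o b = o a
triangle-heads P (x , dn) o c = o b

apply : Form → Ed → ℤ
apply ω (x , t) = ω x t

curl : Form → Vertex → ℤ
curl ω v = apply ω (edgeAt v a) ℤ.+ apply ω (edgeAt v b) ℤ.+ apply ω (edgeAt v c)

-- Discrete Poincaré lemma: integrate along the axis in direction b, then in direction c. Steps in
-- direction b are right on the axis, and by zero curl their defect `D` is the same on all rows;
-- steps in direction a complete a triangle.
integrate : ∀ ω → (∀ v → curl ω v ≡ + 0) → ∃ λ (f : Hx → ℤ) → ∀ x t → f (x ⊞ t) ≡ f x ℤ.+ ω x t
integrate ω closed = f , step
  where
  f : Hx → ℤ
  f (i , j) = ∑ (λ k → ω (k , + 0) b) i ℤ.+ ∑ (λ k → ω (i , k) c) j

  step-c : ∀ x → f (x ⊞ c) ≡ f x ℤ.+ ω x c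
  step-c (i , j) = trans (cong (λ z → ∑ (λ k → ω (k , + 0) b) i ℤ.+ z) (∑-suc (λ k → ω (i , k) c) j))
    (sym (ℤP.+-assoc (∑ (λ k → ω (k , + 0) b) i) _ _))

  swap : ∀ x → ω x b ℤ.+ ω (x ⊞ b) c ≡ ω x c ℤ.+ ω (x ⊞ c) b
  swap x = GP.∙-cancelˡ (AbelianGroup.group ℤP.+-0-abelianGroup) (ω (x ⊞ b ⊞ c) a) _ _
    (trans (sym (ℤP.+-assoc (ω (x ⊞ b ⊞ c) a) _ _)) (trans (closed (x , up)) (trans (sym (closed (x , dn)))
      (solve 3 (λ p q r → p :+ q :+ r := p :+ (r :+ q)) refl (ω (x ⊞ c ⊞ b) a) (ω (x ⊞ c) b) (ω x c)))))

  step-b : ∀ x → f (x ⊞ b) ≡ f x ℤ.+ ω x b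
  step-b (i , j) = begin
    f (ℤ.suc i , j) ≡⟨ solve 3 (λ p q r → p := q :+ r :+ (p :- q :- r)) refl (f (ℤ.suc i , j)) (f (i , j))
      (ω (i , j) b) ⟩
    f (i , j) ℤ.+ ω (i , j) b ℤ.+ D j ≡⟨ cong (λ z → f (i , j) ℤ.+ ω (i , j) b ℤ.+ z)
      (trans (constant D D-suc j) D-zero) ⟩
    f (i , j) ℤ.+ ω (i , j) b ℤ.+ + 0 ≡⟨ ℤP.+-identityʳ _ ⟩
    f (i , j) ℤ.+ ω (i , j) b ∎
    where
    open ≡-Reasoning
    D : ℤ → ℤ
    D k = f (ℤ.suc i , k) ℤ.- f (i , k) ℤ.- ω (i , k) b
    D-zero : D (+ 0) ≡ + 0
    D-zero = trans (cong (λ z → z ℤ.+ + 0 ℤ.- f (i , + 0) ℤ.- ω (i , + 0) b) (∑-suc (λ k → ω (k , + 0) b) i))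
      (solve 2 (λ p w → p :+ w :+ con (+ 0) :- (p :+ con (+ 0)) :- w := con (+ 0)) refl
        (∑ (λ k → ω (k , + 0) b) i) (ω (i , + 0) b))
    D-suc : ∀ k → D (ℤ.suc k) ≡ D k
    D-suc k = begin
      f (ℤ.suc i , ℤ.suc k) ℤ.- f (i , ℤ.suc k) ℤ.- ω (i , ℤ.suc k) b
        ≡⟨ cong₂ (λ p q → p ℤ.- q ℤ.- ω (i , ℤ.suc k) b) (step-c (ℤ.suc i , k)) (step-c (i , k)) ⟩
      f (ℤ.suc i , k) ℤ.+ ω (ℤ.suc i , k) c ℤ.- (f (i , k) ℤ.+ ω (i , k) c) ℤ.- ω (i , ℤ.suc k) b
        ≡⟨ solve 5 (λ p q r s t → p :+ q :- (r :+ s) :- t := p :- r :- (s :+ t :- q)) refl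
             (f (ℤ.suc i , k)) (ω (ℤ.suc i , k) c) (f (i , k)) (ω (i , k) c) (ω (i , ℤ.suc k) b) ⟩
      f (ℤ.suc i , k) ℤ.- f (i , k) ℤ.- (ω (i , k) c ℤ.+ ω (i , ℤ.suc k) b ℤ.- ω (ℤ.suc i , k) c)
        ≡⟨ cong (λ z → f (ℤ.suc i , k) ℤ.- f (i , k) ℤ.- (z ℤ.- ω (ℤ.suc i , k) c)) (sym (swap (i , k))) ⟩
      f (ℤ.suc i , k) ℤ.- f (i , k) ℤ.- (ω (i , k) b ℤ.+ ω (ℤ.suc i , k) c ℤ.- ω (ℤ.suc i , k) c)
        ≡⟨ solve 4 (λ p r w q → p :- r :- (w :+ q :- q) := p :- r :- w) refl (f (ℤ.suc i , k)) (f (i , k))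
          (ω (i , k) b) (ω (ℤ.suc i , k) c) ⟩
      D k ∎

  step-a : ∀ x → f (x ⊞ a) ≡ f x ℤ.+ ω x a
  step-a x = subst (λ y → f (x ⊞ a) ≡ f y ℤ.+ ω y a) (⊞abc x) (begin
    f y ≡⟨ solve 2 (λ p k → p := p :+ con (+ 0)) refl (f y) (f y) ⟩
    f y ℤ.+ + 0 ≡⟨ cong (λ z → f y ℤ.+ z) (sym (closed (y , up))) ⟩
    f y ℤ.+ (ω (y ⊞ b ⊞ c) a ℤ.+ ω y b ℤ.+ ω (y ⊞ b) c)
      ≡⟨ solve 4 (λ p q r s → p :+ (q :+ r :+ s) := p :+ r :+ s :+ q) refl (f y) (ω (y ⊞ b ⊞ c) a) (ω y b)
        (ω (y ⊞ b) c) ⟩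
    f y ℤ.+ ω y b ℤ.+ ω (y ⊞ b) c ℤ.+ ω (y ⊞ b ⊞ c) a
      ≡⟨ cong (λ z → z ℤ.+ ω (y ⊞ b) c ℤ.+ ω (y ⊞ b ⊞ c) a) (sym (step-b y)) ⟩
    f (y ⊞ b) ℤ.+ ω (y ⊞ b) c ℤ.+ ω (y ⊞ b ⊞ c) a ≡⟨ cong (ℤ._+ ω (y ⊞ b ⊞ c) a) (sym (step-c (y ⊞ b))) ⟩
    f (y ⊞ b ⊞ c) ℤ.+ ω (y ⊞ b ⊞ c) a ∎)
    where
    open ≡-Reasoning
    y = x ⊞ a

  step : ∀ x t → f (x ⊞ t) ≡ f x ℤ.+ ω x t
  step x a = step-a x
  step x b = step-b x
  step x c = step-c x

-- Heights and potentials on a domain with connected exterior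

-- Connectedness is phrased by predicates and needs no paths. It will spread the value of a
-- potential and the existence of sinks.
record Domain : Set₁ where
  field
    I : Hx → Bool
    cells : List Hx
    cells-complete : ∀ x → I x ≡ true → x ∈ cells
    cells-sound : ∀ x → x ∈ cells → I x ≡ true
    cells-unique : Unique cells
    exterior-connected : (P : Hx → Set) →
      (∀ x t → I x ≡ false → I (x ⊞ t) ≡ false → (P x → P (x ⊞ t)) × (P (x ⊞ t) → P x)) →
      ∀ x y → I x ≡ false → I y ≡ false → P x → P y

module OnDomain (Δ : Domain) where
  open Domain Δ

  size : List Hx → ℕ
  size [] = 0
  size ((i , j) ∷ xs) = ℤ.∣ i ∣ ℕ.+ size xs

  ∈-size : ∀ {i j xs} → (i , j) ∈ xs → ℤ.∣ i ∣ ≤ size xs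
  ∈-size (here refl) = ℕP.m≤m+n _ _
  ∈-size {xs = (k , _) ∷ xs} (there m) = ℕP.≤-trans (∈-size m) (ℕP.m≤n+m (size xs) ℤ.∣ k ∣)

  N : ℕ
  N = suc (size cells)

  far : ∀ i j → N ≤ ℤ.∣ i ∣ → I (i , j) ≡ false
  far i j le with split (I (i , j))
  ... | inj₂ o = o
  ... | inj₁ o = ⊥-elim (ℕP.<⇒≱ le (∈-size (cells-complete (i , j) o)))

  iter-b : ∀ n i j → iter n (_⊞ b) (i , j) ≡ (+ n ℤ.+ i , j)
  iter-b zero i j = cong (_, j) (sym (ℤP.+-identityˡ i))
  iter-b (suc n) i j = trans (cong (_⊞ b) (iter-b n i j)) (cong (_, j) (sym (ℤP.+-assoc (+ 1) (+ n) i)))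

  iter-b⁻ : ∀ n i j → iter n (_⊟ b) (i , j) ≡ (i ℤ.- + n , j)
  iter-b⁻ zero i j = cong (_, j) (sym (ℤP.+-identityʳ i))
  iter-b⁻ (suc n) i j = trans (cong (_⊟ b) (iter-b⁻ n i j)) (cong (_, j)
    (solve 2 (λ i n → con -1ℤ :+ (i :- n) := i :- (con (+ 1) :+ n)) refl i (+ n)))

  ⊞-escape : ∀ x → ∃ λ n → I (iter n (_⊞ b) x) ≡ false
  ⊞-escape (i , j) = n , trans (cong I (iter-b n i j)) (far _ j le)
    where
    n = N ℕ.+ ℤ.∣ i ∣
    le : N ≤ ℤ.∣ + n ℤ.+ i ∣
    le = ℕP.+-cancelʳ-≤ ℤ.∣ i ∣ N _ (ℕP.≤-trans
      (ℕP.≤-reflexive (cong ℤ.∣_∣ (solve 2 (λ n i → n := n :+ i :- i) refl (+ n) i)))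
      (ℤP.∣i-j∣≤∣i∣+∣j∣ (+ n ℤ.+ i) i))

  ⊟-escape : ∀ x → ∃ λ n → I (iter n (_⊟ b) x) ≡ false
  ⊟-escape (i , j) = n , trans (cong I (iter-b⁻ n i j)) (far _ j le)
    where
    n = N ℕ.+ ℤ.∣ i ∣
    le : N ≤ ℤ.∣ i ℤ.- + n ∣
    le = ℕP.+-cancelʳ-≤ ℤ.∣ i ∣ N _ (ℕP.≤-trans (ℕP.≤-reflexive (trans (sym (ℤP.∣-i∣≡∣i∣ (+ n)))
        (cong ℤ.∣_∣ (solve 2 (λ n i → :- n := i :- n :- i) refl (+ n) i))))
      (ℤP.∣i-j∣≤∣i∣+∣j∣ (i ℤ.- + n) i))

  lattice : Lattice
  lattice = record
    { _⊕_ = _⊞_ ; _⊖_ = _⊟_ ; ⊕⊖ = ⊞⊟ ; ⊖⊕ = ⊟⊞ ; ⊕-comm = ⊞-comm ; ⊖-comm = ⊟-comm ; ⊕-tri = ⊞-tri ; ⊖-tri = ⊟-tri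
    ; colour = hue
    ; ⊕-colour = λ x t eq → rot-moves up (hue x) (trans (sym (hue-⊞ x t)) eq)
    ; ⊖-colour = λ x t eq → rot-moves dn (hue x) (trans (sym (hue-⊟ x t)) eq)
    ; ⊕-colour³ = λ x r s t → trans (hue-⊞ (x ⊞ r ⊞ s) t)
      (trans (cong (rot up) (trans (hue-⊞ (x ⊞ r) s) (cong (rot up) (hue-⊞ x r)))) (cube up (hue x)))
    ; ⊖-colour³ = λ x r s t → trans (hue-⊟ (x ⊟ r ⊟ s) t)
      (trans (cong (rot dn) (trans (hue-⊟ (x ⊟ r) s) (cong (rot dn) (hue-⊟ x r)))) (cube dn (hue x)))
    ; row = proj₂
    ; ⊕-row = λ x → refl ; ⊖-row = λ x → refl
    ; ⊕-rows = λ { (i , j) → pred≢ j ∘ sym , suc≢ j ∘ sym , pred≢suc j }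
    ; ⊖-rows = λ { (i , j) → suc≢ j ∘ sym , pred≢ j ∘ sym , pred≢suc j ∘ sym }
    ; I = I ; cells = cells ; cells-complete = cells-complete ; cells-sound = cells-sound ; cells-unique =
      cells-unique
    ; ⊕-escape = ⊞-escape ; ⊖-escape = ⊟-escape }
    where
    cube : ∀ s t → rot s (rot s (rot s t)) ≡ t
    cube s t = trans (cong (rot s) (rot-rot s t)) (rot-rot-opp s t)

  open Contours lattice using (PM; OneAt; Int; Ext; int?)

  _≟ⱽ_ : (v w : Vertex) → Dec (v ≡ w)
  (x , s) ≟ⱽ (y , s′) = map′ (λ { (refl , refl) → refl }) (λ { refl → refl , refl }) ((x ≟ᴴ y) ×-dec (s ≟ˢ s′))

  δ : Ed → Form
  δ e x t = val (does ((x , t) ≟ᴱ e))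

  δ-hit : ∀ e e′ → e′ ≡ e → apply (δ e) e′ ≡ + 1
  δ-hit e e′ eq = cong val (dec-true (e′ ≟ᴱ e) eq)

  δ-miss : ∀ e e′ → e′ ≢ e → apply (δ e) e′ ≡ + 0
  δ-miss e e′ ne = cong val (dec-false (e′ ≟ᴱ e) ne)

  curl-δ-off : ∀ e v → (∀ s → v ≢ endAt e s) → curl (δ e) v ≡ + 0
  curl-δ-off e v off = cong₂ ℤ._+_ (cong₂ ℤ._+_ (miss a) (miss b)) (miss c)
    where
    miss : ∀ t → apply (δ e) (edgeAt v t) ≡ + 0
    miss t = δ-miss e (edgeAt v t) λ eq →
      off (proj₂ v) (trans (sym (endAt-edgeAt v t)) (cong (λ e → endAt e (proj₂ v)) eq))

  curl-δ-end : ∀ e s → curl (δ e) (endAt e s) ≡ + 1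
  curl-δ-end e@(x , t) s = total t refl
    where
    v = endAt e s
    value : ∀ r → (r ≡ t → apply (δ e) (edgeAt v r) ≡ + 1) × (r ≢ t → apply (δ e) (edgeAt v r) ≡ + 0)
    value r = (λ { refl → δ-hit e (edgeAt v r) (edgeAt-endAt x t s) }) ,
      λ ne → δ-miss e (edgeAt v r) λ eq → ne (trans (sym (cong proj₂ (edgeAt-type v r))) (cong proj₂ eq))
    total : ∀ r → r ≡ t → curl (δ e) v ≡ + 1
    total a q = cong₂ ℤ._+_ (cong₂ ℤ._+_ (proj₁ (value a) q) (proj₂ (value b) (λ { refl → case q of λ () })))
      (proj₂ (value c) (λ { refl → case q of λ () }))
    total b q = cong₂ ℤ._+_ (cong₂ ℤ._+_ (proj₂ (value a) (λ { refl → case q of λ () })) (proj₁ (value b) q))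
      (proj₂ (value c) (λ { refl → case q of λ () }))
    total c q = cong₂ ℤ._+_ (cong₂ ℤ._+_ (proj₂ (value a) (λ { refl → case q of λ () }))
      (proj₂ (value b) (λ { refl → case q of λ () }))) (proj₁ (value c) q)

  subtract : Form → ℤ → Form → Form
  subtract ω k η x t = ω x t ℤ.- k ℤ.* η x t

  curl-subtract : ∀ ω k η v → curl (subtract ω k η) v ≡ curl ω v ℤ.- k ℤ.* curl η v
  curl-subtract ω k η v = solve 7 (λ p q r k x y z → p :- k :* x :+ (q :- k :* y) :+ (r :- k :* z)
      := p :+ q :+ r :- k :* (x :+ y :+ z)) refl
    (apply ω (edgeAt v a)) (apply ω (edgeAt v b)) (apply ω (edgeAt v c)) k (apply η (edgeAt v a))
      (apply η (edgeAt v b)) (apply η (edgeAt v c))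

  VanishesInside : Form → Set
  VanishesInside η = ∀ x t → Int x → Int (x ⊞ t) → η x t ≡ + 0

  -- A sink at v carries a unit of curl from v to infinity without crossing an inner edge.
  record Sink (v : Vertex) : Set where
    field
      η : Form
      inner : VanishesInside η
      unit : curl η v ≡ + 1
      elsewhere : ∀ w → w ≢ v → curl η w ≡ + 0

  Border : Ed → Set
  Border (x , t) = Ext x ⊎ Ext (x ⊞ t)

  -- `δ e` has curl 1 at both ends of `e`, and subtracting the old sink cancels it at the old end.
  -- An edge on the border is not inner, so `δ e` is harmless.
  move : ∀ e s → Border e → Sink (endAt e s) → Sink (endAt e (opp s))
  move e s bd K = record
    { η = η′
    ; inner = λ x t i j → cong₂ (λ p q → p ℤ.- + 1 ℤ.* q)
      (δ-miss e (x , t) (λ { refl → [ absurdᵇ i , absurdᵇ j ]′ bd })) (inner x t i j)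
    ; unit = trans (curl-subtract (δ e) (+ 1) η (endAt e (opp s)))
        (cong₂ (λ p q → p ℤ.- + 1 ℤ.* q) (curl-δ-end e (opp s)) (elsewhere _ other))
    ; elsewhere = λ w n → trans (curl-subtract (δ e) (+ 1) η w) (away w n (w ≟ⱽ endAt e s)) }
    where
    open Sink K
    η′ = subtract (δ e) (+ 1) η
    opp≢ : ∀ s → opp s ≢ s
    opp≢ up ()
    opp≢ dn ()
    other : endAt e (opp s) ≢ endAt e s
    other eq = opp≢ s (trans (sym (endAt-sense e (opp s))) (trans (cong proj₂ eq) (endAt-sense e s)))
    senses : ∀ s s′ → s′ ≡ s ⊎ s′ ≡ opp s
    senses up up = inj₁ refl
    senses up dn = inj₂ refl
    senses dn up = inj₂ refl
    senses dn dn = inj₁ refl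
    away : ∀ w → w ≢ endAt e (opp s) → Dec (w ≡ endAt e s) → curl (δ e) w ℤ.- + 1 ℤ.* curl η w ≡ + 0
    away w n (yes refl) = cong₂ (λ p q → p ℤ.- + 1 ℤ.* q) (curl-δ-end e s) unit
    away w n (no m) = cong₂ (λ p q → p ℤ.- + 1 ℤ.* q)
      (curl-δ-off e w λ s′ eq → [ (λ { refl → m eq }) , (λ { refl → n eq }) ]′ (senses s s′)) (elsewhere w m)

  Drained : Hx → Set
  Drained x = ∀ t s → Sink (endAt (x , t) s)

  -- All edges around an exterior hexagon are on the border, so a sink can move to all six corners;
  -- two moves lead to the next corner of the same sense.
  drain : ∀ x t s → Ext x → Sink (endAt (x , t) s) → Drained x
  drain x t s o K t′ s′ = turn s s′ (let n , eq = spin s t t′ in subst (λ r → Sink (endAt (x , r) s)) eq (around n t K))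
    where
    turn : ∀ s s′ → Sink (endAt (x , t′) s) → Sink (endAt (x , t′) s′)
    turn up up K = K
    turn up dn K = move (x , t′) up (inj₁ o) K
    turn dn up K = move (x , t′) dn (inj₁ o) K
    turn dn dn K = K
    corner : ∀ t s → endAt (x ⊟ t , t) s ≡ endAt (x , rot s t) s
    corner t s = trans (endAt-head (x ⊟ t) t s) (cong (λ y → endAt (y , rot s t) s) (⊟⊞ x t))
    next : ∀ t → Sink (endAt (x , t) s) → Sink (endAt (x , rot s t) s)
    next t K = subst (λ k → Sink (endAt (x , rot s t) k)) (opp² s)
      (move (x , rot s t) (opp s) (inj₁ o)
        (subst Sink (trans (corner r (opp s)) (cong (λ k → endAt (x , k) (opp s)) e₂))
        (move (x ⊟ r , r) s (inj₂ (trans (cong I (⊟⊞ x r)) o))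
          (subst Sink (sym (trans (corner r s) (cong (λ k → endAt (x , k) s) (rot-rot-opp s t)))) K))))
      where
      r = rot (opp s) t
      e₂ : rot (opp s) r ≡ rot s t
      e₂ = trans (rot-rot (opp s) t) (cong (λ k → rot k t) (opp² s))
    around : ∀ n t → Sink (endAt (x , t) s) → Sink (endAt (x , iter n (rot s) t) s)
    around zero t K = K
    around (suc n) t K = next _ (around n t K)

  ray? : ∀ x → Dec (proj₂ x ≡ + 0 × + N ℤ.≤ proj₁ x)
  ray? x = (proj₂ x ℤ.≟ + 0) ×-dec (+ N ℤ.≤? proj₁ x)

  ray : Hx → ℤ
  ray x = val (does (ray? x))

  ray-int : ∀ x → Int x → ray x ≡ + 0
  ray-int x@(i , j) o = cong val (dec-false (ray? x)
    λ { (_ , le) → absurdᵇ o (far i j (ℤP.drop‿+≤+ (ℤP.≤-trans le (i≤∣i∣ i)))) })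
    where
    i≤∣i∣ : ∀ i → i ℤ.≤ + ℤ.∣ i ∣
    i≤∣i∣ (+ n) = ℤP.≤-refl
    i≤∣i∣ -[1+ n ] = ℤ.-≤+

  -- The values 1 and -1 alternate on a half-infinite zigzag of edges along the hexagons `(i , 0)`
  -- with `i ≥ N`. They cancel at every vertex but the first.
  base-sink : Sink (endAt ((+ N , + 0) , c) up)
  base-sink = record { η = η ; inner = inner ; unit = unit ; elsewhere = elsewhere }
    where
    η : Form
    η x a = ℤ.- ray (x ⊞ a)
    η x b = + 0
    η x c = ray x
    inner : VanishesInside η
    inner x a i j = cong ℤ.-_ (ray-int (x ⊞ a) j)
    inner x b i j = refl
    inner x c i j = ray-int x i
    curl-up : ∀ x → curl η (x , up) ≡ ℤ.- ray x ℤ.+ ray (x ⊞ b)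
    curl-up x = trans (cong (λ y → ℤ.- ray y ℤ.+ + 0 ℤ.+ ray (x ⊞ b)) (⊞bca x))
      (cong (ℤ._+ ray (x ⊞ b)) (ℤP.+-identityʳ (ℤ.- ray x)))
    unit : curl η ((ℤ.pred (+ N) , + 0) , up) ≡ + 1
    unit = trans (curl-up (ℤ.pred (+ N) , + 0)) (cong₂ (λ p q → ℤ.- p ℤ.+ q)
      (cong val (dec-false (ray? (ℤ.pred (+ N) , + 0))
        λ { (_ , le) → ℤP.<⇒≱ (subst (ℤ.pred (+ N) ℤ.<_) (ℤP.suc-pred (+ N)) (i<suc[i] (ℤ.pred (+ N)))) le }))
      (cong val (dec-true (ray? (ℤ.suc (ℤ.pred (+ N)) , + 0)) (refl , ℤP.≤-reflexive (sym (ℤP.suc-pred (+ N)))))))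
    elsewhere : ∀ w → w ≢ ((ℤ.pred (+ N) , + 0) , up) → curl η w ≡ + 0
    elsewhere (x , dn) n = trans (cong (λ y → ℤ.- ray y ℤ.+ + 0 ℤ.+ ray x) (⊞bca x))
      (trans (cong (ℤ._+ ray x) (ℤP.+-identityʳ (ℤ.- ray x))) (ℤP.+-inverseˡ (ray x)))
    elsewhere (x@(i , j) , up) n = trans (curl-up x) (go (ray? x) (ray? (x ⊞ b)))
      where
      go : Dec (proj₂ x ≡ + 0 × + N ℤ.≤ proj₁ x) → Dec (j ≡ + 0 × + N ℤ.≤ ℤ.suc i) → ℤ.- ray x ℤ.+ ray (x ⊞ b) ≡ + 0
      go (yes p) (yes q) = cong₂ (λ p q → ℤ.- val p ℤ.+ val q) (dec-true (ray? x) p) (dec-true (ray? (x ⊞ b)) q)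
      go (no p) (no q) = cong₂ (λ p q → ℤ.- val p ℤ.+ val q) (dec-false (ray? x) p) (dec-false (ray? (x ⊞ b)) q)
      go (yes (p , le)) (no q) = ⊥-elim (q (p , ℤP.≤-trans le (ℤP.i≤suc[i] i)))
      go (no p) (yes (z , le)) = ⊥-elim (n (cong₂ (λ i j → (i , j) , up)
        (trans (sym (ℤP.pred-suc i)) (cong ℤ.pred (ℤP.≤-antisym (ℤP.i<j⇒suc[i]≤j (ℤP.≰⇒> λ q → p (z , q))) le))) z))

  drained : ∀ x → Ext x → Drained x
  drained x o = exterior-connected Drained spread (+ N , + 0) x base-ext o
    (drain (+ N , + 0) c up base-ext base-sink)
    where
    base-ext : Ext (+ N , + 0)
    base-ext = far (+ N) (+ 0) ℕP.≤-refl
    spread : ∀ x t → Ext x → Ext (x ⊞ t) → (Drained x → Drained (x ⊞ t)) × (Drained (x ⊞ t) → Drained x)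
    spread x t o p = (λ d → drain (x ⊞ t) (rot up t) up p (subst Sink (endAt-head x t up) (d t up))) ,
      λ d → drain x t up o (subst Sink (sym (endAt-head x t up)) (d (rot up t) up))

  -- Only vertices with an exterior corner can have curl, and this curl is drained to infinity. The repaired
  -- form is wrong on exterior edges, where a single-valued height need not exist.
  close-up : ∀ (L : List Vertex) ω → (∀ v → v ∉ L → curl ω v ≡ + 0) →
    (∀ v → (∀ t → Int (tail-at v t)) → curl ω v ≡ + 0) →
    ∃ λ ω′ → (∀ x t → Int x → Int (x ⊞ t) → ω′ x t ≡ ω x t) × (∀ v → curl ω′ v ≡ + 0)
  close-up [] ω off inn = ω , (λ _ _ _ _ → refl) , λ v → off v λ ()
  close-up (v ∷ L) ω off inn with anyDir? (λ t → I (tail-at v t) BP.≟ false)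
  ... | no n = close-up L ω (λ w w∉ → go w w∉ (w ≟ⱽ v)) inn
    where
    go : ∀ w → w ∉ L → Dec (w ≡ v) → curl ω w ≡ + 0
    go w w∉ (yes refl) = inn v λ t → BP.¬-not λ q → n (t , q)
    go w w∉ (no ne) = off w λ { (here eq) → ne eq ; (there m) → w∉ m }
  ... | yes (t , o) = let ω″ , agree , closed = close-up L ω′ off′ inn′ in
        ω″ , (λ x r i j → trans (agree x r i j) (trans (cong (λ z → ω x r ℤ.- curl ω v ℤ.* z) (inner x r i j))
          (trans (cong (λ z → ω x r ℤ.- z) (ℤP.*-zeroʳ (curl ω v))) (ℤP.+-identityʳ _)))) , closed
    where
    open Sink (subst Sink (trans (cong (λ e → endAt e (proj₂ v)) (sym (edgeAt-type v t))) (endAt-edgeAt v t))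
      (drained (tail-at v t) o t (proj₂ v)))
    ω′ = subtract ω (curl ω v) η
    at-v : curl ω′ v ≡ + 0
    at-v = trans (curl-subtract ω (curl ω v) η v) (trans (cong (λ z → curl ω v ℤ.- curl ω v ℤ.* z) unit)
      (trans (cong (λ z → curl ω v ℤ.- z) (ℤP.*-identityʳ _)) (ℤP.+-inverseʳ (curl ω v))))
    away : ∀ w → w ≢ v → curl ω′ w ≡ curl ω w
    away w n = trans (curl-subtract ω (curl ω v) η w)
      (trans (cong (λ z → curl ω w ℤ.- curl ω v ℤ.* z) (elsewhere w n))
      (trans (cong (λ z → curl ω w ℤ.- z) (ℤP.*-zeroʳ (curl ω v))) (ℤP.+-identityʳ _)))
    off′ : ∀ w → w ∉ L → curl ω′ w ≡ + 0
    off′ w w∉ = go (w ≟ⱽ v)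
      where
      go : Dec (w ≡ v) → curl ω′ w ≡ + 0
      go (yes refl) = at-v
      go (no ne) = trans (away w ne) (off w λ { (here eq) → ne eq ; (there m) → w∉ m })
    inn′ : ∀ w → (∀ t → Int (tail-at w t)) → curl ω′ w ≡ + 0
    inn′ w i = go (w ≟ⱽ v)
      where
      go : Dec (w ≡ v) → curl ω′ w ≡ + 0
      go (yes refl) = at-v
      go (no ne) = trans (away w ne) (inn w i)

  lin : Matching → Form
  lin φ x t = val (φ x t)

  curl-One : ∀ {φ} → PM φ → ∀ v t → Int (tail-at v t) → curl (lin φ) v ≡ + 1
  curl-One {φ} pm v t i = three v t (PM.one pm (proj₂ v) (tail-at v t) t i)
    where
    total : ∀ {p q r} → One p q r → val p ℤ.+ val q ℤ.+ val r ≡ + 1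
    total (one₁ refl refl refl) = refl
    total (one₂ refl refl refl) = refl
    total (one₃ refl refl refl) = refl
    three : ∀ v t → OneAt φ (proj₂ v) (tail-at v t) t → curl (lin φ) v ≡ + 1
    three (x , up) b o = total (One-rot (One-rot o))
    three (x , up) c o = total (One-rot (subst (λ y → One (φ (x ⊞ b) c) (φ (x ⊞ b ⊞ c) a) (φ y b)) (⊞bca x) o))
    three (x , up) a o = total (subst₂ (λ y z → One (φ (x ⊞ b ⊞ c) a) (φ y b) (φ z c)) (⊞bca x)
      (cong (_⊞ b) (⊞bca x)) o)
    three (x , dn) c o = total (One-swap (One-rot (One-rot o)))
    three (x , dn) b o = total (One-swap
      (One-rot (subst (λ y → One (φ (x ⊞ c) b) (φ (x ⊞ c ⊞ b) a) (φ y c)) (⊞bca x) o)))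
    three (x , dn) a o = total (One-swap
      (subst₂ (λ y z → One (φ (x ⊞ c ⊞ b) a) (φ y c) (φ z b)) (⊞bca x) (cong (_⊞ c) (⊞bca x)) o))

  outside-false : ∀ {φ} → PM φ → ∀ x t → Ext x → Ext (x ⊞ t) → φ x t ≡ false
  outside-false pm x t o p = BP.¬-not λ q → [ (λ i → absurdᵇ i o) , (λ i → absurdᵇ i p) ]′ (PM.inside pm x t q)

  abstract
    -- Both matchings have curl 1 at the vertices of the system and 0 elsewhere, so their difference
    -- integrates over the whole plane. The integral is constant on the connected exterior, where no
    -- edge is matched.
    potential : ∀ φ₁ φ₂ → PM φ₁ → PM φ₂ → ∃ λ (f : Hx → ℤ) →
        (∀ x → Ext x → f x ≡ + 0) × (∀ x t → f (x ⊞ t) ℤ.+ val (φ₂ x t) ≡ f x ℤ.+ val (φ₁ x t))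
    potential φ₁ φ₂ p₁ p₂ = g , outer , step
      where
      ω : Form
      ω = subtract (lin φ₁) (+ 1) (lin φ₂)
      closed : ∀ v → curl ω v ≡ + 0
      closed v with anyDir? (λ t → I (tail-at v t) BP.≟ true)
      ... | yes (t , i) = trans (curl-subtract (lin φ₁) (+ 1) (lin φ₂) v)
        (cong₂ (λ p q → p ℤ.- + 1 ℤ.* q) (curl-One p₁ v t i) (curl-One p₂ v t i))
      ... | no n = trans (curl-subtract (lin φ₁) (+ 1) (lin φ₂) v)
        (cong₂ (λ p q → p ℤ.- + 1 ℤ.* q) (none p₁) (none p₂))
        where
        out : ∀ t → Ext (tail-at v t)
        out t = BP.¬-not λ q → n (t , q)
        none : ∀ {φ} → PM φ → curl (lin φ) v ≡ + 0
        none {φ} pm = cong₂ ℤ._+_ (cong₂ ℤ._+_ (z a) (z b)) (z c)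
          where
          z : ∀ t → apply (lin φ) (edgeAt v t) ≡ + 0
          z t = trans (cong (apply (lin φ)) (edgeAt-type v t))
            (cong val (outside-false pm (tail-at v t) t (out t) (triangle-heads Ext v out t)))
      f : Hx → ℤ
      f = proj₁ (integrate ω closed)
      f-step : ∀ x t → f (x ⊞ t) ≡ f x ℤ.+ ω x t
      f-step = proj₂ (integrate ω closed)
      o : Hx
      o = + N , + 0
      g : Hx → ℤ
      g x = f x ℤ.- f o
      outer : ∀ x → Ext x → g x ≡ + 0
      outer x e = trans (cong (ℤ._- f o) (exterior-connected (λ y → f y ≡ f o) same o x
        (far (+ N) (+ 0) ℕP.≤-refl) e refl)) (ℤP.+-inverseʳ (f o))
        where
        same : ∀ x t → Ext x → Ext (x ⊞ t) → (f x ≡ f o → f (x ⊞ t) ≡ f o) × (f (x ⊞ t) ≡ f o → f x ≡ f o)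
        same x t p q = trans eq , trans (sym eq)
          where
          eq : f (x ⊞ t) ≡ f x
          eq = trans (f-step x t) (trans (cong₂ (λ y z → f x ℤ.+ (val y ℤ.- + 1 ℤ.* val z))
            (outside-false p₁ x t p q) (outside-false p₂ x t p q)) (ℤP.+-identityʳ _))
      step : ∀ x t → g (x ⊞ t) ℤ.+ val (φ₂ x t) ≡ g x ℤ.+ val (φ₁ x t)
      step x t = trans (cong (λ y → y ℤ.- f o ℤ.+ val (φ₂ x t)) (f-step x t))
        (solve 4 (λ p q v w → p :+ (v :- con (+ 1) :* w) :- q :+ w := p :- q :+ v) refl (f x) (f o)
          (val (φ₁ x t)) (val (φ₂ x t)))

    -- The slopes 1, 1 and -2 cancel around a vertex with three interior hexagons. Slope 0 off the
    -- inner edges leaves curl at finitely many vertices of the boundary only, to be removed by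
    -- `close-up`.
    height : ∀ φ → PM φ → ∃ λ (h : Hx → ℤ) → ∀ x t → Int x → Int (x ⊞ t) →
        (φ x t ≡ false → h (x ⊞ t) ≡ ℤ.suc (h x)) × (φ x t ≡ true → h x ≡ ℤ.suc (ℤ.suc (h (x ⊞ t))))
    height φ pm = h , slopes
      where
      slope : Bool → ℤ
      slope p = + 1 ℤ.- + 3 ℤ.* val p
      ω : Form
      ω x t = if I x ∧ I (x ⊞ t) then slope (φ x t) else + 0
      ω-inner : ∀ x t → Int x → Int (x ⊞ t) → ω x t ≡ slope (φ x t)
      ω-inner x t i j rewrite i | j = refl
      ω-outer : ∀ x t → Ext x → ω x t ≡ + 0
      ω-outer x t o rewrite o = refl
      vertices : List Vertex
      vertices = concatMap (λ x → concatMap (λ t → endAt (x , t) up ∷ endAt (x , t) dn ∷ []) (a ∷ b ∷ c ∷ [])) cells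
      listed : ∀ x t s → Int x → endAt (x , t) s ∈ vertices
      listed x t s i = ∈-concatMap⁺ _ (Any.map (λ { refl → pick t s }) (cells-complete x i))
        where
        pick : ∀ t s → endAt (x , t) s ∈ concatMap (λ t → endAt (x , t) up ∷ endAt (x , t) dn ∷ []) (a ∷ b ∷ c ∷ [])
        pick a up = here refl
        pick a dn = there (here refl)
        pick b up = there (there (here refl))
        pick b dn = there (there (there (here refl)))
        pick c up = there (there (there (there (here refl))))
        pick c dn = there (there (there (there (there (here refl)))))
      off : ∀ v → v ∉ vertices → curl ω v ≡ + 0
      off v n = cong₂ ℤ._+_ (cong₂ ℤ._+_ (z a) (z b)) (z c)
        where
        z : ∀ t → apply ω (edgeAt v t) ≡ + 0
        z t with int? (tail-at v t)
        ... | inj₂ o = trans (cong (apply ω) (edgeAt-type v t)) (ω-outer (tail-at v t) t o)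
        ... | inj₁ i = ⊥-elim (n (subst (_∈ vertices)
          (trans (cong (λ e → endAt e (proj₂ v)) (sym (edgeAt-type v t))) (endAt-edgeAt v t))
          (listed (tail-at v t) t (proj₂ v) i)))
      inn : ∀ v → (∀ t → Int (tail-at v t)) → curl ω v ≡ + 0
      inn v i = trans (cong₂ ℤ._+_ (cong₂ ℤ._+_ (z a) (z b)) (z c)) (trans
          (solve 3 (λ p q r → con (+ 1) :- con (+ 3) :* p :+ (con (+ 1) :- con (+ 3) :* q) :+
            (con (+ 1) :- con (+ 3) :* r)
            := con (+ 3) :- con (+ 3) :* (p :+ q :+ r)) refl (apply (lin φ) (edgeAt v a))
              (apply (lin φ) (edgeAt v b)) (apply (lin φ) (edgeAt v c)))
          (cong (λ k → + 3 ℤ.- + 3 ℤ.* k) (curl-One pm v a (i a))))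
        where
        z : ∀ t → apply ω (edgeAt v t) ≡ + 1 ℤ.- + 3 ℤ.* apply (lin φ) (edgeAt v t)
        z t = trans (cong (apply ω) (edgeAt-type v t))
          (trans (ω-inner (tail-at v t) t (i t) (triangle-heads Int v i t))
          (cong (λ e → + 1 ℤ.- + 3 ℤ.* apply (lin φ) e) (sym (edgeAt-type v t))))
      repaired : ∃ λ ω′ → (∀ x t → Int x → Int (x ⊞ t) → ω′ x t ≡ ω x t) × (∀ v → curl ω′ v ≡ + 0)
      repaired = close-up vertices ω off inn
      h : Hx → ℤ
      h = proj₁ (integrate (proj₁ repaired) (proj₂ (proj₂ repaired)))
      h-step : ∀ x t → Int x → Int (x ⊞ t) → h (x ⊞ t) ≡ h x ℤ.+ slope (φ x t)
      h-step x t i j = trans (proj₂ (integrate (proj₁ repaired) (proj₂ (proj₂ repaired))) x t)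
        (cong (λ z → h x ℤ.+ z) (trans (proj₁ (proj₂ repaired) x t i j) (ω-inner x t i j)))
      slopes : ∀ x t → Int x → Int (x ⊞ t) →
        (φ x t ≡ false → h (x ⊞ t) ≡ ℤ.suc (h x)) × (φ x t ≡ true → h x ≡ ℤ.suc (ℤ.suc (h (x ⊞ t))))
      slopes x t i j = (λ f → trans (h-step x t i j)
        (trans (cong (λ p → h x ℤ.+ slope p) f) (ℤP.+-comm (h x) (+ 1)))) ,
        λ m → sym (trans (cong (ℤ.suc ∘ ℤ.suc) (trans (h-step x t i j) (cong (λ p → h x ℤ.+ slope p) m)))
          (solve 1 (λ k → con (+ 1) :+ (con (+ 1) :+ (k :+ con (ℤ.- (+ 2)))) := k) refl (h x)))

  region : Region
  region = record { lattice = lattice ; potential = potential ; height = height }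

-- Sums modulo 2

xsum : {A : Set} → (A → Bool) → List A → Bool
xsum p [] = false
xsum p (x ∷ xs) = p x xor xsum p xs

xor-interchange : ∀ p q r s → (p xor q) xor (r xor s) ≡ (p xor r) xor (q xor s)
xor-interchange true true true true = refl
xor-interchange true true true false = refl
xor-interchange true true false true = refl
xor-interchange true true false false = refl
xor-interchange true false true true = refl
xor-interchange true false true false = refl
xor-interchange true false false true = refl
xor-interchange true false false false = refl
xor-interchange false true true true = refl
xor-interchange false true true false = refl
xor-interchange false true false true = refl
xor-interchange false true false false = refl
xor-interchange false false r s = refl

module _ {A : Set} where

  xsum-xor : ∀ (p q : A → Bool) xs → xsum (λ x → p x xor q x) xs ≡ xsum p xs xor xsum q xs
  xsum-xor p q [] = refl
  xsum-xor p q (x ∷ xs) = trans (cong ((p x xor q x) xor_) (xsum-xor p q xs))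
    (xor-interchange (p x) (q x) (xsum p xs) (xsum q xs))

  xsum-cong : ∀ {p q : A → Bool} xs → (∀ x → x ∈ xs → p x ≡ q x) → xsum p xs ≡ xsum q xs
  xsum-cong [] h = refl
  xsum-cong (x ∷ xs) h = cong₂ _xor_ (h x (here refl)) (xsum-cong xs (λ y m → h y (there m)))

  xsum-false : ∀ {p : A → Bool} xs → (∀ x → x ∈ xs → p x ≡ false) → xsum p xs ≡ false
  xsum-false [] h = refl
  xsum-false {p} (x ∷ xs) h rewrite h x (here refl) = xsum-false xs (λ y m → h y (there m))

  xsum-once : ∀ {p : A → Bool} {xs x} → Unique xs → x ∈ xs → p x ≡ true → (∀ y → y ∈ xs → p y ≡ true → y ≡ x) →
    xsum p xs ≡ true
  xsum-once {p} {x ∷ xs} (x∉ ∷ u) (here refl) px h rewrite px =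
    cong not (xsum-false xs λ y m → BP.¬-not λ q → All.lookup x∉ m (sym (h y (there m) q)))
  xsum-once {p} {y ∷ xs} {x} (y∉ ∷ u) (there m) px h
    rewrite BP.¬-not {p y} (λ q → All.lookup y∉ m (h y (here refl) q)) = xsum-once u m px (λ z k → h z (there k))

  xsum-++ : ∀ (p : A → Bool) xs ys → xsum p (xs ++ ys) ≡ xsum p xs xor xsum p ys
  xsum-++ p [] ys = refl
  xsum-++ p (x ∷ xs) ys = trans (cong (p x xor_) (xsum-++ p xs ys))
    (sym (BP.xor-assoc (p x) (xsum p xs) (xsum p ys)))

xsum-map : {A B : Set} (p : B → Bool) (f : A → B) → ∀ xs → xsum p (map f xs) ≡ xsum (p ∘ f) xs
xsum-map p f [] = refl
xsum-map p f (x ∷ xs) = cong (p (f x) xor_) (xsum-map p f xs)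

xor-dec : {A B C : Set} (A? : Dec A) (B? : Dec B) (C? : Dec C) →
  (A → B → ¬ C) → (A → ¬ B → C) → (¬ A → B → C) → (¬ A → ¬ B → ¬ C) → does A? xor does B? ≡ does C?
xor-dec (yes p) (yes q) C? f _ _ _ = sym (dec-false C? (f p q))
xor-dec (yes p) (no q) C? _ g _ _ = sym (dec-true C? (g p q))
xor-dec (no p) (yes q) C? _ _ h _ = sym (dec-true C? (h p q))
xor-dec (no p) (no q) C? _ _ _ k = sym (dec-false C? (k p q))

suc-injective : ∀ {i j} → ℤ.suc i ≡ ℤ.suc j → i ≡ j
suc-injective {i} {j} eq = trans (sym (ℤP.pred-suc i)) (trans (cong ℤ.pred eq) (ℤP.pred-suc j))

pred-injective : ∀ {i j} → ℤ.pred i ≡ ℤ.pred j → i ≡ j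
pred-injective {i} {j} eq = trans (sym (ℤP.suc-pred i)) (trans (cong ℤ.suc eq) (ℤP.suc-pred j))

pred-≤ : ∀ {i j} → ℤ.pred i ℤ.≤ ℤ.pred j → i ℤ.≤ j
pred-≤ {i} {j} le = subst₂ ℤ._≤_ (ℤP.suc-pred i) (ℤP.suc-pred j) (ℤP.+-monoʳ-≤ (+ 1) le)

suc-≰ : ∀ {i k} → i ℤ.≤ k → ¬ (ℤ.suc i ℤ.≤ k) → k ≡ i
suc-≰ le n = ℤP.≤-antisym (ℤP.≮⇒≥ λ lt → n (ℤP.i<j⇒suc[i]≤j lt)) le

suc-≤ : ∀ {i k} → ℤ.suc i ℤ.≤ k → i ℤ.≤ k
suc-≤ le = ℤP.≤-trans (ℤP.i≤suc[i] _) le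

suc-≰-self : ∀ i → ¬ (ℤ.suc i ℤ.≤ i)
suc-≰-self i le = ℤP.<⇒≱ (i<suc[i] i) le

-- Rays and their crossings with edges

Dart : Set
Dart = Ed × Sense

src tgt : Dart → Vertex
src (e , s) = endAt e s
tgt (e , s) = endAt e (opp s)

-- The ray from the hexagon x in direction b meets the edge (y , b).
Ray : Hx → Hx → Set
Ray x y = proj₂ y ≡ proj₂ x × proj₁ x ℤ.≤ proj₁ y

ray? : ∀ x y → Dec (Ray x y)
ray? x y = (proj₂ y ℤ.≟ proj₂ x) ×-dec (proj₁ x ℤ.≤? proj₁ y)

crosses : Hx → Ed → Bool
crosses x (y , a) = false
crosses x (y , b) = does (ray? x y)
crosses x (y , c) = false

is : Ed → Ed → Bool
is e e′ = does (e′ ≟ᴱ e)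

crosses-b : ∀ x e → crosses x e xor crosses (x ⊞ b) e ≡ is (x , b) e
crosses-b x (y , a) = sym (dec-false ((y , a) ≟ᴱ (x , b)) λ ())
crosses-b x (y , c) = sym (dec-false ((y , c) ≟ᴱ (x , b)) λ ())
crosses-b (i , j) ((k , l) , b) = xor-dec (ray? (i , j) (k , l)) (ray? (ℤ.suc i , j) (k , l))
  (((k , l) , b) ≟ᴱ ((i , j) , b))
  (λ { _ (_ , le) refl → suc-≰-self i le })
  (λ { (refl , le) n → cong (λ z → (z , j) , b) (suc-≰ le λ q → n (refl , q)) })
  (λ { n (eq , le) → ⊥-elim (n (eq , suc-≤ le)) })
  (λ { n _ refl → n (refl , ℤP.≤-refl) })

-- The vertices between the rays of `x` and `x ⊞ c`. A closed walk enters and leaves this strip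
-- equally often, and it does so through the two rays and the edge `(x , c)`.
half-c : Hx → Vertex → Bool
half-c x (z , s) = does (ray? x z)

crosses-c : ∀ x e → half-c x (endAt e up) xor half-c x (endAt e dn)
  ≡ (crosses x e xor crosses (x ⊞ c) e) xor is (x , c) e
crosses-c x (y , a) = trans (BP.xor-same (half-c x (endAt (y , a) up))) (sym (dec-false ((y , a) ≟ᴱ (x , c)) λ ()))
crosses-c (i , j) (y@(k , l) , b) = trans (cong (does (ray? (i , j) y) xor_)
    (does-⇔ (mk⇔
      (λ { (eq , le) → trans (sym (ℤP.suc-pred l)) (cong ℤ.suc eq) , le })
      (λ { (eq , le) → trans (cong ℤ.pred eq) (ℤP.pred-suc j) , le }))
      (ray? (i , j) (k , ℤ.pred l)) (ray? (i , ℤ.suc j) y)))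
  (trans (sym (BP.xor-identityʳ _)) (cong ((does (ray? (i , j) y) xor does (ray? (i , ℤ.suc j) y)) xor_)
    (sym (dec-false ((y , b) ≟ᴱ ((i , j) , c)) λ ()))))
crosses-c (i , j) ((k , l) , c) = xor-dec (ray? (i , j) (ℤ.pred k , l)) (ray? (i , j) (k , l))
  (((k , l) , c) ≟ᴱ ((i , j) , c))
  (λ { (_ , le) _ refl → ℤP.<⇒≱ (subst (ℤ.pred i ℤ.<_) (ℤP.suc-pred i) (i<suc[i] (ℤ.pred i))) le })
  (λ { (eq , le) n → ⊥-elim (n (eq , ℤP.≤-trans le
    (subst (ℤ.pred k ℤ.≤_) (ℤP.suc-pred k) (ℤP.i≤suc[i] (ℤ.pred k))))) })
  (λ { n (refl , le) → cong (λ z → (z , j) , c)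
    (suc-≰ le λ q → n (refl , subst (ℤ._≤ ℤ.pred k) (ℤP.pred-suc i) (ℤP.+-monoʳ-≤ -1ℤ q))) })
  (λ { _ n refl → n (refl , ℤP.≤-refl) })

-- The strip between the rays of `x ⊞ a` and `x`. Both ends of the edge `(x , a)` are named by
-- `x ⊞ a`, so the bounds for the two senses must differ by 1 to separate them.
half-a : Hx → Vertex → Bool
half-a (i , j) (z , up) = does (ray? (ℤ.pred i , ℤ.pred j) z)
half-a (i , j) (z , dn) = does (ray? (i , ℤ.pred j) z)

crosses-a : ∀ x e → half-a x (endAt e up) xor half-a x (endAt e dn)
  ≡ (crosses x e xor crosses (x ⊞ a) e) xor is (x , a) e
crosses-a (i , j) ((k , l) , a) = xor-dec (ray? (ℤ.pred i , ℤ.pred j) (ℤ.pred k , ℤ.pred l))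
  (ray? (i , ℤ.pred j) (ℤ.pred k , ℤ.pred l))
    (((k , l) , a) ≟ᴱ ((i , j) , a))
  (λ { _ (_ , le) refl → ℤP.<⇒≱ (subst (ℤ.pred i ℤ.<_) (ℤP.suc-pred i) (i<suc[i] (ℤ.pred i))) le })
  (λ { (eq , le) n → cong₂ (λ z w → (z , w) , a)
    (suc-≰ (pred-≤ le) λ q → n (eq , subst (ℤ._≤ ℤ.pred k) (ℤP.pred-suc i) (ℤP.+-monoʳ-≤ -1ℤ q)))
        (pred-injective eq) })
  (λ { n (eq , le) → ⊥-elim (n (eq , ℤP.≤-trans
    (subst (ℤ.pred i ℤ.≤_) (ℤP.suc-pred i) (ℤP.i≤suc[i] (ℤ.pred i))) le)) })
  (λ { n _ refl → n (refl , ℤP.≤-refl) })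
crosses-a (i , j) (y@(k , l) , b) = trans (cong (does (ray? (ℤ.pred i , ℤ.pred j) y) xor_)
    (does-⇔ (mk⇔
      (λ { (eq , le) → pred-injective eq , le })
      (λ { (eq , le) → cong ℤ.pred eq , le }))
      (ray? (i , ℤ.pred j) (k , ℤ.pred l)) (ray? (i , j) y)))
  (trans (BP.xor-comm (does (ray? (ℤ.pred i , ℤ.pred j) y)) _)
  (trans (sym (BP.xor-identityʳ _)) (cong ((does (ray? (i , j) y) xor does (ray? (ℤ.pred i , ℤ.pred j) y)) xor_)
    (sym (dec-false ((y , b) ≟ᴱ ((i , j) , a)) λ ())))))
crosses-a (i , j) ((k , l) , c) = trans (cong (_xor does (ray? (i , ℤ.pred j) (k , l)))
    (does-⇔ (mk⇔
      (λ { (eq , le) → eq , pred-≤ le })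
      (λ { (eq , le) → eq , ℤP.+-monoʳ-≤ -1ℤ le }))
      (ray? (ℤ.pred i , ℤ.pred j) (ℤ.pred k , l)) (ray? (i , ℤ.pred j) (k , l))))
  (trans (BP.xor-same (does (ray? (i , ℤ.pred j) (k , l)))) (sym (dec-false (((k , l) , c) ≟ᴱ ((i , j) , a)) λ ())))

at-ends : (q : Vertex → Bool) → ∀ e s → q (endAt e s) xor q (endAt e (opp s)) ≡ q (endAt e up) xor q (endAt e dn)
at-ends q e up = refl
at-ends q e dn = BP.xor-comm (q (endAt e dn)) (q (endAt e up))

xor-zero : ∀ p q → p xor q ≡ false → p ≡ q
xor-zero true true _ = refl
xor-zero false false _ = refl

xor-one : ∀ p q → p xor q ≡ true → p ≡ not q
xor-one true false _ = refl
xor-one false true _ = refl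

-- An edge is determined by its direction and one end of known sense, and the three edges at a
-- vertex have the three directions.
meeting : ∀ r y t y′ t′ → endAt (y′ , t′) r ≡ endAt (y , t) r →
  (y′ , t′) ≡ (y , t) ⊎ (y′ , t′) ≡ (y ⊞ t , rot r t) ⊎ (y′ , t′) ≡ (y ⊞ t ⊞ rot r t , rot (opp r) t)
meeting r y t y′ t′ eq = go (which r t t′)
  where
  at-type : ∀ w u → endAt (w , u) r ≡ endAt (y , t) r → u ≡ t′ → (y′ , t′) ≡ (w , u)
  at-type w u q refl = trans (sym (edgeAt-endAt y′ t′ r))
    (trans (cong (λ v → edgeAt v t′) (trans eq (sym q))) (edgeAt-endAt w t′ r))
  h₁ : endAt (y ⊞ t , rot r t) r ≡ endAt (y , t) r
  h₁ = sym (endAt-head y t r)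
  h₂ : endAt (y ⊞ t ⊞ rot r t , rot (opp r) t) r ≡ endAt (y , t) r
  h₂ = trans (cong (λ u → endAt (y ⊞ t ⊞ rot r t , u) r) (sym (rot-rot r t)))
    (trans (sym (endAt-head (y ⊞ t) (rot r t) r)) h₁)
  which : ∀ r t t′ → t ≡ t′ ⊎ rot r t ≡ t′ ⊎ rot (opp r) t ≡ t′
  which up a a = inj₁ refl
  which up a b = inj₂ (inj₁ refl)
  which up a c = inj₂ (inj₂ refl)
  which up b a = inj₂ (inj₂ refl)
  which up b b = inj₁ refl
  which up b c = inj₂ (inj₁ refl)
  which up c a = inj₂ (inj₁ refl)
  which up c b = inj₂ (inj₂ refl)
  which up c c = inj₁ refl
  which dn a a = inj₁ refl
  which dn a b = inj₂ (inj₂ refl)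
  which dn a c = inj₂ (inj₁ refl)
  which dn b a = inj₂ (inj₁ refl)
  which dn b b = inj₁ refl
  which dn b c = inj₂ (inj₂ refl)
  which dn c a = inj₂ (inj₂ refl)
  which dn c b = inj₂ (inj₁ refl)
  which dn c c = inj₁ refl
  go : t ≡ t′ ⊎ rot r t ≡ t′ ⊎ rot (opp r) t ≡ t′ → (y′ , t′) ≡ (y , t) ⊎ (y′ , t′) ≡ (y ⊞ t , rot r t) ⊎
    (y′ , t′) ≡ (y ⊞ t ⊞ rot r t , rot (opp r) t)
  go (inj₁ q) = inj₁ (at-type y t refl q)
  go (inj₂ (inj₁ q)) = inj₂ (inj₁ (at-type _ _ h₁ q))
  go (inj₂ (inj₂ q)) = inj₂ (inj₂ (at-type _ _ h₂ q))

rot-opp≢ : ∀ r t → rot (opp r) t ≢ rot r t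
rot-opp≢ up a ()
rot-opp≢ up b ()
rot-opp≢ up c ()
rot-opp≢ dn a ()
rot-opp≢ dn b ()
rot-opp≢ dn c ()

-- A closed lattice path and its two sides

-- A closed lattice path without repeated vertices, given by its darts.
module Track (d₀ : Dart) (ds₀ : List Dart)
  (chain : map tgt (d₀ ∷ ds₀) ≡ map src ds₀ ++ [ src d₀ ])
  (unique : Unique (map src (d₀ ∷ ds₀))) (long : 3 ≤ length (d₀ ∷ ds₀)) where

  ds : List Dart
  ds = d₀ ∷ ds₀

  track : List Ed
  track = map proj₁ ds

  I : Hx → Bool
  I x = xsum (crosses x) track

  onTrack : Ed → Bool
  onTrack e = xsum (is e) track

  -- Induction around the path: from `d` to the last dart, over to `d₀`, then through the whole
  -- list.
  walk : (P : Dart → Set) → (∀ {d d′} → d ∈ ds → d′ ∈ ds → src d′ ≡ tgt d → P d → P d′) → ∀ {d d′} → d ∈ ds →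
    d′ ∈ ds → P d → P d′
  walk P step {d} {d′} m m′ p = All.lookup (All-from-first (let l , l∈ , eq , q = to-last d₀ ds₀ chain id m p in step l∈ (here refl) (sym eq) q)) m′
    where
    to-last : ∀ e es {z} → map tgt (e ∷ es) ≡ map src es ++ [ z ] → (∀ {f} → f ∈ e ∷ es → f ∈ ds) →
      ∀ {f} → f ∈ e ∷ es → P f → ∃ λ l → l ∈ ds × tgt l ≡ z × P l
    to-last e [] eq sub (here refl) p = e , sub (here refl) , LP.∷-injectiveˡ eq , p
    to-last e (e′ ∷ es) eq sub (here refl) p =
      to-last e′ es (LP.∷-injectiveʳ eq) (sub ∘ there) (here refl)
        (step (sub (here refl)) (sub (there (here refl))) (sym (LP.∷-injectiveˡ eq)) p)
    to-last e (e′ ∷ es) eq sub (there m) p = to-last e′ es (LP.∷-injectiveʳ eq) (sub ∘ there) m p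
    forward : ∀ e es {z} → map tgt (e ∷ es) ≡ map src es ++ [ z ] → (∀ {f} → f ∈ e ∷ es → f ∈ ds) → P e →
      All P (e ∷ es)
    forward e [] eq sub p = p ∷ []
    forward e (e′ ∷ es) eq sub p = p ∷ forward e′ es (LP.∷-injectiveʳ eq) (sub ∘ there)
      (step (sub (here refl)) (sub (there (here refl))) (sym (LP.∷-injectiveˡ eq)) p)
    All-from-first : P d₀ → All P ds
    All-from-first = forward d₀ ds₀ chain id

  unique-key : {A B : Set} (f : A → B) → ∀ {xs x y} → Unique (map f xs) → x ∈ xs → y ∈ xs → f x ≡ f y → x ≡ y
  unique-key f (n ∷ u) (here refl) (here refl) eq = refl
  unique-key f (n ∷ u) (here refl) (there m) eq = ⊥-elim (All.lookup n (∈-map⁺ f m) eq)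
  unique-key f (n ∷ u) (there m) (here refl) eq = ⊥-elim (All.lookup n (∈-map⁺ f m) (sym eq))
  unique-key f (n ∷ u) (there m) (there k) eq = unique-key f u m k eq

  src-injective : ∀ {d d′} → d ∈ ds → d′ ∈ ds → src d ≡ src d′ → d ≡ d′
  src-injective = unique-key src unique

  tgt-injective : ∀ {d d′} → d ∈ ds → d′ ∈ ds → tgt d ≡ tgt d′ → d ≡ d′
  tgt-injective = unique-key tgt (subst Unique (sym chain) (rotate unique))
    where
    rotate : ∀ {A : Set} {x : A} {xs} → Unique (x ∷ xs) → Unique (xs ++ [ x ])
    rotate (n ∷ u) = AllPairsP.++⁺ u ([] ∷ []) (All.map (λ ne → (ne ∘ sym) ∷ []) n)

  ds-unique : Unique ds
  ds-unique = AllPairs.map (λ ne eq → ne (cong src eq)) (AllPairsP.map⁻ unique)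

  -- The path would close up after the two darts, but it has at least three.
  no-return : ∀ {d d′} → d ∈ ds → d′ ∈ ds → src d′ ≡ tgt d → src d ≡ tgt d′ → ⊥
  no-return {d} {d′} m m′ p q = ℕP.<⇒≱ long
    (Unique-⊆-length {ys = d ∷ d′ ∷ []} ds-unique λ x k → mem (walk Two step m k (inj₁ refl)))
    where
    Two : Dart → Set
    Two x = x ≡ d ⊎ x ≡ d′
    mem : ∀ {x} → Two x → x ∈ d ∷ d′ ∷ []
    mem (inj₁ refl) = here refl
    mem (inj₂ refl) = there (here refl)
    step : ∀ {x y} → x ∈ ds → y ∈ ds → src y ≡ tgt x → Two x → Two y
    step _ ym eq (inj₁ refl) = inj₂ (src-injective ym m′ (trans eq (sym p)))
    step _ ym eq (inj₂ refl) = inj₁ (src-injective ym m (trans eq (sym q)))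

  edge-once : ∀ {d d′} → d ∈ ds → d′ ∈ ds → proj₁ d ≡ proj₁ d′ → d ≡ d′
  edge-once {e , s} {.e , s′} m m′ refl with s ≟ˢ s′
  ... | yes refl = refl
  edge-once {e , up} {.e , up} m m′ refl | no n = ⊥-elim (n refl)
  edge-once {e , up} {.e , dn} m m′ refl | no n = ⊥-elim (no-return m m′ refl refl)
  edge-once {e , dn} {.e , up} m m′ refl | no n = ⊥-elim (no-return m m′ refl refl)
  edge-once {e , dn} {.e , dn} m m′ refl | no n = ⊥-elim (n refl)

  on-track : ∀ {d} → d ∈ ds → onTrack (proj₁ d) ≡ true
  on-track {d} m = trans (xsum-map (is (proj₁ d)) proj₁ ds)
    (xsum-once ds-unique m (dec-true (proj₁ d ≟ᴱ proj₁ d) refl)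
    λ y k h → edge-once k m (does-true (proj₁ y ≟ᴱ proj₁ d) h))

  off-track : ∀ e → (∀ {d} → d ∈ ds → proj₁ d ≢ e) → onTrack e ≡ false
  off-track e n = trans (xsum-map (is e) proj₁ ds) (xsum-false ds λ d m → dec-false (proj₁ d ≟ᴱ e) (n m))

  track? : ∀ e → (∃ λ d → d ∈ ds × proj₁ d ≡ e) ⊎ (∀ {d} → d ∈ ds → proj₁ d ≢ e)
  track? e with any? (λ d → proj₁ d ≟ᴱ e) ds
  ... | yes p = inj₁ (find p)
  ... | no n = inj₂ λ m eq → n (Any.map (λ { refl → eq }) m)

  closed-walk : (q : Vertex → Bool) → xsum (λ e → q (endAt e up) xor q (endAt e dn)) track ≡ false
  closed-walk q = begin
    xsum (λ e → q (endAt e up) xor q (endAt e dn)) track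
      ≡⟨ xsum-map (λ e → q (endAt e up) xor q (endAt e dn)) proj₁ ds ⟩
    xsum (λ d → q (endAt (proj₁ d) up) xor q (endAt (proj₁ d) dn)) ds
      ≡⟨ xsum-cong ds (λ { (e , s) _ → sym (at-ends q e s) }) ⟩
    xsum (λ d → q (src d) xor q (tgt d)) ds ≡⟨ xsum-xor (q ∘ src) (q ∘ tgt) ds ⟩
    xsum (q ∘ src) ds xor xsum (q ∘ tgt) ds
      ≡⟨ cong (xsum (q ∘ src) ds xor_) (trans (sym (xsum-map q tgt ds)) (trans (cong (xsum q) chain) shifted)) ⟩
    xsum (q ∘ src) ds xor xsum (q ∘ src) ds ≡⟨ BP.xor-same (xsum (q ∘ src) ds) ⟩
    false ∎
    where
    open ≡-Reasoning
    shifted : xsum q (map src ds₀ ++ [ src d₀ ]) ≡ xsum (q ∘ src) ds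
    shifted = trans (xsum-++ q (map src ds₀) [ src d₀ ])
      (trans (cong₂ _xor_ (xsum-map q src ds₀) (BP.xor-identityʳ (q (src d₀))))
      (BP.xor-comm (xsum (q ∘ src) ds₀) (q (src d₀))))

  -- In direction b one ray extends the other by a single edge. In the other directions the rays are
  -- parallel, and the strip between them compares their crossings.
  parity : ∀ x t → I x xor I (x ⊞ t) ≡ onTrack (x , t)
  parity x b = trans (sym (xsum-xor (crosses x) (crosses (x ⊞ b)) track)) (xsum-cong track λ e _ → crosses-b x e)
  parity x c = xor-zero _ _ (trans (sym
    (trans (xsum-xor (λ e → crosses x e xor crosses (x ⊞ c) e) (is (x , c)) track)
      (cong (_xor onTrack (x , c)) (xsum-xor (crosses x) (crosses (x ⊞ c)) track))))
    (trans (xsum-cong track λ e _ → sym (crosses-c x e)) (closed-walk (half-c x))))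
  parity x a = xor-zero _ _ (trans (sym
    (trans (xsum-xor (λ e → crosses x e xor crosses (x ⊞ a) e) (is (x , a)) track)
      (cong (_xor onTrack (x , a)) (xsum-xor (crosses x) (crosses (x ⊞ a)) track))))
    (trans (xsum-cong track λ e _ → sym (crosses-a x e)) (closed-walk (half-a x))))

  same : ∀ x t → (∀ {d} → d ∈ ds → proj₁ d ≢ (x , t)) → I x ≡ I (x ⊞ t)
  same x t n = xor-zero (I x) (I (x ⊞ t)) (trans (parity x t) (off-track (x , t) n))

  opposite : ∀ {x t s} → ((x , t) , s) ∈ ds → I x ≡ not (I (x ⊞ t))
  opposite {x} {t} m = xor-one (I x) (I (x ⊞ t)) (trans (parity x t) (on-track m))

  -- The hexagons to the left (dn) and to the right (up) of a dart.
  side : Sense → Dart → Hx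
  side σ ((x , t) , s) = if does (s ≟ˢ σ) then x else x ⊞ t

  data Neighbours (x y : Hx) : Set where
    equal : x ≡ y → Neighbours x y
    forth : ∀ t → x ⊞ t ≡ y → (∀ {d} → d ∈ ds → proj₁ d ≢ (x , t)) → Neighbours x y
    back : ∀ t → y ⊞ t ≡ x → (∀ {d} → d ∈ ds → proj₁ d ≢ (y , t)) → Neighbours x y

  -- The path visits the vertex only once, entering and leaving through edges of the other two
  -- directions.
  third-off : ∀ {d d′ f r} → d ∈ ds → d′ ∈ ds → tgt d ≡ endAt f r → src d′ ≡ endAt f r →
    proj₂ f ≢ proj₂ (proj₁ d) → proj₂ f ≢ proj₂ (proj₁ d′) → ∀ {d″} → d″ ∈ ds → proj₁ d″ ≢ f
  third-off {r = r} m m′ p q n n′ {f , s} m″ refl with s ≟ˢ r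
  ... | yes refl = n′ (cong (proj₂ ∘ proj₁) (src-injective m″ m′ (sym q)))
  ... | no ne = n (cong (proj₂ ∘ proj₁) (tgt-injective m″ m (trans (cong (endAt f) (other s r ne)) (sym p))))
    where
    other : ∀ s r → s ≢ r → opp s ≡ r
    other up up ne = ⊥-elim (ne refl)
    other up dn ne = refl
    other dn up ne = refl
    other dn dn ne = ⊥-elim (ne refl)

  -- On one side of a vertex, successive darts border the same hexagon. On the other side their
  -- hexagons are separated only by the third edge, which is off the track.
  neighbours : ∀ σ {d d′} → d ∈ ds → d′ ∈ ds → src d′ ≡ tgt d → Neighbours (side σ d) (side σ d′)
  neighbours σ {(y , t) , s} {(y′ , t′) , s′} m m′ eq with trans (sym (endAt-sense (y′ , t′) s′))
    (trans (cong proj₂ eq) (endAt-sense (y , t) (opp s)))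
  ... | refl with meeting (opp s) y t y′ t′ eq
  ... | inj₁ refl = ⊥-elim (no-return m m′ eq (cong (endAt (y , t)) (sym (opp² s))))
  ... | inj₂ (inj₁ refl) = left s σ refl
    where
    r = opp s
    z = y ⊞ t ⊞ rot r t
    zy : z ⊞ rot (opp r) t ≡ y
    zy = ⊞-tri r y t
    h₂ : endAt (z , rot (opp r) t) r ≡ endAt (y , t) r
    h₂ = trans (cong (λ u → endAt (z , u) r) (sym (rot-rot r t)))
      (trans (sym (endAt-head (y ⊞ t) (rot r t) r)) (sym (endAt-head y t r)))
    third : ∀ {d} → d ∈ ds → proj₁ d ≢ (z , rot (opp r) t)
    third = third-off m m′ (sym h₂) (trans eq (sym h₂)) (rot-moves (opp r) t) (rot-opp≢ r t)
    left : ∀ s₁ σ₁ → s ≡ s₁ → Neighbours (side σ₁ ((y , t) , s₁)) (side σ₁ ((y ⊞ t , rot r t) , opp s₁))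
    left up up q = back _ zy third
    left up dn q = equal refl
    left dn up q = equal refl
    left dn dn q = back _ zy third
  ... | inj₂ (inj₂ refl) = left s σ refl
    where
    r = opp s
    z = y ⊞ t ⊞ rot r t
    third : ∀ {d} → d ∈ ds → proj₁ d ≢ (y ⊞ t , rot r t)
    third = third-off m m′ (endAt-head y t r) (trans eq (endAt-head y t r)) (rot-moves r t) (rot-opp≢ r t ∘ sym)
    left : ∀ s₁ σ₁ → s ≡ s₁ → Neighbours (side σ₁ ((y , t) , s₁)) (side σ₁ ((z , rot (opp r) t) , opp s₁))
    left up up q = equal (sym (⊞-tri r y t))
    left up dn q = forth _ refl third
    left dn up q = forth _ refl third
    left dn dn q = equal (sym (⊞-tri r y t))

  neighbours-same : ∀ {x y} → Neighbours x y → I x ≡ I y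
  neighbours-same (equal refl) = refl
  neighbours-same (forth t refl n) = same _ t n
  neighbours-same (back t refl n) = sym (same _ t n)

  sides-opposite : ∀ σ {d} → d ∈ ds → I (side σ d) ≡ not (I (side (opp σ) d))
  sides-opposite up {(x , t) , up} m = opposite m
  sides-opposite up {(x , t) , dn} m = trans (sym (BP.not-involutive _)) (cong not (sym (opposite m)))
  sides-opposite dn {(x , t) , up} m = trans (sym (BP.not-involutive _)) (cong not (sym (opposite m)))
  sides-opposite dn {(x , t) , dn} m = opposite m

  outer : ∃ λ σ → ∀ {d} → d ∈ ds → I (side σ d) ≡ false
  outer with split (I (side up d₀))
  ... | inj₂ o = up , λ m → walk (λ d → I (side up d) ≡ false)
          (λ m m′ eq p → trans (sym (neighbours-same (neighbours up m m′ eq))) p) (here refl) m o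
  ... | inj₁ i = dn , λ m → walk (λ d → I (side dn d) ≡ false)
          (λ m m′ eq p → trans (sym (neighbours-same (neighbours dn m m′ eq))) p) (here refl) m
          (trans (sides-opposite dn {d₀} (here refl)) (cong not i))

  outside-side : ∀ {x d} → d ∈ ds → I x ≡ false → x ≡ proj₁ (proj₁ d) ⊎ x ≡ proj₁ (proj₁ d) ⊞ proj₂ (proj₁ d) →
    x ≡ side (proj₁ outer) d
  outside-side {x} {d} m o or = go (proj₁ outer) (proj₂ outer m) (pick d or)
    where
    pick : ∀ d → x ≡ proj₁ (proj₁ d) ⊎ x ≡ proj₁ (proj₁ d) ⊞ proj₂ (proj₁ d) → ∃ λ σ → x ≡ side σ d
    pick (e , up) (inj₁ q) = up , q
    pick (e , up) (inj₂ q) = dn , q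
    pick (e , dn) (inj₁ q) = dn , q
    pick (e , dn) (inj₂ q) = up , q
    go : ∀ σ₀ → I (side σ₀ d) ≡ false → (∃ λ σ → x ≡ side σ d) → x ≡ side σ₀ d
    go up p (up , q) = q
    go dn p (dn , q) = q
    go up p (dn , q) = ⊥-elim (absurdᵇ (trans (sides-opposite up m) (cong not (trans (cong I (sym q)) o))) p)
    go dn p (up , q) = ⊥-elim (absurdᵇ (trans (sides-opposite dn m) (cong not (trans (cong I (sym q)) o))) p)

  -- Finiteness of the interior and connectedness of the exterior

  xsum-true : ∀ {A : Set} (p : A → Bool) xs → xsum p xs ≡ true → ∃ λ x → x ∈ xs × p x ≡ true
  xsum-true p xs h with any? (λ x → p x BP.≟ true) xs
  ... | yes q = find q
  ... | no n = absurdᵇ h (xsum-false xs λ x m → BP.¬-not λ e → n (Any.map (λ { refl → e }) m))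

  extent : List Ed → ℕ
  extent [] = 0
  extent (((k , l) , t) ∷ es) = ℤ.∣ k ∣ ℕ.+ (ℤ.∣ l ∣ ℕ.+ extent es)

  ∈-extent : ∀ {k l t es} → ((k , l) , t) ∈ es → ℤ.∣ k ∣ ≤ extent es × ℤ.∣ l ∣ ≤ extent es
  ∈-extent {k} {l} {es = _ ∷ es} (here refl) = ℕP.m≤m+n _ _ , ℕP.≤-trans (ℕP.m≤m+n _ _) (ℕP.m≤n+m _ ℤ.∣ k ∣)
  ∈-extent {es = ((k′ , l′) , _) ∷ es} (there m) = let p , q = ∈-extent m in
    ℕP.≤-trans p (ℕP.≤-trans (ℕP.m≤n+m _ ℤ.∣ l′ ∣) (ℕP.m≤n+m _ ℤ.∣ k′ ∣)) ,
    ℕP.≤-trans q (ℕP.≤-trans (ℕP.m≤n+m _ ℤ.∣ l′ ∣) (ℕP.m≤n+m _ ℤ.∣ k′ ∣))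

  M : ℕ
  M = extent track

  inside-row : ∀ i j → I (i , j) ≡ true → ℤ.∣ j ∣ ≤ M
  inside-row i j h with xsum-true (crosses (i , j)) track h
  ... | ((k , l) , b) , m , q = subst (λ z → ℤ.∣ z ∣ ≤ M) (proj₁ (does-true (ray? (i , j) (k , l)) q))
    (proj₂ (∈-extent m))

  -- No edge of the track has its tail in this column, so `I` is constant along it, and it is false
  -- beyond row `M`.
  far-column : ∀ i j → ¬ (ℤ.∣ i ∣ ≤ M) → I (i , j) ≡ false
  far-column i j n = BP.¬-not λ h → ℕP.<⇒≱ big (inside-row i _ (trans (sym (climbing (suc (M ℕ.+ ℤ.∣ j ∣)))) h))
    where
    up-column : ∀ j → I (i , j) ≡ I (i , ℤ.suc j)
    up-column j = same (i , j) c λ {d} m eq → n (proj₁ (∈-extent (subst (_∈ track) eq (∈-map⁺ proj₁ m))))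
    climbing : ∀ n → I (i , j) ≡ I (i , + n ℤ.+ j)
    climbing zero = cong (λ z → I (i , z)) (sym (ℤP.+-identityˡ j))
    climbing (suc n) = trans (climbing n)
      (trans (up-column (+ n ℤ.+ j)) (cong (λ z → I (i , z)) (sym (ℤP.+-assoc (+ 1) (+ n) j))))
    big : M < ℤ.∣ + suc (M ℕ.+ ℤ.∣ j ∣) ℤ.+ j ∣
    big = ℕP.+-cancelʳ-≤ ℤ.∣ j ∣ _ _ (ℕP.≤-trans (ℕP.≤-reflexive (cong ℤ.∣_∣
        (solve 2 (λ n j → n := n :+ j :- j) refl (+ suc (M ℕ.+ ℤ.∣ j ∣)) j)))
          (ℤP.∣i-j∣≤∣i∣+∣j∣ (+ suc (M ℕ.+ ℤ.∣ j ∣) ℤ.+ j) j))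

  inside-column : ∀ i j → I (i , j) ≡ true → ℤ.∣ i ∣ ≤ M
  inside-column i j h with ℤ.∣ i ∣ ℕP.≤? M
  ... | yes p = p
  ... | no n = absurdᵇ h (far-column i j n)

  range : List ℤ
  range = map +_ (upTo (suc M)) ++ map -[1+_] (upTo M)

  ∈-range : ∀ i → ℤ.∣ i ∣ ≤ M → i ∈ range
  ∈-range (+ n) le = ∈-++⁺ˡ (∈-map⁺ +_ (∈-upTo⁺ (s≤s le)))
  ∈-range -[1+ n ] le = ∈-++⁺ʳ (map +_ (upTo (suc M))) (∈-map⁺ -[1+_] (∈-upTo⁺ le))

  range-unique : Unique range
  range-unique = UniqueP.++⁺ (UniqueP.map⁺ ℤP.+-injective (UniqueP.upTo⁺ (suc M)))
    (UniqueP.map⁺ ℤP.-[1+-injective (UniqueP.upTo⁺ M))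
    λ { (p , q) → apart (∈-map⁻ +_ p) (∈-map⁻ -[1+_] q) }
    where
    apart : ∀ {i : ℤ} {P Q : ℕ → Set} → (∃ λ n → P n × i ≡ + n) → (∃ λ n → Q n × i ≡ -[1+ n ]) → ⊥
    apart (_ , _ , refl) (_ , _ , ())

  cells : List Hx
  cells = filter (λ x → I x BP.≟ true) (cartesianProduct range range)

  module _ (P : Hx → Set)
    (close : ∀ x t → I x ≡ false → I (x ⊞ t) ≡ false → (P x → P (x ⊞ t)) × (P (x ⊞ t) → P x)) where

    σ : Sense
    σ = proj₁ outer

    Rim : Set
    Rim = ∀ {d} → d ∈ ds → P (side σ d)

    around : ∀ {d} → d ∈ ds → P (side σ d) → Rim
    around m p m′ = walk (λ d → P (side σ d))
      (λ {d} {d′} k k′ eq → across (proj₂ outer k) (proj₂ outer k′) (neighbours σ k k′ eq)) m m′ p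
      where
      across : ∀ {x y} → I x ≡ false → I y ≡ false → Neighbours x y → P x → P y
      across o o′ (equal refl) p = p
      across o o′ (forth t refl _) p = proj₁ (close _ t o o′) p
      across o o′ (back t refl _) p = proj₂ (close _ t o′ o) p

    -- The invariant of a walk along a row. While interior hexagons are passed, the second part
    -- remembers that `P` holds along the whole rim, ready for when the row becomes exterior again.
    OnRow : ℤ → ℤ → Set
    OnRow j i = (I (i , j) ≡ false → P (i , j)) × ((I (i , j) ≡ false × P (i , j)) ⊎ Rim)

    transport : ∀ x y → (∀ {d} → d ∈ ds → proj₁ d ≢ (x , b)) ⊎ (∃ λ d → d ∈ ds × proj₁ d ≡ (x , b)) → x ⊞ b ≡ y →
      ((I x ≡ false → P x) × ((I x ≡ false × P x) ⊎ Rim) → (I y ≡ false → P y) × ((I y ≡ false × P y) ⊎ Rim)) ×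
      ((I y ≡ false → P y) × ((I y ≡ false × P y) ⊎ Rim) → (I x ≡ false → P x) × ((I x ≡ false × P x) ⊎ Rim))
    transport x y (inj₁ n) refl =
      (λ { (f , g) → (λ o → proj₁ (close x b (trans eq o) o) (f (trans eq o))) ,
        [ (λ { (o , p) → inj₁ (trans (sym eq) o , proj₁ (close x b o (trans (sym eq) o)) p) }) , inj₂ ]′ g }) ,
      (λ { (f , g) → (λ o → proj₂ (close x b o (trans (sym eq) o)) (f (trans (sym eq) o))) ,
        [ (λ { (o , p) → inj₁ (trans eq o , proj₂ (close x b (trans eq o) o) p) }) , inj₂ ]′ g })
      where
      eq : I x ≡ I (x ⊞ b)
      eq = same x b n
    transport x y (inj₂ (d , m , refl)) refl =
      (λ { (f , g) → done (inj₂ refl) (rim (inj₁ refl) g) , inj₂ (λ {d} → rim (inj₁ refl) g {d}) }) ,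
      (λ { (f , g) → done (inj₁ refl) (rim (inj₂ refl) g) , inj₂ (λ {d} → rim (inj₂ refl) g {d}) })
      where
      rim : ∀ {z} → z ≡ x ⊎ z ≡ x ⊞ b → (I z ≡ false × P z) ⊎ Rim → Rim
      rim w (inj₁ (o , p)) = around m (subst P (outside-side m o w) p)
      rim w (inj₂ r) = r
      done : ∀ {z} → z ≡ x ⊎ z ≡ x ⊞ b → Rim → I z ≡ false → P z
      done w r o = subst P (sym (outside-side m o w)) (r m)

    track?′ : ∀ e → (∀ {d} → d ∈ ds → proj₁ d ≢ e) ⊎ (∃ λ d → d ∈ ds × proj₁ d ≡ e)
    track?′ e with track? e
    ... | inj₁ p = inj₂ p
    ... | inj₂ n = inj₁ n

    ℤ-walk : (Q : ℤ → Set) → (∀ i → (Q i → Q (ℤ.suc i)) × (Q (ℤ.suc i) → Q i)) → ∀ i → (Q (+ 0) → Q i) ×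
      (Q i → Q (+ 0))
    ℤ-walk Q s (+ zero) = id , id
    ℤ-walk Q s (+ suc n) = proj₁ (s (+ n)) ∘ proj₁ (ℤ-walk Q s (+ n)) , proj₂ (ℤ-walk Q s (+ n)) ∘ proj₂ (s (+ n))
    ℤ-walk Q s -[1+ zero ] = proj₂ (s -[1+ 0 ]) , proj₁ (s -[1+ 0 ])
    ℤ-walk Q s -[1+ suc n ] = proj₂ (s -[1+ suc n ]) ∘ proj₁ (ℤ-walk Q s -[1+ n ]) ,
      proj₂ (ℤ-walk Q s -[1+ n ]) ∘ proj₁ (s -[1+ suc n ])

    beyond : ∀ j → I (+ suc M , j) ≡ false
    beyond j = far-column (+ suc M) j (ℕP.<⇒≱ ℕP.≤-refl)

    everywhere : P (+ suc M , + 0) → ∀ x → I x ≡ false → P x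
    everywhere p (i , j) = proj₁ (proj₁ (ℤ-walk (OnRow j) row i) (proj₂ (ℤ-walk (OnRow j) row (+ suc M)) start))
      where
      row : ∀ i → (OnRow j i → OnRow j (ℤ.suc i)) × (OnRow j (ℤ.suc i) → OnRow j i)
      row i = transport (i , j) (ℤ.suc i , j) (track?′ ((i , j) , b)) refl
      edge : P (+ suc M , j)
      edge = proj₁ (ℤ-walk (λ j → P (+ suc M , j)) (λ j → close (+ suc M , j) c (beyond j) (beyond (ℤ.suc j))) j) p
      start : OnRow j (+ suc M)
      start = (λ _ → edge) , inj₁ (beyond j , edge)

  -- All exterior hexagons along the path lie on the same side of it, and consecutive ones are adjacent;
  -- every other exterior hexagon reaches the path or infinity along its row.
  exterior-connected : (P : Hx → Set) →
      (∀ x t → I x ≡ false → I (x ⊞ t) ≡ false → (P x → P (x ⊞ t)) × (P (x ⊞ t) → P x)) →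
      ∀ x y → I x ≡ false → I y ≡ false → P x → P y
  exterior-connected P close x y o o′ p = everywhere P close
    -- To bring `P` from `x` to the base hexagon, the implication from `P z` to `P` at the base is
    -- spread from the base to `x`.
    (everywhere (λ z → P z → P (+ suc M , + 0))
      (λ z t q r → (λ f → f ∘ proj₂ (close z t q r)) , (λ f → f ∘ proj₁ (close z t q r))) id x o p) y o′

  domain : Domain
  domain = record
    { I = I ; cells = cells
    ; cells-complete = λ { (i , j) h → ∈-filter⁺ (λ x → I x BP.≟ true)
        (∈-cartesianProduct⁺ (∈-range i (inside-column i j h)) (∈-range j (inside-row i j h))) h }
    ; cells-sound = λ x m → proj₂ (∈-filter⁻ (λ x → I x BP.≟ true) {xs = cartesianProduct range range} m)
    ; cells-unique = UniqueP.filter⁺ (λ x → I x BP.≟ true) (UniqueP.cartesianProduct⁺ range-unique range-unique)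
    ; exterior-connected = exterior-connected }

-- Conversion between axial and brick coordinates

-- The axial hexagon (i , j) has its lower-left corner at (2i - j , j). The vertex at an up (dn) triangle
-- is the right (left) end of the a-edge of that triangle.

pos : Hx → Vtx
pos (i , j) = i ℤ.+ i ℤ.- j , j

vt : Vertex → Vtx
vt ((i , j) , up) = i ℤ.+ i ℤ.- j ℤ.+ + 2 , j ℤ.+ + 1
vt ((i , j) , dn) = i ℤ.+ i ℤ.- j ℤ.+ + 1 , j ℤ.+ + 1

enc : Ed → Edge
enc ((i , j) , a) = hor (i ℤ.+ i ℤ.- j) j
enc ((i , j) , b) = ver (i ℤ.+ i ℤ.- j ℤ.+ + 2) j
enc ((i , j) , c) = hor (i ℤ.+ i ℤ.- j) (j ℤ.+ + 1)

-- The sense of the endpoint that `ends` lists first.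
lower : Dir → Sense
lower a = dn
lower b = dn
lower c = up

ends-enc : ∀ x t → ends (enc (x , t)) ≡ (vt (endAt (x , t) (lower t)) , vt (endAt (x , t) (opp (lower t))))
ends-enc (i , j) a = cong₂ _,_ (cong₂ _,_
    (solve 2 (λ i j → i :+ i :- j := (con -1ℤ :+ i) :+ (con -1ℤ :+ i) :- (con -1ℤ :+ j) :+ con (+ 1)) refl i j)
    (solve 1 (λ j → j := con -1ℤ :+ j :+ con (+ 1)) refl j))
  (cong₂ _,_
    (solve 2 (λ i j → i :+ i :- j :+ con (+ 1) := (con -1ℤ :+ i) :+ (con -1ℤ :+ i) :- (con -1ℤ :+ j) :+ con
      (+ 2)) refl i j)
    (solve 1 (λ j → j := con -1ℤ :+ j :+ con (+ 1)) refl j))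
ends-enc (i , j) b = cong₂ _,_ (cong₂ _,_
    (solve 2 (λ i j → i :+ i :- j :+ con (+ 2) := i :+ i :- (con -1ℤ :+ j) :+ con (+ 1)) refl i j)
    (solve 1 (λ j → j := con -1ℤ :+ j :+ con (+ 1)) refl j))
  refl
ends-enc (i , j) c = cong₂ _,_ (cong (_, j ℤ.+ + 1)
    (solve 2 (λ i j → i :+ i :- j := (con -1ℤ :+ i) :+ (con -1ℤ :+ i) :- j :+ con (+ 2)) refl i j))
  refl

halve : ∀ z → ∃ λ w → z ≡ w ℤ.+ w ⊎ z ≡ w ℤ.+ w ℤ.+ + 1
halve (+ zero) = + 0 , inj₁ refl
halve (+ suc n) with halve (+ n)
... | w , inj₁ eq = w , inj₂ (trans (cong ℤ.suc eq) (ℤP.+-comm (+ 1) (w ℤ.+ w)))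
... | w , inj₂ eq = ℤ.suc w , inj₁ (trans (cong ℤ.suc eq)
      (solve 1 (λ w → con (+ 1) :+ (w :+ w :+ con (+ 1)) := (con (+ 1) :+ w) :+ (con (+ 1) :+ w)) refl w))
halve -[1+ zero ] = -[1+ 0 ] , inj₂ refl
halve -[1+ suc n ] with halve -[1+ n ]
... | w , inj₂ eq = w , inj₁ (trans (cong ℤ.pred eq)
      (solve 1 (λ w → con -1ℤ :+ (w :+ w :+ con (+ 1)) := w :+ w) refl w))
... | w , inj₁ eq = ℤ.pred w , inj₂ (trans (cong ℤ.pred eq)
      (solve 1 (λ w → con -1ℤ :+ (w :+ w) := (con -1ℤ :+ w) :+ (con -1ℤ :+ w) :+ con (+ 1)) refl w))

double-mono : ∀ {i k} → i ℤ.≤ k → i ℤ.+ i ℤ.≤ k ℤ.+ k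
double-mono le = ℤP.+-mono-≤ le le

double-<-suc : ∀ {i k} → i ℤ.+ i ℤ.< ℤ.suc (ℤ.suc (k ℤ.+ k)) → i ℤ.≤ k
double-<-suc {i} {k} lt = ℤP.≮⇒≥ λ k<i → ℤP.<⇒≱ lt (subst (ℤ._≤ i ℤ.+ i)
  (solve 1 (λ k → (con (+ 1) :+ k) :+ (con (+ 1) :+ k) := con (+ 1) :+ (con (+ 1) :+ (k :+ k))) refl k)
  (double-mono (ℤP.i<j⇒suc[i]≤j k<i)))

double-injective : ∀ {i k} → i ℤ.+ i ≡ k ℤ.+ k → i ≡ k
double-injective {i} {k} eq = ℤP.≤-antisym (half-≤ (ℤP.≤-reflexive eq)) (half-≤ (ℤP.≤-reflexive (sym eq)))
  where
  half-≤ : ∀ {i k} → i ℤ.+ i ℤ.≤ k ℤ.+ k → i ℤ.≤ k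
  half-≤ le = double-<-suc (ℤP.≤-<-trans le (ℤP.<-trans (i<suc[i] _) (i<suc[i] _)))

even≢odd : ∀ i k → i ℤ.+ i ≢ ℤ.suc (k ℤ.+ k)
even≢odd i k eq = ℤP.<-irrefl (trans (cong (λ z → z ℤ.+ z) i≡k) eq) (i<suc[i] (k ℤ.+ k))
  where
  i≤k : i ℤ.≤ k
  i≤k = double-<-suc (subst (ℤ._< ℤ.suc (ℤ.suc (k ℤ.+ k))) (sym eq) (i<suc[i] _))
  i≡k : k ≡ i
  i≡k = ℤP.≤-antisym (double-<-suc (ℤP.<-trans (subst (k ℤ.+ k ℤ.<_) (sym eq) (i<suc[i] _))
    (ℤP.<-trans (i<suc[i] _) (i<suc[i] _)))) i≤k

abscissa : ∀ i j d → i ℤ.+ i ≡ i ℤ.+ i ℤ.- j ℤ.+ d ℤ.+ (j ℤ.- d)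
abscissa = solve 3 (λ i j d → i :+ i := i :+ i :- j :+ d :+ (j :- d)) refl

+-cancelʳ : ∀ {i j} k → i ℤ.+ k ≡ j ℤ.+ k → i ≡ j
+-cancelʳ k = GP.∙-cancelʳ (AbelianGroup.group ℤP.+-0-abelianGroup) k _ _

vt-row : ∀ i j s → proj₂ (vt ((i , j) , s)) ≡ j ℤ.+ + 1
vt-row i j up = refl
vt-row i j dn = refl

vt-rows : ∀ i j s k l s′ → vt ((i , j) , s) ≡ vt ((k , l) , s′) → j ≡ l
vt-rows i j s k l s′ eq = +-cancelʳ (+ 1) (trans (sym (vt-row i j s)) (trans (cong proj₂ eq) (vt-row k l s′)))

vt-injective : ∀ {v w} → vt v ≡ vt w → v ≡ w
vt-injective {(i , j) , s} {(k , l) , s′} eq with vt-rows i j s k l s′ eq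
vt-injective {(i , j) , up} {(k , .j) , up} eq | refl = cong (λ z → (z , j) , up)
  (double-injective (trans (abscissa i j (+ 2))
    (trans (cong (ℤ._+ (j ℤ.- + 2)) (cong proj₁ eq)) (sym (abscissa k j (+ 2))))))
vt-injective {(i , j) , dn} {(k , .j) , dn} eq | refl = cong (λ z → (z , j) , dn)
  (double-injective (trans (abscissa i j (+ 1))
    (trans (cong (ℤ._+ (j ℤ.- + 1)) (cong proj₁ eq)) (sym (abscissa k j (+ 1))))))
vt-injective {(i , j) , up} {(k , .j) , dn} eq | refl = ⊥-elim (even≢odd k i
  (trans (abscissa k j (+ 1)) (trans (cong (ℤ._+ (j ℤ.- + 1)) (sym (cong proj₁ eq)))
    (solve 2 (λ i j → i :+ i :- j :+ con (+ 2) :+ (j :- con (+ 1)) := con (+ 1) :+ (i :+ i)) refl i j))))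
vt-injective {(i , j) , dn} {(k , .j) , up} eq | refl = ⊥-elim (even≢odd i k
  (trans (abscissa i j (+ 1)) (trans (cong (ℤ._+ (j ℤ.- + 1)) (cong proj₁ eq))
    (solve 2 (λ i j → i :+ i :- j :+ con (+ 2) :+ (j :- con (+ 1)) := con (+ 1) :+ (i :+ i)) refl k j))))

pos-injective : ∀ {x y} → pos x ≡ pos y → x ≡ y
pos-injective {i , j} {k , l} eq with cong proj₂ eq
... | refl = cong (_, j) (double-injective (+-cancelʳ (ℤ.- j) (cong proj₁ eq)))

⊞-drift : ∀ x t → x ⊞ t ≢ x
⊞-drift x t q = rot-moves up (hue x) (trans (sym (hue-⊞ x t)) (cong hue q))

-- `ends` recovers both end vertices, and the two other edges at one end of `(x , t)` never occur
-- among the edges at its other end.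
enc-injective : ∀ {e e′} → enc e ≡ enc e′ → e ≡ e′
enc-injective {x , t} {y , t′} eq =
  go (meeting s x t y t′ (vt-injective tails)) (meeting (opp s) x t y t′ (vt-injective heads))
  where
  s = lower t
  pair : (vt (endAt (x , t) s) , vt (endAt (x , t) (opp s)))
    ≡ (vt (endAt (y , t′) (lower t′)) , vt (endAt (y , t′) (opp (lower t′))))
  pair = trans (sym (ends-enc x t)) (trans (cong ends eq) (ends-enc y t′))
  senses : lower t′ ≡ s
  senses = trans (sym (endAt-sense (y , t′) (lower t′)))
    (trans (cong proj₂ (sym (vt-injective (cong proj₁ pair)))) (endAt-sense (x , t) s))
  tails : vt (endAt (y , t′) s) ≡ vt (endAt (x , t) s)
  tails = trans (cong (λ s → vt (endAt (y , t′) s)) (sym senses)) (sym (cong proj₁ pair))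
  heads : vt (endAt (y , t′) (opp s)) ≡ vt (endAt (x , t) (opp s))
  heads = trans (cong (λ s → vt (endAt (y , t′) (opp s))) (sym senses)) (sym (cong proj₂ pair))
  Meeting : Sense → Set
  Meeting r = (y , t′) ≡ (x , t) ⊎ (y , t′) ≡ (x ⊞ t , rot r t) ⊎ (y , t′) ≡ (x ⊞ t ⊞ rot r t , rot (opp r) t)
  go : Meeting s → Meeting (opp s) → (x , t) ≡ (y , t′)
  go (inj₁ q) _ = sym q
  go (inj₂ _) (inj₁ q) = sym q
  go (inj₂ (inj₁ p)) (inj₂ (inj₁ q)) = ⊥-elim (rot-opp≢ s t (cong proj₂ (trans (sym q) p)))
  go (inj₂ (inj₁ p)) (inj₂ (inj₂ q)) = ⊥-elim (⊞-drift _ _ (cong proj₁ (trans (sym q) p)))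
  go (inj₂ (inj₂ p)) (inj₂ (inj₁ q)) = ⊥-elim (⊞-drift _ _ (cong proj₁ (trans (sym p) q)))
  go (inj₂ (inj₂ p)) (inj₂ (inj₂ q)) = ⊥-elim (rot-opp≢ s t
    (trans (cong proj₂ (trans (sym p) q)) (cong (λ k → rot k t) (opp² s))))

even-half : ∀ z → Even z → ∃ λ q → z ≡ q ℤ.* + 2
even-half z even with ℤSD.∣ᵤ⇒∣ {+ 2} {z} even
... | ℤSD.divides q eq = q , eq

+--cancel : ∀ x y → x ℤ.+ y ℤ.- y ≡ x
+--cancel = solve 2 (λ x y → x :+ y :- y := x) refl

enc-onto : ∀ e → ValidEdge e → ∃ λ e′ → enc e′ ≡ e
enc-onto (hor x y) _ with halve (x ℤ.+ y)
... | w , inj₁ eq = ((w , y) , a) , cong (λ z → hor z y) (trans (cong (ℤ._- y) (sym eq)) (+--cancel x y))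
... | w , inj₂ eq = ((w , y ℤ.- + 1) , c) , cong₂ hor
    (trans (shift w y) (trans (cong (ℤ._- y) (sym eq)) (+--cancel x y)))
    (solve 1 (λ y → y :- con (+ 1) :+ con (+ 1) := y) refl y)
  where
  shift : ∀ w y → w ℤ.+ w ℤ.- (y ℤ.- + 1) ≡ w ℤ.+ w ℤ.+ + 1 ℤ.- y
  shift = solve 2 (λ w y → w :+ w :- (y :- con (+ 1)) := w :+ w :+ con (+ 1) :- y) refl
enc-onto (ver x y) even with even-half (x ℤ.+ y) even
... | q , eq = ((q ℤ.- + 1 , y) , b) ,
  cong (λ z → ver z y) (trans (shift q y) (trans (cong (ℤ._- y) (sym eq)) (+--cancel x y)))
  where
  shift : ∀ q y → (q ℤ.- + 1) ℤ.+ (q ℤ.- + 1) ℤ.- y ℤ.+ + 2 ≡ q ℤ.* + 2 ℤ.- y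
  shift = solve 2 (λ q y → (q :- con (+ 1)) :+ (q :- con (+ 1)) :- y :+ con (+ 2) := q :* con (+ 2) :- y) refl

pos-onto : ∀ h → ValidHex h → ∃ λ x → pos x ≡ h
pos-onto (x , y) even with even-half (x ℤ.+ y) even
... | q , eq = (q , y) , cong (_, y) (trans (shift q y) (trans (cong (ℤ._- y) (sym eq)) (+--cancel x y)))
  where
  shift : ∀ q y → q ℤ.+ q ℤ.- y ≡ q ℤ.* + 2 ℤ.- y
  shift = solve 2 (λ q y → q :+ q :- y := q :* con (+ 2) :- y) refl

pos-valid : ∀ x → ValidHex (pos x)
pos-valid (i , j) = ℤSD.∣⇒∣ᵤ (ℤSD.divides i (solve 2 (λ i j → i :+ i :- j :+ j := i :* con (+ 2)) refl i j))

dartEnds : Dart → Vtx × Vtx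
dartEnds d = vt (src d) , vt (tgt d)

dart : ∀ {u w} → Adjacent u w → ∃ λ d → dartEnds d ≡ (u , w)
dart (e , valid , or) with enc-onto e valid
dart (_ , _ , inj₁ eq) | (x , t) , refl = ((x , t) , lower t) , trans (sym (ends-enc x t)) eq
dart (_ , _ , inj₂ eq) | (x , t) , refl = ((x , t) , opp (lower t)) ,
  cong₂ _,_ (cong proj₂ q) (trans (cong (λ s → vt (endAt (x , t) s)) (opp² (lower t))) (cong proj₁ q))
  where
  q : (vt (endAt (x , t) (lower t)) , vt (endAt (x , t) (opp (lower t)))) ≡ _
  q = trans (sym (ends-enc x t)) eq

darts : ∀ {ps} → All (λ p → Adjacent (proj₁ p) (proj₂ p)) ps → ∃ λ ds → map dartEnds ds ≡ ps
darts [] = [] , refl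
darts (p ∷ ps) = let d , eq = dart p ; ds , eqs = darts ps in d ∷ ds , cong₂ _∷_ eq eqs

no-twist : ∀ {j l} → j ≡ l ℤ.+ + 1 → l ≢ j ℤ.+ + 1
no-twist {j} {l} refl eq = ℤP.<-irrefl (trans eq (ℤP.+-comm (l ℤ.+ + 1) (+ 1)))
  (ℤP.<-trans (subst (l ℤ.<_) (ℤP.+-comm (+ 1) l) (i<suc[i] l)) (i<suc[i] (l ℤ.+ + 1)))

-- Edges of types a and c are horizontal. On a common row, the abscissa `2k - j + 2` of an edge of
-- type b exceeds `2i - j + 1` exactly when `i ≤ k`.
crosses-dart : ∀ x d → does (crosses? (pos x) (dartEnds d)) ≡ crosses x (proj₁ d)
crosses-dart (i , j) ((y , a) , s) =
  dec-false (crosses? (pos (i , j)) (dartEnds ((y , a) , s))) λ { (eq , _) → skew y s eq }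
  where
  skew : ∀ y s → proj₁ (vt (endAt (y , a) s)) ≢ proj₁ (vt (endAt (y , a) (opp s)))
  skew (k , l) up eq = suc≢ _ (trans (solve 1 (λ z → con (+ 1) :+ (z :+ con (+ 1)) := z :+ con (+ 2)) refl
    (ℤ.pred k ℤ.+ ℤ.pred k ℤ.- ℤ.pred l)) eq)
  skew (k , l) dn eq = suc≢ _ (trans (solve 1 (λ z → con (+ 1) :+ (z :+ con (+ 1)) := z :+ con (+ 2)) refl
    (ℤ.pred k ℤ.+ ℤ.pred k ℤ.- ℤ.pred l)) (sym eq))
crosses-dart (i , j) ((y , c) , s) =
  dec-false (crosses? (pos (i , j)) (dartEnds ((y , c) , s))) λ { (eq , _) → skew y s eq }
  where
  lem : ∀ k l → ℤ.suc (ℤ.pred k ℤ.+ ℤ.pred k ℤ.- l ℤ.+ + 2) ≡ k ℤ.+ k ℤ.- l ℤ.+ + 1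
  lem = solve 2 (λ k l → con (+ 1) :+ ((con -1ℤ :+ k) :+ (con -1ℤ :+ k) :- l :+ con (+ 2)) := k :+ k :- l :+ con
    (+ 1)) refl
  skew : ∀ y s → proj₁ (vt (endAt (y , c) s)) ≢ proj₁ (vt (endAt (y , c) (opp s)))
  skew (k , l) up eq = suc≢ _ (trans (lem k l) (sym eq))
  skew (k , l) dn eq = suc≢ _ (trans (lem k l) eq)
crosses-dart (i , j) ((y@(k , l) , b) , s) =
  does-⇔ (mk⇔ (to s) (from s)) (crosses? (pos (i , j)) (dartEnds ((y , b) , s))) (ray? (i , j) y)
  where
  left : ∀ l → ℤ.pred l ℤ.+ + 1 ≡ l
  left = solve 1 (λ l → con -1ℤ :+ l :+ con (+ 1) := l) refl
  level : ∀ k l → k ℤ.+ k ℤ.- ℤ.pred l ℤ.+ + 1 ≡ k ℤ.+ k ℤ.- l ℤ.+ + 2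
  level = solve 2 (λ k l → k :+ k :- (con -1ℤ :+ l) :+ con (+ 1) := k :+ k :- l :+ con (+ 2)) refl
  narrow : i ℤ.+ i ℤ.- j ℤ.+ + 1 ℤ.< k ℤ.+ k ℤ.- j ℤ.+ + 2 → i ℤ.≤ k
  narrow lt = double-<-suc (ℤP.<-trans (i<suc[i] (i ℤ.+ i)) (subst₂ ℤ._<_
    (solve 2 (λ i j → i :+ i :- j :+ con (+ 1) :+ j := con (+ 1) :+ (i :+ i)) refl i j)
    (solve 2 (λ k j → k :+ k :- j :+ con (+ 2) :+ j := con (+ 1) :+ (con (+ 1) :+ (k :+ k))) refl k j)
    (ℤP.+-monoˡ-< j lt)))
  widen : i ℤ.≤ k → i ℤ.+ i ℤ.- j ℤ.+ + 1 ℤ.< k ℤ.+ k ℤ.- j ℤ.+ + 2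
  widen le = subst₂ ℤ._<_
    (solve 2 (λ i j → i :+ i :+ (con (+ 1) :- j) := i :+ i :- j :+ con (+ 1)) refl i j)
    (solve 2 (λ k j → con (+ 1) :+ (k :+ k) :+ (con (+ 1) :- j) := k :+ k :- j :+ con (+ 2)) refl k j)
    (ℤP.+-monoˡ-< (+ 1 ℤ.- j) (ℤP.≤-<-trans (double-mono le) (i<suc[i] (k ℤ.+ k))))
  heights : ∀ {p q} → (p ≡ j × q ≡ j ℤ.+ + 1) ⊎ (p ≡ j ℤ.+ + 1 × q ≡ j) → p ≡ l × q ≡ l ℤ.+ + 1 ⊎ p
    ≡ l ℤ.+ + 1 × q ≡ l → l ≡ j
  heights (inj₁ (p , _)) (inj₁ (p′ , _)) = trans (sym p′) p
  heights (inj₂ (_ , q)) (inj₂ (_ , q′)) = trans (sym q′) q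
  heights (inj₁ (p , q)) (inj₂ (p′ , q′)) = ⊥-elim (no-twist (trans (sym p) p′) (trans (sym q′) q))
  heights (inj₂ (p , q)) (inj₁ (p′ , q′)) = ⊥-elim (no-twist (trans (sym p′) p) (trans (sym q) q′))
  to : ∀ s → Crosses (pos (i , j)) (dartEnds ((y , b) , s)) → Ray (i , j) y
  to up (_ , lt , or) with heights or (inj₂ (refl , left l))
  ... | refl = refl , narrow lt
  to dn (_ , lt , or) with heights or (inj₁ (left l , refl))
  ... | refl = refl , narrow (subst (i ℤ.+ i ℤ.- j ℤ.+ + 1 ℤ.<_) (level k j) lt)
  from : ∀ s → Ray (i , j) y → Crosses (pos (i , j)) (dartEnds ((y , b) , s))
  from up (refl , le) = sym (level k l) , widen le , inj₂ (refl , left l)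
  from dn (refl , le) = level k l , subst (i ℤ.+ i ℤ.- l ℤ.+ + 1 ℤ.<_) (sym (level k l)) (widen le) ,
    inj₁ (left l , refl)

odd-filter : ∀ {A : Set} {P : A → Set} (P? : ∀ x → Dec (P x)) xs →
  does (length (filter P? xs) ℕ.% 2 ℕP.≟ 1) ≡ xsum (does ∘ P?) xs
odd-filter P? [] = refl
odd-filter P? (x ∷ xs) with P? x
... | no _ = odd-filter P? xs
... | yes _ = trans (flipped (length (filter P? xs))) (cong not (odd-filter P? xs))
  where
  flipped : ∀ n → does (suc n ℕ.% 2 ℕP.≟ 1) ≡ not (does (n ℕ.% 2 ℕP.≟ 1))
  flipped zero = refl
  flipped (suc zero) = refl
  flipped (suc (suc n)) = flipped n

record Tracked (vs : List Vtx) : Set where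
  field
    d₀ : Dart
    ds₀ : List Dart
    ends≡ : map dartEnds (d₀ ∷ ds₀) ≡ steps vs
    chain : map tgt (d₀ ∷ ds₀) ≡ map src ds₀ ++ [ src d₀ ]
    unique : Unique (map src (d₀ ∷ ds₀))
    long : 3 ≤ length (d₀ ∷ ds₀)

zip-proj₁ : ∀ {A B : Set} (xs : List A) (ys : List B) → length xs ≡ length ys → map proj₁ (zip xs ys) ≡ xs
zip-proj₁ [] [] _ = refl
zip-proj₁ (x ∷ xs) (y ∷ ys) eq = cong (x ∷_) (zip-proj₁ xs ys (ℕP.suc-injective eq))

zip-proj₂ : ∀ {A B : Set} (xs : List A) (ys : List B) → length xs ≡ length ys → map proj₂ (zip xs ys) ≡ ys
zip-proj₂ [] [] _ = refl
zip-proj₂ (x ∷ xs) (y ∷ ys) eq = cong (y ∷_) (zip-proj₂ xs ys (ℕP.suc-injective eq))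

tracked : ∀ vs → 3 ≤ length vs → Unique vs → All (λ p → Adjacent (proj₁ p) (proj₂ p)) (steps vs) → Tracked vs
tracked (v ∷ vs) le u adj = build (darts adj)
  where
  lens : length (v ∷ vs) ≡ length (vs ++ v ∷ [])
  lens = trans (ℕP.+-comm 1 (length vs)) (sym (LP.length-++ vs))
  build : (∃ λ ds → map dartEnds ds ≡ steps (v ∷ vs)) → Tracked (v ∷ vs)
  build ([] , eq) = absurd (trans (cong (map proj₁) eq) (zip-proj₁ (v ∷ vs) _ lens))
    where
    absurd : [] ≡ v ∷ vs → Tracked (v ∷ vs)
    absurd ()
  build (d₀ ∷ ds₀ , eq) = record { d₀ = d₀ ; ds₀ = ds₀ ; ends≡ = eq ; chain = chain ; unique = unique ; long =
    long }
    where
    srcs : map vt (map src (d₀ ∷ ds₀)) ≡ v ∷ vs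
    srcs = trans (sym (LP.map-∘ (d₀ ∷ ds₀)))
      (trans (LP.map-∘ (d₀ ∷ ds₀)) (trans (cong (map proj₁) eq) (zip-proj₁ (v ∷ vs) _ lens)))
    tgts : map vt (map tgt (d₀ ∷ ds₀)) ≡ vs ++ v ∷ []
    tgts = trans (sym (LP.map-∘ (d₀ ∷ ds₀)))
      (trans (LP.map-∘ (d₀ ∷ ds₀)) (trans (cong (map proj₂) eq) (zip-proj₂ (v ∷ vs) _ lens)))
    chain : map tgt (d₀ ∷ ds₀) ≡ map src ds₀ ++ [ src d₀ ]
    chain = LP.map-injective vt-injective (trans tgts (trans
      (cong₂ (λ us u → us ++ u ∷ []) (sym (LP.∷-injectiveʳ srcs)) (sym (LP.∷-injectiveˡ srcs)))
        (sym (LP.map-++ vt (map src ds₀) [ src d₀ ]))))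
    unique : Unique (map src (d₀ ∷ ds₀))
    unique = AllPairs.map (λ ne eq → ne (cong vt eq)) (AllPairsP.map⁻ (subst Unique (sym srcs) u))
    long : 3 ≤ length (d₀ ∷ ds₀)
    long = ℕP.≤-trans le (ℕP.≤-reflexive
      (trans (cong length (sym srcs)) (trans (LP.length-map vt (map src (d₀ ∷ ds₀)))
      (LP.length-map src (d₀ ∷ ds₀)))))

Matches : LatticeCycle → Domain → Set
Matches C Δ = ∀ x → does (crossings C (pos x) ℕ.% 2 ℕP.≟ 1) ≡ Domain.I Δ x

interior-domain : ∀ C → Σ Domain (Matches C)
interior-domain C = T.domain , agree
  where
  open Tracked (tracked (LatticeCycle.verts C) (LatticeCycle.long C) (LatticeCycle.distinct C)
    (LatticeCycle.adjacent C))
  module T = Track d₀ ds₀ chain unique long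
  agree : ∀ x → does (crossings C (pos x) ℕ.% 2 ℕP.≟ 1) ≡ T.I x
  agree x = begin
    does (crossings C (pos x) ℕ.% 2 ℕP.≟ 1) ≡⟨ odd-filter (crosses? (pos x)) (steps (LatticeCycle.verts C)) ⟩
    xsum (does ∘ crosses? (pos x)) (steps (LatticeCycle.verts C))
      ≡⟨ cong (xsum (does ∘ crosses? (pos x))) (sym ends≡) ⟩
    xsum (does ∘ crosses? (pos x)) (map dartEnds T.ds) ≡⟨ xsum-map (does ∘ crosses? (pos x)) dartEnds T.ds ⟩
    xsum (does ∘ crosses? (pos x) ∘ dartEnds) T.ds ≡⟨ xsum-cong T.ds (λ d _ → crosses-dart x d) ⟩
    xsum (crosses x ∘ proj₁) T.ds ≡⟨ sym (xsum-map (crosses x) proj₁ T.ds) ⟩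
    T.I x ∎
    where open ≡-Reasoning

hor-injective : ∀ {x y x′ y′} → hor x y ≡ hor x′ y′ → x ≡ x′ × y ≡ y′
hor-injective refl = refl , refl

ver-injective : ∀ {x y x′ y′} → ver x y ≡ ver x′ y′ → x ≡ x′ × y ≡ y′
ver-injective refl = refl , refl

_≟ᵉ_ : (e e′ : Edge) → Dec (e ≡ e′)
hor x y ≟ᵉ hor x′ y′ = map′ (λ { (refl , refl) → refl }) hor-injective ((x ℤ.≟ x′) ×-dec (y ℤ.≟ y′))
ver x y ≟ᵉ ver x′ y′ = map′ (λ { (refl , refl) → refl }) ver-injective ((x ℤ.≟ x′) ×-dec (y ℤ.≟ y′))
hor _ _ ≟ᵉ ver _ _ = no λ ()
ver _ _ ≟ᵉ hor _ _ = no λ ()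

-- In the order of `hexEdges`: arcs leaving `x` alternate with arcs entering it, so the two
-- alternating patterns are the peak and the source.
boundary : Hx → List Ed
boundary x = (x , a) ∷ (x ⊟ c , c) ∷ (x , b) ∷ (x ⊟ a , a) ∷ (x , c) ∷ (x ⊟ b , b) ∷ []

hexEdges-enc : ∀ x → hexEdges (pos x) ≡ map enc (boundary x)
hexEdges-enc (i , j) = cong (hor (i ℤ.+ i ℤ.- j) j ∷_)
  (cong₂ _∷_ (cong₂ hor e₁ e₁′) (cong (ver (i ℤ.+ i ℤ.- j ℤ.+ + 2) j ∷_)
    (cong₂ _∷_ (cong₂ hor e₃ (ℤP.+-comm j (+ 1)))
      (cong (hor (i ℤ.+ i ℤ.- j) (j ℤ.+ + 1) ∷_) (cong (_∷ []) (cong (λ z → ver z j) e₅))))))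
  where
  e₁ : i ℤ.+ i ℤ.- j ℤ.+ + 1 ≡ i ℤ.+ i ℤ.- ℤ.pred j
  e₁ = solve 2 (λ i j → i :+ i :- j :+ con (+ 1) := i :+ i :- (con -1ℤ :+ j)) refl i j
  e₁′ : j ≡ ℤ.pred j ℤ.+ + 1
  e₁′ = solve 1 (λ j → j := con -1ℤ :+ j :+ con (+ 1)) refl j
  e₃ : i ℤ.+ i ℤ.- j ℤ.+ + 1 ≡ ℤ.suc i ℤ.+ ℤ.suc i ℤ.- ℤ.suc j
  e₃ = solve 2 (λ i j → i :+ i :- j :+ con (+ 1) := (con (+ 1) :+ i) :+ (con (+ 1) :+ i) :-
    (con (+ 1) :+ j)) refl i j
  e₅ : i ℤ.+ i ℤ.- j ≡ ℤ.pred i ℤ.+ ℤ.pred i ℤ.- j ℤ.+ + 2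
  e₅ = solve 2 (λ i j → i :+ i :- j := (con -1ℤ :+ i) :+ (con -1ℤ :+ i) :- j :+ con (+ 2)) refl i j

-- `Q` is not assumed decidable, so the minimum is obtained under a double negation; this suffices
-- for refuting an improvement.
eventually-least : (Q : ℕ → Set) → ∀ n → Q n → ¬ ¬ (∃ λ j → Q j × (∀ i → Q i → j ≤ i))
eventually-least Q n q none = never n q
  where
  never : ∀ n → ¬ Q n
  never = <-rec (λ n → ¬ Q n) λ n ih q → none (n , q , λ i r → ℕP.≮⇒≥ λ i<n → ih i<n r)

-- Transfer to matchings and anti-forcing sets given by lists of edges

module System (C : LatticeCycle) (Δ : Domain) (agree : Matches C Δ) where
  open OnDomain Δ using (region; lattice; size)
  open Contours lattice

  interior : ∀ x → Int x → Interior C (pos x)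
  interior x i = pos-valid x , does-true (crossings C (pos x) ℕ.% 2 ℕP.≟ 1) (trans (agree x) i)

  interior⁻ : ∀ x → Interior C (pos x) → Int x
  interior⁻ x (_ , odd) = trans (sym (agree x)) (dec-true (crossings C (pos x) ℕ.% 2 ℕP.≟ 1) odd)

  on-boundary : ∀ {x e} → Int x → e ∈ boundary x → HEdge e
  on-boundary i (here refl) = inj₁ i
  on-boundary {x} i (there (here refl)) = inj₂ (trans (cong I (⊟⊞ x c)) i)
  on-boundary i (there (there (here refl))) = inj₁ i
  on-boundary {x} i (there (there (there (here refl)))) = inj₂ (trans (cong I (⊟⊞ x a)) i)
  on-boundary i (there (there (there (there (here refl))))) = inj₁ i
  on-boundary {x} i (there (there (there (there (there (here refl)))))) = inj₂ (trans (cong I (⊟⊞ x b)) i)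

  tail∈boundary : ∀ x t → (x , t) ∈ boundary x
  tail∈boundary x a = here refl
  tail∈boundary x b = there (there (here refl))
  tail∈boundary x c = there (there (there (there (here refl))))

  head∈boundary : ∀ x t → (x ⊟ t , t) ∈ boundary x
  head∈boundary x a = there (there (there (here refl)))
  head∈boundary x b = there (there (there (there (there (here refl)))))
  head∈boundary x c = there (here refl)

  decode : ∀ {e} → EdgeOf C e → ∃ λ e′ → enc e′ ≡ e × HEdge e′
  decode {e} (h , hex , m) with pos-onto h (proj₁ hex)
  ... | x , refl with ∈-map⁻ enc (subst (λ es → e ∈ es) (hexEdges-enc x) m)
  ... | e′ , m′ , refl = e′ , refl , on-boundary (interior⁻ x hex) m′

  encode : ∀ e → HEdge e → EdgeOf C (enc e)
  encode (x , t) (inj₁ i) = pos x , interior x i ,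
    subst (enc (x , t) ∈_) (sym (hexEdges-enc x)) (∈-map⁺ enc (tail∈boundary x t))
  encode (x , t) (inj₂ i) = pos (x ⊞ t) , interior (x ⊞ t) i , subst (enc (x , t) ∈_) (sym (hexEdges-enc (x ⊞ t)))
    (subst (λ y → enc (y , t) ∈ map enc (boundary (x ⊞ t))) (⊞⊟ x t) (∈-map⁺ enc (head∈boundary (x ⊞ t) t)))

  incident : ∀ e s → Incident (vt (endAt e s)) (enc e)
  incident (x , t) s = go t s (ends-enc x t)
    where
    go : ∀ t s → ends (enc (x , t)) ≡ (vt (endAt (x , t) (lower t)) , vt (endAt (x , t) (opp (lower t)))) →
      Incident (vt (endAt (x , t) s)) (enc (x , t))
    go a dn eq = inj₁ (cong proj₁ eq)
    go a up eq = inj₂ (cong proj₂ eq)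
    go b dn eq = inj₁ (cong proj₁ eq)
    go b up eq = inj₂ (cong proj₂ eq)
    go c up eq = inj₁ (cong proj₁ eq)
    go c dn eq = inj₂ (cong proj₂ eq)

  incident⁻ : ∀ {v} e → Incident v (enc e) → ∃ λ s → v ≡ vt (endAt e s)
  incident⁻ (x , t) (inj₁ eq) = lower t , trans (sym eq) (cong proj₁ (ends-enc x t))
  incident⁻ (x , t) (inj₂ eq) = opp (lower t) , trans (sym eq) (cong proj₂ (ends-enc x t))

  join : ∀ {e e′ v} → Incident v (enc e) → Incident v (enc e′) → ∃ λ s → v ≡ vt (endAt e s) × endAt e′ s ≡ endAt e s
  join {e} {e′} p q with incident⁻ e p | incident⁻ e′ q
  ... | s , refl | s′ , eq with vt-injective eq
  ... | eq′ with trans (sym (endAt-sense e s)) (trans (cong proj₂ eq′) (endAt-sense e′ s′))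
  ... | refl = s , refl , sym eq′

  _∈ᵉ?_ : ∀ e M → Dec (e ∈ M)
  e ∈ᵉ? M = any? (e ≟ᵉ_) M

  fromList : List Edge → Matching
  fromList M x t = does (enc (x , t) ∈ᵉ? M)

  corner₁ : ∀ s x t → endAt (x ⊞ t , rot s t) s ≡ endAt (x , t) s
  corner₁ s x t = sym (endAt-head x t s)

  corner₂ : ∀ s x t → endAt (x ⊞ t ⊞ rot s t , rot (opp s) t) s ≡ endAt (x , t) s
  corner₂ s x t = trans (cong (λ u → endAt (x ⊞ t ⊞ rot s t , u) s) (sym (rot-rot s t)))
    (trans (sym (endAt-head (x ⊞ t) (rot s t) s)) (corner₁ s x t))

  at-corner : ∀ {e v} s → endAt e s ≡ v → Incident (vt v) (enc e)
  at-corner {e} s eq = subst (λ v → Incident (vt v) (enc e)) eq (incident e s)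

  fromList-PM : ∀ {M} → PerfectMatching C M → PM (fromList M)
  fromList-PM {M} (sub , cover , uniq) = record { inside = ins ; one = on }
    where
    φ : Matching
    φ = fromList M
    ins : ∀ x t → φ x t ≡ true → HEdge (x , t)
    ins x t q with decode (sub _ (does-true (enc (x , t) ∈ᵉ? M) q))
    ... | e′ , eq , h = subst HEdge (enc-injective eq) h
    on : ∀ s u x → Int u → OneAt φ s u x
    on s u x i = found (cover v (enc (u , x) , encode (u , x) (inj₁ i) , incident (u , x) s))
      where
      v : Vtx
      v = vt (endAt (u , x) s)
      e₁ e₂ e₃ : Ed
      e₁ = u , x
      e₂ = u ⊞ x , rot s x
      e₃ = u ⊞ x ⊞ rot s x , rot (opp s) x
      i₁ : Incident v (enc e₁)
      i₁ = incident e₁ s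
      i₂ : Incident v (enc e₂)
      i₂ = at-corner s (corner₁ s u x)
      i₃ : Incident v (enc e₃)
      i₃ = at-corner s (corner₂ s u x)
      yes! : ∀ e → enc e ∈ M → at φ e ≡ true
      yes! e m = dec-true (enc e ∈ᵉ? M) m
      no! : ∀ e e′ → enc e ∈ M → Incident v (enc e) → Incident v (enc e′) → proj₂ e ≢ proj₂ e′ → at φ e′ ≡ false
      no! e e′ m p q ne = dec-false (enc e′ ∈ᵉ? M) λ m′ → ne (cong proj₂ (enc-injective (uniq v _ _ m m′ p q)))
      n₁₂ : rot s x ≢ x
      n₁₂ = rot-moves s x
      n₁₃ : rot (opp s) x ≢ x
      n₁₃ = rot-moves (opp s) x
      n₂₃ : rot (opp s) x ≢ rot s x
      n₂₃ = rot-opp≢ s x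
      found : (Σ Edge λ e → e ∈ M × Incident v e) → OneAt φ s u x
      found (e , m , inc) with decode (sub e m)
      ... | e′ , refl , h with join {e₁} {e′} i₁ inc
      ... | s′ , eq , meet with trans (sym (endAt-sense e₁ s))
        (trans (cong proj₂ (vt-injective eq)) (endAt-sense e₁ s′))
      ... | refl with meeting s u x (proj₁ e′) (proj₂ e′) meet
      ... | inj₁ refl = one₁ (yes! e₁ m) (no! e₁ e₂ m i₁ i₂ (n₁₂ ∘ sym)) (no! e₁ e₃ m i₁ i₃ (n₁₃ ∘ sym))
      ... | inj₂ (inj₁ refl) = one₂ (no! e₂ e₁ m i₂ i₁ n₁₂) (yes! e₂ m) (no! e₂ e₃ m i₂ i₃ (n₂₃ ∘ sym))
      ... | inj₂ (inj₂ refl) = one₃ (no! e₃ e₁ m i₃ i₁ n₁₃) (no! e₃ e₂ m i₃ i₂ n₂₃) (yes! e₃ m)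

  edges : List Ed
  edges = concatMap boundary cells

  edges-complete : ∀ e → HEdge e → e ∈ edges
  edges-complete (x , t) (inj₁ i) = ∈-concatMap⁺ boundary
    (Any.map (λ { refl → tail∈boundary x t }) (cells-complete x i))
  edges-complete (x , t) (inj₂ i) = ∈-concatMap⁺ boundary (Any.map (λ { refl →
    subst (λ y → (y , t) ∈ boundary (x ⊞ t)) (⊞⊟ x t) (head∈boundary (x ⊞ t) t) }) (cells-complete (x ⊞ t) i))

  toList : Matching → List Edge
  toList φ = map enc (filter (λ e → at φ e BP.≟ true) edges)

  toList⁺ : ∀ {φ} → PM φ → ∀ e → at φ e ≡ true → enc e ∈ toList φ
  toList⁺ {φ} pm e q = ∈-map⁺ enc (∈-filter⁺ (λ e → at φ e BP.≟ true) (edges-complete e (PM.inside pm _ _ q)) q)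

  toList⁻ : ∀ {φ e} → e ∈ toList φ → ∃ λ e′ → e ≡ enc e′ × at φ e′ ≡ true
  toList⁻ {φ} m with ∈-map⁻ enc m
  ... | e′ , m′ , eq = e′ , eq , proj₂ (∈-filter⁻ (λ e → at φ e BP.≟ true) {xs = edges} m′)

  toList-∈ : ∀ {φ} e → enc e ∈ toList φ → at φ e ≡ true
  toList-∈ {φ} e m with toList⁻ {φ} m
  ... | e′ , eq , q = subst (λ e → at φ e ≡ true) (sym (enc-injective eq)) q

  toList-PM : ∀ {φ} → PM φ → PerfectMatching C (toList φ)
  toList-PM {φ} pm = sub , cover , uniq
    where
    open Matched pm
    sub : ∀ e → e ∈ toList φ → EdgeOf C e
    sub e m with toList⁻ {φ} m
    ... | e′ , refl , q = encode e′ (inside _ _ q)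
    cover : ∀ v → VertexOf C v → Σ Edge λ e → e ∈ toList φ × Incident v e
    cover v (e , E , inc) with decode E
    ... | (x , t) , refl , h with incident⁻ (x , t) inc
    ... | s , refl with one′ s x t h
    ... | one₁ q _ _ = _ , toList⁺ pm (x , t) q , incident (x , t) s
    ... | one₂ _ q _ = _ , toList⁺ pm _ q , at-corner s (corner₁ s x t)
    ... | one₃ _ _ q = _ , toList⁺ pm _ q , at-corner s (corner₂ s x t)
    uniq : ∀ v e e′ → e ∈ toList φ → e′ ∈ toList φ → Incident v e → Incident v e′ → e ≡ e′
    uniq v e e′ m m′ p q with toList⁻ {φ} m | toList⁻ {φ} m′
    ... | (x , t) , refl , f | f′@(y , t′) , refl , g with join {x , t} {f′} p q
    ... | s , _ , meet with meeting s x t y t′ meet | one′ s x t (inside _ _ f)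
    ... | inj₁ eq | _ = sym (cong enc eq)
    ... | inj₂ _ | one₂ o _ _ = absurdᵇ f o
    ... | inj₂ _ | one₃ o _ _ = absurdᵇ f o
    ... | inj₂ (inj₁ refl) | one₁ _ o _ = absurdᵇ g o
    ... | inj₂ (inj₂ refl) | one₁ _ _ o = absurdᵇ g o

  bool-ext : ∀ {p q} → (p ≡ true → q ≡ true) → (q ≡ true → p ≡ true) → p ≡ q
  bool-ext {true} {q} f g = sym (f refl)
  bool-ext {false} {false} f g = refl
  bool-ext {false} {true} f g = g refl

  fromList-toList : ∀ {φ} → PM φ → ∀ u x → fromList (toList φ) u x ≡ φ u x
  fromList-toList {φ} pm u x = bool-ext (λ q → toList-∈ {φ} (u , x) (does-true (enc (u , x) ∈ᵉ? toList φ) q))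
    (λ q → dec-true (enc (u , x) ∈ᵉ? toList φ) (toList⁺ pm (u , x) q))

  antiforcing-cong : ∀ {φ ψ S} → (∀ u x → φ u x ≡ ψ u x) → AntiForcing φ S → AntiForcing ψ S
  antiforcing-cong eq (free , unique) =
    All.map (λ q → trans (sym (eq _ _)) q) free , λ χ pm avoid u x → trans (unique χ pm avoid u x) (eq u x)

  decode-all : ∀ S → (∀ e → e ∈ S → EdgeOf C e) → ∃ λ S′ → map enc S′ ≡ S
  decode-all [] _ = [] , refl
  decode-all (e ∷ S) h =
    let e′ , eq , _ = decode (h e (here refl))
        S′ , eqs = decode-all S (λ e m → h e (there m))
    in e′ ∷ S′ , cong₂ _∷_ eq eqs

  antiforcing⁺ : ∀ {M S} → AntiForcingSet C M S → ∃ λ S′ → length S′ ≡ length S × AntiForcing (fromList M) S′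
  antiforcing⁺ {M} {S} (_ , avoids , forced) with decode-all S (λ e m → proj₁ (avoids e m))
  ... | S′ , refl = S′ , sym (LP.length-map enc S′) , All.tabulate free , unique
    where
    free : ∀ {e} → e ∈ S′ → fromList M (proj₁ e) (proj₂ e) ≡ false
    free {e} m = dec-false (enc e ∈ᵉ? M) (proj₂ (avoids (enc e) (∈-map⁺ enc m)))
    unique : ∀ ψ → PM ψ → All (λ e → at ψ e ≡ false) S′ → ∀ u x → ψ u x ≡ fromList M u x
    unique ψ pm off u x = bool-ext
      (λ q → dec-true (enc (u , x) ∈ᵉ? M) (proj₁ (same (enc (u , x))) (toList⁺ pm (u , x) q)))
      (λ q → toList-∈ {ψ} (u , x) (proj₂ (same (enc (u , x))) (does-true (enc (u , x) ∈ᵉ? M) q)))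
      where
      same : SameEdgeSet (toList ψ) M
      same = forced (toList ψ) (toList-PM pm) λ e m k → case ∈-map⁻ enc k of λ
        { (e′ , k′ , refl) → absurdᵇ (toList-∈ {ψ} e′ m) (All.lookup off k′) }

  antiforcing⁻ : ∀ {M S} → PerfectMatching C M → AntiForcing (fromList M) S → Unique S → All HEdge S →
    AntiForcingSet C M (map enc S)
  antiforcing⁻ {M} {S} pm (free , unique) u hs = UniqueP.map⁺ enc-injective u , avoids , forced
    where
    avoids : ∀ e → e ∈ map enc S → EdgeOf C e × e ∉ M
    avoids e m with ∈-map⁻ enc m
    ... | e′ , m′ , refl = encode e′ (All.lookup hs m′) , does-false (enc e′ ∈ᵉ? M) (All.lookup free m′)
    forced : ∀ M′ → PerfectMatching C M′ → (∀ e → e ∈ M′ → e ∉ map enc S) → SameEdgeSet M′ M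
    forced M′ pm′ off = λ e → to e , from e
      where
      same : ∀ u x → fromList M′ u x ≡ fromList M u x
      same = unique (fromList M′) (fromList-PM pm′)
        (All.tabulate λ {e} m → dec-false (enc e ∈ᵉ? M′) λ k → off (enc e) k (∈-map⁺ enc m))
      to : ∀ e → e ∈ M′ → e ∈ M
      to e m with decode (proj₁ pm′ e m)
      ... | e′ , refl , _ = does-true (enc e′ ∈ᵉ? M) (trans (sym (same _ _)) (dec-true (enc e′ ∈ᵉ? M′) m))
      from : ∀ e → e ∈ M → e ∈ M′
      from e m with decode (proj₁ pm e m)
      ... | e′ , refl , _ = does-true (enc e′ ∈ᵉ? M′) (trans (same _ _) (dec-true (enc e′ ∈ᵉ? M) m))

  module ForMatching {M : List Edge} (pm : PerfectMatching C M) where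
    φ : Matching
    φ = fromList M

    open Matched (fromList-PM pm) hiding (module Flip; module Contour)
    open Dichotomy region (fromList-PM pm) public using
      (contours; contours-unique; contours-antiforcing; contours-family; Tight; Improvement; dichotomy)

    contours-hedge : All HEdge contours
    contours-hedge = All.map (λ cl → Closed.hedge cl 0) (Family.closed contours-family)

    contours-set : AntiForcingSet C M (map enc contours)
    contours-set = antiforcing⁻ pm contours-antiforcing contours-unique contours-hedge

    in-M : ∀ {e} e′ → e ≡ enc e′ → at φ e′ ≡ true → e ∈ M
    in-M e′ refl = does-true (enc e′ ∈ᵉ? M)

    out-M : ∀ {e} e′ → e ≡ enc e′ → at φ e′ ≡ false → e ∉ M
    out-M e′ refl = does-false (enc e′ ∈ᵉ? M)

    matched : ∀ {e} e′ → e ≡ enc e′ → e ∈ M → at φ e′ ≡ true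
    matched e′ refl = dec-true (enc e′ ∈ᵉ? M)

    e1≡ : ∀ x → e1 (pos x) ≡ enc (x ⊟ c , c)
    e1≡ x = LP.∷-injectiveˡ (LP.∷-injectiveʳ (hexEdges-enc x))

    e3≡ : ∀ x → e3 (pos x) ≡ enc (x ⊟ a , a)
    e3≡ x = LP.∷-injectiveˡ (LP.∷-injectiveʳ (LP.∷-injectiveʳ (LP.∷-injectiveʳ (hexEdges-enc x))))

    e5≡ : ∀ x → e5 (pos x) ≡ enc (x ⊟ b , b)
    e5≡ x = LP.∷-injectiveˡ (LP.∷-injectiveʳ
      (LP.∷-injectiveʳ (LP.∷-injectiveʳ (LP.∷-injectiveʳ (LP.∷-injectiveʳ (hexEdges-enc x))))))

    alternating⁺ : ∀ x → Int x → AlternatingHex x → Alternating M (pos x)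
    alternating⁺ x i (peak p) = inj₁ (in-M (x , a) refl (p a) , out-M (x ⊟ c , c) (e1≡ x) (peak-free i p c) , in-M (x , b) refl (p b) ,
      out-M (x ⊟ a , a) (e3≡ x) (peak-free i p a) , in-M (x , c) refl (p c) , out-M (x ⊟ b , b) (e5≡ x) (peak-free i p b))
    alternating⁺ x i (source p) = inj₂ (out-M (x , a) refl (f a) , in-M (x ⊟ c , c) (e1≡ x) (p c) , out-M (x , b) refl (f b) ,
      in-M (x ⊟ a , a) (e3≡ x) (p a) , out-M (x , c) refl (f c) , in-M (x ⊟ b , b) (e5≡ x) (p b))
      where
      f : ∀ t → φ x t ≡ false
      f t = proj₁ (source-free i p up t)

    alternating⁻ : ∀ x → Alternating M (pos x) → AlternatingHex x
    alternating⁻ x (inj₁ (p , _ , q , _ , r , _)) =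
      peak λ { a → matched (x , a) refl p ; b → matched (x , b) refl q ; c → matched (x , c) refl r }
    alternating⁻ x (inj₂ (_ , p , _ , q , _ , r)) =
      source λ { a → matched (x ⊟ a , a) (e3≡ x) q ; b → matched (x ⊟ b , b) (e5≡ x) r ; c →
        matched (x ⊟ c , c) (e1≡ x) p }

    allDir? : (f : Dir → Bool) → Dec (∀ t → f t ≡ true)
    allDir? f with anyDir? (λ t → f t BP.≟ false)
    ... | yes (t , q) = no λ h → absurdᵇ (h t) q
    ... | no n = yes λ t → BP.¬-not λ q → n (t , q)

    alternating? : ∀ x → Dec (AlternatingHex x)
    alternating? x = map′ [ source , peak ]′ (λ { (source p) → inj₁ p ; (peak p) → inj₂ p })
      (allDir? (λ t → φ (x ⊟ t) t) ⊎-dec allDir? (φ x))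

    hexagons : List Hx
    hexagons = filter alternating? cells

    hexagons-alternating : All (λ x → Int x × AlternatingHex x) hexagons
    hexagons-alternating = All.tabulate λ {x} m → let p , q = ∈-filter⁻ alternating? {xs = cells} m in cells-sound x p , q

    hexagons-complete : ∀ x → Int x → AlternatingHex x → x ∈ hexagons
    hexagons-complete x i p = ∈-filter⁺ alternating? (cells-complete x i) p

    hexagons-unique : Unique hexagons
    hexagons-unique = UniqueP.filter⁺ alternating? cells-unique

    fries : ∀ {n} → length hexagons ≡ n → Fr C M n
    fries len = map pos hexagons , UniqueP.map⁺ pos-injective hexagons-unique , (λ h → to h , from h) ,
      trans (LP.length-map pos hexagons) len
      where
      to : ∀ h → h ∈ map pos hexagons → HexOf C h × Alternating M h
      to h m with ∈-map⁻ pos m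
      ... | x , k , refl = let i , p = All.lookup hexagons-alternating k in interior x i , alternating⁺ x i p
      from : ∀ h → HexOf C h × Alternating M h → h ∈ map pos hexagons
      from h (hex , alt) with pos-onto h (proj₁ hex)
      ... | x , refl = ∈-map⁺ pos (hexagons-complete x (interior⁻ x hex) (alternating⁻ x alt))

    module _ {n : ℕ} (af : AfM C M n) where

      hexagons≤ : length hexagons ≤ n
      hexagons≤ with proj₁ af
      ... | S , set , refl with antiforcing⁺ set
      ... | S′ , len , af′ = subst₂ _≤_ (LP.length-map rep hexagons) len
            (weak-duality (alternating-family hexagons-unique hexagons-alternating) af′)

      ≤contours : n ≤ length contours
      ≤contours = subst (n ≤_) (LP.length-map enc contours) (proj₂ af (map enc contours) contours-set)

      -- The number of hexagons is at most `n`, `n` is at most the number of contours, and `Tight`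
      -- supplies as many alternating hexagons as contours.
      tight : Tight → length hexagons ≡ n
      tight (xs , u , alt , len) = ℕP.≤-antisym hexagons≤ (ℕP.≤-trans ≤contours (ℕP.≤-trans (ℕP.≤-reflexive len)
        (Unique-⊆-length u λ x m → let i , p = All.lookup alt m in hexagons-complete x i p)))

  -- `max` speaks of anti-forcing numbers, so a minimum anti-forcing set of the new matching is
  -- assumed. Its size is at least 2 plus the number of contours, hence at least `2 + n`, which
  -- exceeds `N`.
  no-improvement : ∀ {M n N} (pm : PerfectMatching C M) → AfM C M n → AfMax C N → N ≤ suc n →
    ¬ ForMatching.Improvement pm
  no-improvement {M} {n} {N} pm af (_ , max) N≤ (φ′ , pm′ , bound) =
    eventually-least (λ k → Σ (List Edge) λ S → AntiForcingSet C M′ S × length S ≡ k)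
      _ (_ , ForMatching.contours-set pmM′ , refl)
        λ { (j , (S , set , len) , least) → refute S set len (λ S′ set′ → least _ (S′ , set′ , refl)) }
    where
    M′ : List Edge
    M′ = toList φ′
    pmM′ : PerfectMatching C M′
    pmM′ = toList-PM pm′
    refute : ∀ {j} S → AntiForcingSet C M′ S → length S ≡ j → (∀ S′ → AntiForcingSet C M′ S′ → j ≤ length S′) → ⊥
    refute {j} S set len least with antiforcing⁺ set
    ... | S′ , len′ , af′ = ℕP.<⇒≱ (ℕP.n<1+n (suc (length (ForMatching.contours pm)))) (begin
      2 ℕ.+ length (ForMatching.contours pm) ≤⟨ bound S′ (antiforcing-cong (fromList-toList pm′) af′) ⟩
      length S′ ≡⟨ trans len′ len ⟩
      j ≤⟨ max M′ j pmM′ ((S , set , len) , least) ⟩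
      N ≤⟨ N≤ ⟩
      suc n ≤⟨ s≤s (ForMatching.≤contours pm af) ⟩
      suc (length (ForMatching.contours pm)) ∎)
      where open ℕP.≤-Reasoning

theorem1p7 : (C : LatticeCycle) → HasPerfectMatching C →
    (M : List Edge) → PerfectMatching C M →
    (a A : ℕ) → AfM C M a → AfMax C A →
    (a ≡ A ⊎ suc a ≡ A) → Fr C M a
theorem1p7 C _ M pm n N af max near = decide (S.ForMatching.dichotomy pm)
  where
  module S = System C (proj₁ (interior-domain C)) (proj₂ (interior-domain C))
  N≤ : N ≤ suc n
  N≤ = [ (λ { refl → ℕP.n≤1+n n }) , (λ { refl → ℕP.≤-refl }) ]′ near
  decide : S.ForMatching.Tight pm ⊎ S.ForMatching.Improvement pm → Fr C M n
  decide (inj₁ t) = S.ForMatching.fries pm (S.ForMatching.tight pm af t)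
  decide (inj₂ i) = ⊥-elim (S.no-improvement pm af max N≤ i)
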